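{- For each integer $r \ge 2$ there is a constant $c_r$, with $c_r = (1+o(1))\frac{\sqrt{r}}{2}$ as $r \to \infty$, and an online algorithm that $r$-colors the edges of the online random edge process on $n$ vertices such that for any $\epsilon > 0$ there is $c_\epsilon>0$ for which, with high probability, after $(c_r + \epsilon)n$ rounds every color class contains a connected component of order at least $c_\epsilon n$.
   Context: Online random edge process: there are $n$ vertices and a sequence of rounds; in each round one edge arrives, chosen uniformly at random among all pairs of distinct vertices, independently of previous rounds (repetitions are possible). The algorithm must color each edge with one of $r$ colors upon arrival, using only the history so far. "With high probability" means with probability tending to $1$ as $n\to\infty$. -}

module Defs where

open import Data.Nat as ℕ using (ℕ; zero; suc; _^_)
open import Data.Nat.Combinatorics using (_C_)
open import Data.Fin as Fin using (Fin)
open import Data.Fin.Subset using (Subset; _∈_; ∣_∣)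
open import Data.Integer as ℤ using (ℤ; +_)
open import Data.Rational as ℚ using (ℚ; _/_; floor; 0ℚ; 1ℚ)
open import Data.Product using (Σ; ∃; _×_; _,_; proj₁; proj₂)
open import Data.Sum using (_⊎_)
open import Data.List as List using (List; []; _∷_; _++_; [_]; length)
open import Data.List.Membership.Propositional using () renaming (_∈_ to _∈ₗ_)
open import Data.List.Relation.Unary.All using (All)
open import Data.List.Relation.Unary.Unique.Propositional using (Unique)
open import Data.Vec as Vec using (Vec)
open import Relation.Binary.PropositionalEquality using (_≡_)

toℚ : ℕ → ℚ
toℚ n = (+ n) / 1

-- An (unordered) edge on vertex set Fin n: a pair (i , j) with i < j.
-- A uniformly random pair of distinct vertices = a uniformly random element of Edge n.
Edge : ℕ → Set
Edge n = Σ (Fin n × Fin n) (λ p → proj₁ p Fin.< proj₂ p)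

-- A deterministic online edge-colouring algorithm with r colours:
-- given n, the history of previously arrived edges (in arrival order) and the
-- newly arrived edge, it returns the colour of the new edge.
OnlineAlg : ℕ → Set
OnlineAlg r = (n : ℕ) → List (Edge n) → Edge n → Fin r

runFrom : ∀ {r} → OnlineAlg r → (n : ℕ) → List (Edge n) → List (Edge n) → List (Edge n × Fin r)
runFrom alg n hist [] = []
runFrom alg n hist (e ∷ es) = (e , alg n hist e) ∷ runFrom alg n (hist ++ [ e ]) es

run : ∀ {r} → OnlineAlg r → (n : ℕ) → List (Edge n) → List (Edge n × Fin r)
run alg n es = runFrom alg n [] es

Adj : ∀ {n r} → List (Edge n × Fin r) → Fin r → Fin n → Fin n → Set
Adj {n} G c u v = Σ (Edge n) λ e → (e , c) ∈ₗ G ×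
  ((proj₁ (proj₁ e) ≡ u × proj₂ (proj₁ e) ≡ v) ⊎ (proj₁ (proj₁ e) ≡ v × proj₂ (proj₁ e) ≡ u))

data Reach {n r} (G : List (Edge n × Fin r)) (c : Fin r) (u : Fin n) : Fin n → Set where
  here : Reach G c u u
  step : ∀ {v w} → Reach G c u v → Adj G c v w → Reach G c u w

HasComponentOfOrder≥ : ∀ {n r} → List (Edge n × Fin r) → Fin r → ℚ → Set
HasComponentOfOrder≥ {n} G c K =
  Σ (Fin n) λ v → Σ (Subset n) λ S → (K ℚ.≤ toℚ ∣ S ∣) × (∀ u → u ∈ S → Reach G c v u)

-- Probability (under the uniform random edge process with m rounds) of the
-- event P is at least p: there is a list of distinct arrival sequences of
-- length m, all in P, whose number is at least p times the total number
-- (n C 2)^m of arrival sequences.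
ProbAtLeast : (n m : ℕ) → (Vec (Edge n) m → Set) → ℚ → Set
ProbAtLeast n m P p = Σ (List (Vec (Edge n) m)) λ L →
  Unique L × All P L × (p ℚ.* toℚ ((n C 2) ^ m) ℚ.≤ toℚ (length L))

WHP : (m : ℕ → ℕ) → ((n : ℕ) → Vec (Edge n) (m n) → Set) → Set
WHP m P = ∀ (δ : ℚ) → 0ℚ ℚ.< δ → Σ ℕ λ N → ∀ n → N ℕ.≤ n → ProbAtLeast n (m n) (P n) (1ℚ ℚ.- δ)

roundsFor : ℚ → ℕ → ℕ
roundsFor q n = ℤ.∣ floor (q ℚ.* toℚ n) ∣

-- c r = (1 + o(1)) √r / 2 as r → ∞ : for every 0 < δ < 1 there is R such that
-- for all r ≥ R, (1-δ) √r/2 ≤ c r ≤ (1+δ) √r/2, written without square roots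
-- as 0 ≤ c r, (1-δ)² r ≤ 4 (c r)² ≤ (1+δ)² r.
AsympSqrtHalf : (ℕ → ℚ) → Set
AsympSqrtHalf c = ∀ (δ : ℚ) → 0ℚ ℚ.< δ → δ ℚ.< 1ℚ → Σ ℕ λ R → ∀ r → R ℕ.≤ r →
  (0ℚ ℚ.≤ c r) ×
  (((1ℚ ℚ.- δ) ℚ.* (1ℚ ℚ.- δ)) ℚ.* toℚ r ℚ.≤ toℚ 4 ℚ.* (c r ℚ.* c r)) ×
  (toℚ 4 ℚ.* (c r ℚ.* c r) ℚ.≤ ((1ℚ ℚ.+ δ) ℚ.* (1ℚ ℚ.+ δ)) ℚ.* toℚ r)

{-# OPTIONS --safe #-}
-- Fix k parts of q points each, with q coprime to 1, …, k - 1, and blow every point up into a class of about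
-- n/(kq) vertices. The q² lines x = a + b j (mod q) of this transversal design meet pairwise in at most one point,
-- so colouring an edge between different parts by the line through its ends gives, for any r ≤ q², r edge-disjoint
-- colour classes, each a complete k-partite graph on about n/q vertices. For large k such a graph behaves like a
-- complete one, so its component structure becomes supercritical after (1 + o(1)) qn/2 ≈ √r n/2 rounds. Taking
-- q ≡ 1 modulo k! with k growing slowly with r makes q = (1 + o(1)) √r without any information on primes.
--
-- For a single colour class, with component sizes |C(v)|, the generating function ∑ (1 - x^|C(v)|) solves a Burgers
-- equation in the mean-field limit and is therefore preserved along characteristics; moving x along the
-- characteristic from 1 - μ to 1 - κ (κ ≪ μ) takes about half as many rounds as the class has vertices, divided by
-- its edge density, and leaves linearly many vertices in components of large constant order. A further small
-- proportion of n rounds joins these to a linear component, since each round merges two of them with probability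
-- bounded below. Both phases are controlled by supermartingales with bounded increments and Chebyshev's inequality.
module Submission where

open import Defs
open import Data.Nat as ℕ using (ℕ; zero; suc; NonZero; _/_; _%_; _!)
open import Data.Fin using (Fin)
open import Data.Rational as ℚ using (ℚ; 0ℚ)
open import Data.Product using (Σ; _×_)
open import Data.Vec using (toList)

open import Data.Bool as Bool using (Bool; true; false; _∧_; not; if_then_else_)
import Data.Bool.Properties as Bool
open import Data.Fin as Fin using (zero; suc; toℕ)
import Data.Fin.Properties as Fin
open import Data.Fin.Subset using (∣_∣)
open import Data.Integer as ℤ using (ℤ)
import Data.Integer.Divisibility.Signed as ℤ
import Data.Integer.Properties as ℤ
import Data.Integer.Tactic.RingSolver as ℤ-Solver
open import Data.List as List using (List; []; _∷_; _++_; length; map; allFin; tabulate; filter; cartesianProductWith)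
open import Data.List.Properties using (map-tabulate; length-++; length-map; length-tabulate)
open import Data.List.Membership.Propositional using () renaming (_∈_ to _∈ₗ_)
open import Data.List.Membership.Propositional.Properties using (∈-allFin; ∈-map⁻)
open import Data.List.Relation.Unary.All as All using (All; []; _∷_)
import Data.List.Relation.Unary.All.Properties as All
open import Data.List.Relation.Unary.AllPairs using ([]; _∷_)
open import Data.List.Relation.Unary.Any using (here; there)
open import Data.List.Relation.Unary.Unique.Propositional using (Unique)
import Data.List.Relation.Unary.Unique.Propositional.Properties as Unique
open import Data.Nat.Combinatorics using (_C_; nC1≡n; nCk+nC[k+1]≡[n+1]C[k+1])
open import Data.Nat.Coprimality using (Coprime; coprime-divisor)
open import Data.Nat.Divisibility as ℕ using (divides)
open import Data.Nat.DivMod using (m≡m%n+[m/n]*n; m%n<n; m<n*o⇒m/o<n; m<n⇒m%n≡m; m<n⇒m/n≡0; m≥n⇒m/n>0; m*n/n≡m; m/n*n≤m; [m+kn]%n≡m%n; +-distrib-/-∣ʳ; +-distrib-/-∣ˡ)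
import Data.Nat.Properties as ℕ
import Data.Nat.Tactic.RingSolver as ℕ-Solver
open import Data.Product using (∃; _,_; proj₁; proj₂)
open import Data.Rational hiding (_/_; truncate; show; ∣_∣; NonZero; ℚ; 0ℚ)
open import Data.Rational.Properties
open import Data.Rational.Unnormalised as ℚᵘ using (mkℚᵘ; *≡*)
import Data.Rational.Unnormalised.Properties as ℚᵘ
open import Data.Sum using (_⊎_; inj₁; inj₂; [_,_])
open import Data.Unit using (⊤; tt)
open import Data.Vec as Vec using (Vec; []; _∷_)
open import Data.Vec.Properties using (∷-injective; lookup∘tabulate; []=⇒lookup)
open import Function using (_∘_; id)
open import Level using (0ℓ)
open import Relation.Binary.PropositionalEquality hiding ([_])
open import Relation.Nullary
open import Relation.Nullary.Decidable using (_×-dec_)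
open import Tactic.RingSolver using (solve-∀)
open import Tactic.RingSolver.Core.AlmostCommutativeRing using (fromCommutativeRing; AlmostCommutativeRing)

-- Rational arithmetic and finite sums

-- The colour of an edge depends on the edge alone, so each colour class can be followed by itself
-- through all rounds, edges of other colours leaving its state unchanged; a union bound over the
-- colours finishes. Write a for the number of vertices of a colour class, E for the number of pairs
-- and P(x) for ∑ x^|C(v)|. In the mean field P loses x P′(x) (a - P) / E per round, so it stays
-- constant if x moves by x (a - P) / E. Initially P = a x, so from x = 1 - μ on the difference a -
-- P stays μ a, and x comes near 1 after about E / a ≈ q n / 2 rounds. The obstacle is that edges
-- inside a part or inside a component are wasted. As long as all components have order at most l n,
-- with l n the order of one blown-up point, this lowers a - P by a few multiples of l n. So μ must
-- be small, as x ≥ 1 - μ is a factor of the speed, while μ a must be many times l n; k = s² parts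
-- and μ = 1 / s make it about s l n. Stopping at 1 - κ keeps c x^c bounded independently of n, and
-- with it the increments.

ring : AlmostCommutativeRing 0ℓ 0ℓ
ring = fromCommutativeRing +-*-commutativeRing (λ x → dec⇒maybe (0ℚ ≟ x))

2ℚ : ℚ
2ℚ = 1ℚ + 1ℚ

-- The form in which most inequalities below are proved: the difference is written as a sum of
-- visibly nonnegative terms, and the remaining identity is left to the ring solver.
≤-cert : ∀ {p q} d → 0ℚ ≤ d → p + d ≡ q → p ≤ q
≤-cert {p} d 0≤d refl = subst (_≤ p + d) (+-identityʳ p) (+-monoʳ-≤ p 0≤d)

+-nonneg : ∀ {p q} → 0ℚ ≤ p → 0ℚ ≤ q → 0ℚ ≤ p + q
+-nonneg = +-mono-≤

*-nonneg : ∀ {p q} → 0ℚ ≤ p → 0ℚ ≤ q → 0ℚ ≤ p * q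
*-nonneg {p} {q} 0≤p 0≤q =
  nonNegative⁻¹ (p * q) {{nonNeg*nonNeg⇒nonNeg p {{nonNegative 0≤p}} q {{nonNegative 0≤q}}}}

*-positive : ∀ {p q} → 0ℚ < p → 0ℚ < q → 0ℚ < p * q
*-positive {p} {q} 0<p 0<q = positive⁻¹ (p * q) {{pos*pos⇒pos p {{positive 0<p}} q {{positive 0<q}}}}

p≤q⇒0≤q-p : ∀ {p q} → p ≤ q → 0ℚ ≤ q - p
p≤q⇒0≤q-p {p} {q} p≤q = subst (_≤ q - p) (+-inverseʳ p) (+-monoˡ-≤ (- p) p≤q)

0≤q-p⇒p≤q : ∀ {p q} → 0ℚ ≤ q - p → p ≤ q
0≤q-p⇒p≤q {p} {q} h = ≤-cert (q - p) h (eq p q)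
  where eq : ∀ p q → p + (q - p) ≡ q
        eq = solve-∀ ring

*-mono-≤ : ∀ {p q r s} → 0ℚ ≤ p → 0ℚ ≤ s → p ≤ q → r ≤ s → p * r ≤ q * s
*-mono-≤ {p} {q} {r} {s} 0≤p 0≤s p≤q r≤s = ≤-trans
  (*-monoˡ-≤-nonNeg p {{nonNegative 0≤p}} r≤s) (*-monoʳ-≤-nonNeg s {{nonNegative 0≤s}} p≤q)

*-monoˡ : ∀ {p q} r → 0ℚ ≤ r → p ≤ q → r * p ≤ r * q
*-monoˡ r 0≤r = *-monoˡ-≤-nonNeg r {{nonNegative 0≤r}}

*-cancelˡ : ∀ {p q} r → 0ℚ < r → r * p ≤ r * q → p ≤ q
*-cancelˡ r 0<r = *-cancelˡ-≤-pos r {{positive 0<r}}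

square-nonneg : ∀ p → 0ℚ ≤ p * p
square-nonneg p with ≤-total 0ℚ p
... | inj₁ 0≤p = *-nonneg 0≤p 0≤p
... | inj₂ p≤0 = subst (0ℚ ≤_) (eq p) (*-nonneg (neg-antimono-≤ p≤0) (neg-antimono-≤ p≤0))
  where eq : ∀ p → (- p) * (- p) ≡ p * p
        eq = solve-∀ ring

square-bound : ∀ {p b} → - b ≤ p → p ≤ b → p * p ≤ b * b
square-bound {p} {b} h₁ h₂ =
  ≤-cert ((b - p) * (p - - b)) (*-nonneg (p≤q⇒0≤q-p h₂) (p≤q⇒0≤q-p h₁)) (eq p b)
  where eq : ∀ p b → p * p + (b - p) * (p - - b) ≡ b * b
        eq = solve-∀ ring

reciprocal : ∀ p → 0ℚ < p → Σ ℚ λ r → 0ℚ < r × p * r ≡ 1ℚ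
reciprocal p 0<p =
  1/ p , positive⁻¹ (1/ p) {{1/pos⇒pos p}} , *-inverseʳ p
  where instance _ = positive 0<p
                 _ = pos⇒nonZero p

0<1 : 0ℚ < 1ℚ
0<1 = positive⁻¹ 1ℚ

0≤1 : 0ℚ ≤ 1ℚ
0≤1 = <⇒≤ 0<1

0≤2 : 0ℚ ≤ 2ℚ
0≤2 = nonNegative⁻¹ 2ℚ

abstract
  -- An opaque copy of `toℚ`, so that no computation ever unfolds into normalised fractions;
  -- `fromℕ≡toℚ` leads back to the statement.
  fromℕ : ℕ → ℚ
  fromℕ = toℚ

  fromℕ≡toℚ : ∀ n → fromℕ n ≡ toℚ n
  fromℕ≡toℚ n = refl

  toℚᵘ-fromℕ : ∀ n → toℚᵘ (fromℕ n) ℚᵘ.≃ mkℚᵘ (ℤ.+ n) 0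
  toℚᵘ-fromℕ n = toℚᵘ-fromℚᵘ (mkℚᵘ (ℤ.+ n) 0)

  fromℕ-0 : fromℕ 0 ≡ 0ℚ
  fromℕ-0 = refl

  fromℕ-1 : fromℕ 1 ≡ 1ℚ
  fromℕ-1 = refl

fromℕ-+ : ∀ m n → fromℕ (m ℕ.+ n) ≡ fromℕ m + fromℕ n
fromℕ-+ m n = toℚᵘ-injective (ℚᵘ.≃-trans (toℚᵘ-fromℕ (m ℕ.+ n)) (ℚᵘ.≃-sym (ℚᵘ.≃-trans
  (toℚᵘ-homo-+ (fromℕ m) (fromℕ n)) (ℚᵘ.≃-trans (ℚᵘ.+-cong (toℚᵘ-fromℕ m) (toℚᵘ-fromℕ n))
  (*≡* (cong (ℤ._* ℤ.+ 1) (trans (cong₂ ℤ._+_ (ℤ.*-identityʳ (ℤ.+ m)) (ℤ.*-identityʳ (ℤ.+ n))) (sym (ℤ.pos-+ m n)))))))))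

fromℕ-* : ∀ m n → fromℕ (m ℕ.* n) ≡ fromℕ m * fromℕ n
fromℕ-* m n = toℚᵘ-injective (ℚᵘ.≃-trans (toℚᵘ-fromℕ (m ℕ.* n)) (ℚᵘ.≃-sym (ℚᵘ.≃-trans
  (toℚᵘ-homo-* (fromℕ m) (fromℕ n)) (ℚᵘ.≃-trans (ℚᵘ.*-cong (toℚᵘ-fromℕ m) (toℚᵘ-fromℕ n))
  (*≡* (cong (ℤ._* ℤ.+ 1) (sym (ℤ.pos-* m n))))))))

fromℕ-suc : ∀ n → fromℕ (suc n) ≡ 1ℚ + fromℕ n
fromℕ-suc n = trans (fromℕ-+ 1 n) (cong (_+ fromℕ n) fromℕ-1)

fromℕ-nonneg : ∀ n → 0ℚ ≤ fromℕ n
fromℕ-nonneg zero = ≤-reflexive (sym fromℕ-0)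
fromℕ-nonneg (suc n) = subst (0ℚ ≤_) (sym (fromℕ-suc n)) (+-nonneg 0≤1 (fromℕ-nonneg n))

fromℕ-mono : ∀ {m n} → m ℕ.≤ n → fromℕ m ≤ fromℕ n
fromℕ-mono {m} {n} m≤n = ≤-cert (fromℕ (n ℕ.∸ m)) (fromℕ-nonneg (n ℕ.∸ m))
  (trans (sym (fromℕ-+ m (n ℕ.∸ m))) (cong fromℕ (ℕ.m+[n∸m]≡n m≤n)))

fromℕ-suc-positive : ∀ n → 0ℚ < fromℕ (suc n)
fromℕ-suc-positive n = <-≤-trans (subst (0ℚ <_) (sym fromℕ-1) 0<1) (fromℕ-mono (ℕ.s≤s ℕ.z≤n))

p<1+p : ∀ p → p < 1ℚ + p
p<1+p p = subst (_< 1ℚ + p) (+-identityˡ p) (+-monoˡ-< p 0<1)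

fromℕ-cancel-≤ : ∀ {m n} → fromℕ m ≤ fromℕ n → m ℕ.≤ n
fromℕ-cancel-≤ {m} {n} h with m ℕ.≤? n
... | yes m≤n = m≤n
... | no m≰n = contradiction
  (<-≤-trans (p<1+p (fromℕ n)) (≤-trans (subst (_≤ fromℕ m) (fromℕ-suc n) (fromℕ-mono (ℕ.≰⇒> m≰n))) h))
  (<-irrefl refl)

-- The absolute value of the numerator serves as the bound, as the denominator is at least 1.
archimedean : ∀ p → Σ ℕ λ n → p ≤ fromℕ n
archimedean p@record{} = ℤ.∣ ↥ p ∣ , toℚᵘ-cancel-≤ (ℚᵘ.≤-respʳ-≃ (ℚᵘ.≃-sym (toℚᵘ-fromℕ ℤ.∣ ↥ p ∣))
  (ℚᵘ.*≤* (subst (ℤ._≤ ℤ.+ ℤ.∣ ↥ p ∣ ℤ.* ↧ p) (sym (ℤ.*-identityʳ (↥ p)))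
   (ℤ.≤-trans (i≤∣i∣ (↥ p)) (subst (ℤ.+ ℤ.∣ ↥ p ∣ ℤ.≤_) (ℤ.pos-* ℤ.∣ ↥ p ∣ (↧ₙ p)) (ℤ.+≤+ (ℕ.m≤m*n _ (↧ₙ p))))))))
  where i≤∣i∣ : ∀ i → i ℤ.≤ ℤ.+ ℤ.∣ i ∣
        i≤∣i∣ (ℤ.+ n) = ℤ.≤-refl
        i≤∣i∣ ℤ.-[1+ n ] = ℤ.-≤+

∑ : ∀ {A : Set} → List A → (A → ℚ) → ℚ
∑ [] f = 0ℚ
∑ (x ∷ xs) f = f x + ∑ xs f

module _ {A : Set} where

  ∑-cong : ∀ (xs : List A) {f g} → (∀ x → f x ≡ g x) → ∑ xs f ≡ ∑ xs g
  ∑-cong [] h = refl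
  ∑-cong (x ∷ xs) h = cong₂ _+_ (h x) (∑-cong xs h)

  ∑-mono : ∀ (xs : List A) {f g} → (∀ x → f x ≤ g x) → ∑ xs f ≤ ∑ xs g
  ∑-mono [] h = ≤-refl
  ∑-mono (x ∷ xs) h = +-mono-≤ (h x) (∑-mono xs h)

  ∑-+ : ∀ (xs : List A) f g → ∑ xs (λ x → f x + g x) ≡ ∑ xs f + ∑ xs g
  ∑-+ [] f g = refl
  ∑-+ (x ∷ xs) f g = trans (cong (λ z → f x + g x + z) (∑-+ xs f g)) (eq (f x) (g x) (∑ xs f) (∑ xs g))
    where eq : ∀ a b c d → a + b + (c + d) ≡ a + c + (b + d)
          eq = solve-∀ ring

  ∑-*ˡ : ∀ (xs : List A) c f → ∑ xs (λ x → c * f x) ≡ c * ∑ xs f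
  ∑-*ˡ [] c f = sym (*-zeroʳ c)
  ∑-*ˡ (x ∷ xs) c f = trans (cong (λ z → c * f x + z) (∑-*ˡ xs c f)) (sym (*-distribˡ-+ c (f x) (∑ xs f)))

  ∑-- : ∀ (xs : List A) f g → ∑ xs (λ x → f x - g x) ≡ ∑ xs f - ∑ xs g
  ∑-- [] f g = refl
  ∑-- (x ∷ xs) f g = trans (cong (λ z → f x - g x + z) (∑-- xs f g)) (eq (f x) (g x) (∑ xs f) (∑ xs g))
    where eq : ∀ a b c d → a - b + (c - d) ≡ a + c - (b + d)
          eq = solve-∀ ring

  ∑-const : ∀ (xs : List A) c → ∑ xs (λ _ → c) ≡ fromℕ (length xs) * c
  ∑-const [] c = sym (trans (cong (_* c) fromℕ-0) (*-zeroˡ c))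
  ∑-const (x ∷ xs) c = trans (cong (_+_ c) (∑-const xs c))
    (trans (eq c (fromℕ (length xs))) (cong (_* c) (sym (fromℕ-suc (length xs)))))
    where eq : ∀ a b → a + b * a ≡ (1ℚ + b) * a
          eq = solve-∀ ring

  ∑-nonneg : ∀ (xs : List A) {f} → (∀ x → 0ℚ ≤ f x) → 0ℚ ≤ ∑ xs f
  ∑-nonneg [] h = ≤-refl
  ∑-nonneg (x ∷ xs) h = +-nonneg (h x) (∑-nonneg xs h)

  ∑-++ : ∀ (xs ys : List A) f → ∑ (xs ++ ys) f ≡ ∑ xs f + ∑ ys f
  ∑-++ [] ys f = sym (+-identityˡ _)
  ∑-++ (x ∷ xs) ys f = trans (cong (_+_ (f x)) (∑-++ xs ys f)) (sym (+-assoc (f x) (∑ xs f) (∑ ys f)))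

∑-map : ∀ {A B : Set} (g : B → A) ys f → ∑ (map g ys) f ≡ ∑ ys (f ∘ g)
∑-map g [] f = refl
∑-map g (y ∷ ys) f = cong (_+_ (f (g y))) (∑-map g ys f)

∑-swap : ∀ {A B : Set} (xs : List A) (ys : List B) (f : A → B → ℚ) →
         ∑ xs (λ x → ∑ ys (f x)) ≡ ∑ ys (λ y → ∑ xs (λ x → f x y))
∑-swap [] ys f = sym (trans (∑-const ys 0ℚ) (*-zeroʳ (fromℕ (length ys))))
∑-swap (x ∷ xs) ys f = trans (cong (_+_ (∑ ys (f x))) (∑-swap xs ys f))
  (sym (∑-+ ys (f x) (λ y → ∑ xs (λ x → f x y))))

∑-allFin-suc : ∀ n (f : Fin (suc n) → ℚ) → ∑ (allFin (suc n)) f ≡ f zero + ∑ (allFin n) (f ∘ suc)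
∑-allFin-suc n f = cong (_+_ (f zero)) (trans (cong (λ l → ∑ l f) (sym (map-tabulate {n = n} id suc))) (∑-map suc (allFin n) f))

⟦_⟧ : Bool → ℚ
⟦ true ⟧ = 1ℚ
⟦ false ⟧ = 0ℚ

⟦⟧-nonneg : ∀ b → 0ℚ ≤ ⟦ b ⟧
⟦⟧-nonneg true = 0≤1
⟦⟧-nonneg false = ≤-refl

⟦⟧≤1 : ∀ b → ⟦ b ⟧ ≤ 1ℚ
⟦⟧≤1 true = ≤-refl
⟦⟧≤1 false = 0≤1

⟦∧⟧ : ∀ a b → ⟦ a ∧ b ⟧ ≡ ⟦ a ⟧ * ⟦ b ⟧
⟦∧⟧ true b = sym (*-identityˡ ⟦ b ⟧)
⟦∧⟧ false b = sym (*-zeroˡ ⟦ b ⟧)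

count : ∀ {A : Set} → List A → (A → Bool) → ℕ
count [] P = 0
count (x ∷ xs) P = (if P x then 1 else 0) ℕ.+ count xs P

fromℕ-count : ∀ {A : Set} (xs : List A) P → fromℕ (count xs P) ≡ ∑ xs (λ x → ⟦ P x ⟧)
fromℕ-count [] P = fromℕ-0
fromℕ-count (x ∷ xs) P with P x
... | true = trans (fromℕ-suc (count xs P)) (cong (1ℚ +_) (fromℕ-count xs P))
... | false = trans (fromℕ-count xs P) (sym (+-identityˡ _))

-- Elementary inequalities for powers

pow : ℚ → ℕ → ℚ
pow x zero = 1ℚ
pow x (suc n) = x * pow x n

pow-nonneg : ∀ {x} n → 0ℚ ≤ x → 0ℚ ≤ pow x n
pow-nonneg zero 0≤x = 0≤1
pow-nonneg (suc n) 0≤x = *-nonneg 0≤x (pow-nonneg n 0≤x)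

pow≤1 : ∀ {x} n → 0ℚ ≤ x → x ≤ 1ℚ → pow x n ≤ 1ℚ
pow≤1 zero 0≤x x≤1 = ≤-refl
pow≤1 {x} (suc n) 0≤x x≤1 = *-mono-≤ 0≤x 0≤1 x≤1 (pow≤1 n 0≤x x≤1)

pow-+ : ∀ x m n → pow x (m ℕ.+ n) ≡ pow x m * pow x n
pow-+ x zero n = sym (*-identityˡ _)
pow-+ x (suc m) n = trans (cong (x *_) (pow-+ x m n)) (sym (*-assoc x (pow x m) (pow x n)))

pow-mono : ∀ {x y} n → 0ℚ ≤ x → x ≤ y → pow x n ≤ pow y n
pow-mono zero 0≤x x≤y = ≤-refl
pow-mono (suc n) 0≤x x≤y = *-mono-≤ 0≤x (pow-nonneg n (≤-trans 0≤x x≤y)) x≤y (pow-mono n 0≤x x≤y)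

-- c x^c ≤ 1 + x + ... + x^(c-1) ≤ 1/(1-x), with the denominator cleared.
pow-decay : ∀ {x} n → 0ℚ ≤ x → x ≤ 1ℚ → (1ℚ - x) * (fromℕ n * pow x n) ≤ 1ℚ - pow x n
pow-decay {x} zero 0≤x x≤1 = ≤-reflexive (trans (cong (λ z → (1ℚ - x) * (z * 1ℚ)) fromℕ-0) (eq x))
  where eq : ∀ x → (1ℚ - x) * (0ℚ * 1ℚ) ≡ 1ℚ - 1ℚ
        eq = solve-∀ ring
pow-decay {x} (suc n) 0≤x x≤1 = ≤-cert
  (x * (1ℚ - pow x n - (1ℚ - x) * (fromℕ n * pow x n)) + (1ℚ - x) * (1ℚ - x * pow x n))
  (+-nonneg (*-nonneg 0≤x (p≤q⇒0≤q-p (pow-decay n 0≤x x≤1)))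
            (*-nonneg (p≤q⇒0≤q-p x≤1) (p≤q⇒0≤q-p (pow≤1 (suc n) 0≤x x≤1))))
  (trans (cong (λ z → (1ℚ - x) * (z * (x * pow x n)) + (x * (1ℚ - pow x n - (1ℚ - x) * (fromℕ n * pow x n)) + (1ℚ - x) * (1ℚ - x * pow x n))) (fromℕ-suc n)) (eq x (pow x n) (fromℕ n)))
  where eq : ∀ x p n → (1ℚ - x) * ((1ℚ + n) * (x * p)) + (x * (1ℚ - p - (1ℚ - x) * (n * p)) + (1ℚ - x) * (1ℚ - x * p)) ≡ 1ℚ - x * p
        eq = solve-∀ ring

bernoulli : ∀ {x} n → 0ℚ ≤ x → x ≤ 1ℚ → 1ℚ - pow x n ≤ fromℕ n * (1ℚ - x)
bernoulli {x} zero 0≤x x≤1 = ≤-reflexive (trans (eq x) (cong (_* (1ℚ - x)) (sym fromℕ-0)))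
  where eq : ∀ x → 1ℚ - 1ℚ ≡ 0ℚ * (1ℚ - x)
        eq = solve-∀ ring
bernoulli {x} (suc n) 0≤x x≤1 = ≤-cert
  ((fromℕ n * (1ℚ - x) - (1ℚ - pow x n)) + (1ℚ - x) * (1ℚ - pow x n))
  (+-nonneg (p≤q⇒0≤q-p (bernoulli n 0≤x x≤1)) (*-nonneg (p≤q⇒0≤q-p x≤1) (p≤q⇒0≤q-p (pow≤1 n 0≤x x≤1))))
  (trans (eq x (pow x n) (fromℕ n)) (cong (_* (1ℚ - x)) (sym (fromℕ-suc n))))
  where eq : ∀ x p n → 1ℚ - x * p + ((n * (1ℚ - x) - (1ℚ - p)) + (1ℚ - x) * (1ℚ - p)) ≡ (1ℚ + n) * (1ℚ - x)
        eq = solve-∀ ring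

-- The mean value bound y^n - x^n ≤ n (y - x) y^(n-1), multiplied by y so that the exponent n - 1
-- does not occur.
pow-tangent : ∀ {x y} n → 0ℚ ≤ x → x ≤ y → y * (pow y n - pow x n) ≤ (y - x) * (fromℕ n * pow y n)
pow-tangent {x} {y} zero 0≤x x≤y = ≤-reflexive (trans (eq x y) (cong (λ z → (y - x) * (z * 1ℚ)) (sym fromℕ-0)))
  where eq : ∀ x y → y * (1ℚ - 1ℚ) ≡ (y - x) * (0ℚ * 1ℚ)
        eq = solve-∀ ring
pow-tangent {x} {y} (suc n) 0≤x x≤y = ≤-cert
  (y * ((y - x) * (fromℕ n * pow y n) - y * (pow y n - pow x n)) + y * ((y - x) * (pow y n - pow x n)))
  (+-nonneg (*-nonneg 0≤y (p≤q⇒0≤q-p (pow-tangent n 0≤x x≤y)))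
            (*-nonneg 0≤y (*-nonneg (p≤q⇒0≤q-p x≤y) (p≤q⇒0≤q-p (pow-mono n 0≤x x≤y)))))
  (trans (eq x y (pow x n) (pow y n) (fromℕ n)) (cong (λ z → (y - x) * (z * (y * pow y n))) (sym (fromℕ-suc n))))
  where
  0≤y : 0ℚ ≤ y
  0≤y = ≤-trans 0≤x x≤y
  eq : ∀ x y p q n → y * (y * q - x * p) + (y * ((y - x) * (n * q) - y * (q - p)) + y * ((y - x) * (q - p)))
       ≡ (y - x) * ((1ℚ + n) * (y * q))
  eq = solve-∀ ring

-- Uniformly random sequences and concentration

∑-cartesianProductWith : ∀ {A B C : Set} (f : A → B → C) xs ys (g : C → ℚ) →
  ∑ (cartesianProductWith f xs ys) g ≡ ∑ xs (λ x → ∑ ys (λ y → g (f x y)))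
∑-cartesianProductWith f [] ys g = refl
∑-cartesianProductWith f (x ∷ xs) ys g = trans (∑-++ (map (f x) ys) _ g)
  (cong₂ _+_ (∑-map (f x) ys g) (∑-cartesianProductWith f xs ys g))

sequences : ∀ {X : Set} → List X → ∀ m → List (Vec X m)
sequences xs zero = [] ∷ []
sequences xs (suc m) = cartesianProductWith _∷_ xs (sequences xs m)

steps : ∀ {X S : Set} → (S → X → S) → ∀ {m} → S → Vec X m → S
steps next s [] = s
steps next s (x ∷ v) = steps next (next s x) v

module Process {X : Set} (xs : List X) (1/E : ℚ) (0≤1/E : 0ℚ ≤ 1/E)
               (E*1/E : fromℕ (length xs) * 1/E ≡ 1ℚ) {S : Set} (next : S → X → S) where

  E : ℚ
  E = fromℕ (length xs)

  avg : (X → ℚ) → ℚ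
  avg f = 1/E * ∑ xs f

  avg-mono : ∀ {f g} → (∀ x → f x ≤ g x) → avg f ≤ avg g
  avg-mono h = *-monoˡ 1/E 0≤1/E (∑-mono xs h)

  avg-const : ∀ c → avg (λ _ → c) ≡ c
  avg-const c = trans (cong (1/E *_) (∑-const xs c)) (trans (eq 1/E E c) (trans (cong (_* c) E*1/E) (*-identityˡ c)))
    where eq : ∀ i e c → i * (e * c) ≡ e * i * c
          eq = solve-∀ ring

  avg-+ : ∀ f g → avg (λ x → f x + g x) ≡ avg f + avg g
  avg-+ f g = trans (cong (1/E *_) (∑-+ xs f g)) (*-distribˡ-+ 1/E (∑ xs f) (∑ xs g))

  avg-* : ∀ c f → avg (λ x → c * f x) ≡ c * avg f
  avg-* c f = trans (cong (1/E *_) (∑-*ˡ xs c f)) (eq 1/E c (∑ xs f))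
    where eq : ∀ i c s → i * (c * s) ≡ c * (i * s)
          eq = solve-∀ ring

  -- The expectation of `f` at the state reached from `s` after the given number of independent
  -- uniform rounds.
  Exp : ℕ → (S → ℚ) → S → ℚ
  Exp zero f s = f s
  Exp (suc m) f s = avg (λ x → Exp m f (next s x))

  Exp-++ : ∀ m k f s → Exp (m ℕ.+ k) f s ≡ Exp m (Exp k f) s
  Exp-++ zero k f s = refl
  Exp-++ (suc m) k f s = cong (1/E *_) (∑-cong xs (λ x → Exp-++ m k f (next s x)))

  Exp-+ : ∀ m f g s → Exp m (λ s → f s + g s) s ≡ Exp m f s + Exp m g s
  Exp-+ zero f g s = refl
  Exp-+ (suc m) f g s = trans (cong (1/E *_) (∑-cong xs (λ x → Exp-+ m f g (next s x))))
    (avg-+ (λ x → Exp m f (next s x)) (λ x → Exp m g (next s x)))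

  Exp-* : ∀ m c f s → Exp m (λ s → c * f s) s ≡ c * Exp m f s
  Exp-* zero c f s = refl
  Exp-* (suc m) c f s = trans (cong (1/E *_) (∑-cong xs (λ x → Exp-* m c f (next s x))))
    (avg-* c (λ x → Exp m f (next s x)))

  Exp-const : ∀ m c s → Exp m (λ _ → c) s ≡ c
  Exp-const zero c s = refl
  Exp-const (suc m) c s = trans (cong (1/E *_) (∑-cong xs (λ x → Exp-const m c (next s x)))) (avg-const c)

  -- For an indicator `f` this turns a bound on an expectation into a bound on the number of arrival
  -- sequences, the form in which probabilities are stated.
  sequences-Exp : ∀ m f s → ∑ (sequences xs m) (λ v → f (steps next s v)) ≡ pow E m * Exp m f s
  sequences-Exp zero f s = eq (f s)
    where eq : ∀ x → x + 0ℚ ≡ 1ℚ * x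
          eq = solve-∀ ring
  sequences-Exp (suc m) f s = begin
    ∑ (sequences xs (suc m)) (λ v → f (steps next s v))
      ≡⟨ ∑-cartesianProductWith _∷_ xs (sequences xs m) (λ v → f (steps next s v)) ⟩
    ∑ xs (λ x → ∑ (sequences xs m) (λ v → f (steps next (next s x) v)))
      ≡⟨ ∑-cong xs (λ x → sequences-Exp m f (next s x)) ⟩
    ∑ xs (λ x → pow E m * Exp m f (next s x))
      ≡⟨ ∑-*ˡ xs (pow E m) (λ x → Exp m f (next s x)) ⟩
    pow E m * Σf
      ≡⟨ sym (*-identityˡ _) ⟩
    1ℚ * (pow E m * Σf)
      ≡⟨ cong (_* (pow E m * Σf)) (sym E*1/E) ⟩
    E * 1/E * (pow E m * Σf)
      ≡⟨ eq E 1/E (pow E m) Σf ⟩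
    E * pow E m * (1/E * Σf) ∎
    where
    open ≡-Reasoning
    Σf : ℚ
    Σf = ∑ xs (λ x → Exp m f (next s x))
    eq : ∀ e i p s → e * i * (p * s) ≡ e * p * (i * s)
    eq = solve-∀ ring

  module _ (I : S → Set) (I-next : ∀ s x → I s → I (next s x)) where

    Exp-mono : ∀ m {f g} → (∀ s → I s → f s ≤ g s) → ∀ s → I s → Exp m f s ≤ Exp m g s
    Exp-mono zero h s i = h s i
    Exp-mono (suc m) h s i = avg-mono (λ x → Exp-mono m h (next s x) (I-next s x i))

    -- `Ψ` depends on the round because the processes of both phases do; the induction takes off the
    -- first round and shifts `Ψ` by one.
    Exp-supermartingale : ∀ V m (Ψ : ℕ → S → ℚ) →
      (∀ t s → t ℕ.< m → I s → avg (λ x → Ψ (suc t) (next s x)) ≤ Ψ t s + V) →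
      ∀ s → I s → Exp m (Ψ m) s ≤ Ψ 0 s + fromℕ m * V
    Exp-supermartingale V zero Ψ h s i = ≤-reflexive (sym (trans (cong (λ z → Ψ 0 s + z * V) fromℕ-0) (eq (Ψ 0 s) V)))
      where eq : ∀ a b → a + 0ℚ * b ≡ a
            eq = solve-∀ ring
    Exp-supermartingale V (suc m) Ψ h s i = begin
      avg (λ x → Exp m (Ψ (suc m)) (next s x))
        ≤⟨ avg-mono (λ x → Exp-supermartingale V m (Ψ ∘ suc) (λ t s t<m → h (suc t) s (ℕ.s≤s t<m)) (next s x) (I-next s x i)) ⟩
      avg (λ x → Ψ 1 (next s x) + fromℕ m * V)
        ≡⟨ trans (avg-+ (λ x → Ψ 1 (next s x)) (λ _ → fromℕ m * V)) (cong (_+_ (avg (λ x → Ψ 1 (next s x)))) (avg-const (fromℕ m * V))) ⟩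
      avg (λ x → Ψ 1 (next s x)) + fromℕ m * V
        ≤⟨ +-monoˡ-≤ (fromℕ m * V) (h 0 s (ℕ.s≤s ℕ.z≤n) i) ⟩
      Ψ 0 s + V + fromℕ m * V
        ≡⟨ trans (eq (Ψ 0 s) V (fromℕ m)) (cong (λ z → Ψ 0 s + z * V) (sym (fromℕ-suc m))) ⟩
      Ψ 0 s + fromℕ (suc m) * V ∎
      where
      open ≤-Reasoning
      eq : ∀ a v m → a + v + m * v ≡ a + (1ℚ + m) * v
      eq = solve-∀ ring

    -- Chebyshev for a process Y that is a supermartingale as long as the state is not good and Y stays
    -- below the level Y₀ + ζ. The squared positive part of Y - Y₀, truncated at ζ² and set to 0 at good
    -- states, grows by at most b² per round on average; the truncation makes control above the level needless.
    module Concentration (good : S → Bool) (good-next : ∀ s x → good s ≡ true → good (next s x) ≡ true)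
      (Y : ℕ → S → ℚ) (Y₀ ζ b : ℚ) (0≤ζ : 0ℚ ≤ ζ) (T : ℕ)
      (drift : ∀ t s → t ℕ.< T → I s → good s ≡ false → Y t s < Y₀ + ζ → avg (λ x → Y (suc t) (next s x)) ≤ Y t s)
      (increment : ∀ t s x → t ℕ.< T → I s → good s ≡ false → Y t s < Y₀ + ζ →
         - b ≤ Y (suc t) (next s x) - Y t s × Y (suc t) (next s x) - Y t s ≤ b)
      where

      φ : ℚ → ℚ
      φ y = (ζ * ζ) ⊓ ((0ℚ ⊔ y) * (0ℚ ⊔ y))

      0≤⁺ : ∀ y → 0ℚ ≤ 0ℚ ⊔ y
      0≤⁺ y = p≤p⊔q 0ℚ y

      φ-nonneg : ∀ y → 0ℚ ≤ φ y
      φ-nonneg y = ⊓-glb (square-nonneg ζ) (square-nonneg (0ℚ ⊔ y))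

      φ-above : ∀ y → ζ ≤ y → φ y ≡ ζ * ζ
      φ-above y ζ≤y = p≤q⇒p⊓q≡p (*-mono-≤ 0≤ζ (0≤⁺ y) ζ≤y⁺ ζ≤y⁺)
        where ζ≤y⁺ : ζ ≤ 0ℚ ⊔ y
              ζ≤y⁺ = ≤-trans ζ≤y (p≤q⊔p 0ℚ y)

      φ-below : ∀ y → y ≤ ζ → φ y ≡ (0ℚ ⊔ y) * (0ℚ ⊔ y)
      φ-below y y≤ζ = p≥q⇒p⊓q≡q (*-mono-≤ (0≤⁺ y) 0≤ζ y⁺≤ζ y⁺≤ζ)
        where y⁺≤ζ : 0ℚ ⊔ y ≤ ζ
              y⁺≤ζ = ⊔-lub 0≤ζ y≤ζ

      φ-nonpos : ∀ y → y ≤ 0ℚ → φ y ≤ 0ℚ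
      φ-nonpos y y≤0 = ≤-trans (p⊓q≤q (ζ * ζ) _) (≤-reflexive (cong (λ z → z * z) (p≥q⇒p⊔q≡p y≤0)))

      -- If y + d ≥ 0, then y + d ≤ y⁺ + d; otherwise its positive part is 0. Either way the square
      -- is at most (y⁺ + d)², and d² ≤ b². The linear term is kept because its average is
      -- nonpositive by `drift`.
      φ-increment : ∀ y d → - b ≤ d → d ≤ b → φ (y + d) ≤ (0ℚ ⊔ y) * (0ℚ ⊔ y) + 2ℚ * (0ℚ ⊔ y) * d + b * b
      φ-increment y d h₁ h₂ = ≤-trans (p⊓q≤q (ζ * ζ) _) (≤-trans square-≤
        (≤-cert (b * b - d * d) (p≤q⇒0≤q-p (square-bound h₁ h₂)) (eq (0ℚ ⊔ y) d b)))
        where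
        eq : ∀ p d b → (p + d) * (p + d) + (b * b - d * d) ≡ p * p + (1ℚ + 1ℚ) * p * d + b * b
        eq = solve-∀ ring
        square-≤ : (0ℚ ⊔ (y + d)) * (0ℚ ⊔ (y + d)) ≤ (0ℚ ⊔ y + d) * (0ℚ ⊔ y + d)
        square-≤ with ≤-total 0ℚ (y + d)
        ... | inj₁ 0≤y+d = subst (λ z → z * z ≤ (0ℚ ⊔ y + d) * (0ℚ ⊔ y + d)) (sym (p≤q⇒p⊔q≡q 0≤y+d))
                (*-mono-≤ 0≤y+d (≤-trans 0≤y+d le) le le)
          where le : y + d ≤ 0ℚ ⊔ y + d
                le = +-monoˡ-≤ d (p≤q⊔p 0ℚ y)
        ... | inj₂ y+d≤0 = subst (λ z → z * z ≤ (0ℚ ⊔ y + d) * (0ℚ ⊔ y + d)) (sym (p≥q⇒p⊔q≡p y+d≤0))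
                (square-nonneg (0ℚ ⊔ y + d))

      Ψ : ℕ → S → ℚ
      Ψ t s = if good s then 0ℚ else φ (Y t s - Y₀)

      Ψ≤φ : ∀ t s → Ψ t s ≤ φ (Y t s - Y₀)
      Ψ≤φ t s with good s
      ... | true = φ-nonneg (Y t s - Y₀)
      ... | false = ≤-refl

      Ψ-drift : ∀ t s → t ℕ.< T → I s → avg (λ x → Ψ (suc t) (next s x)) ≤ Ψ t s + b * b
      Ψ-drift t s t<T i with good s in eq
      ... | true = ≤-trans (≤-reflexive (trans (cong (1/E *_) (∑-cong xs (λ x → cong (λ g → if g then 0ℚ else φ (Y (suc t) (next s x) - Y₀)) (good-next s x eq)))) (avg-const 0ℚ)))
                     (+-nonneg ≤-refl (square-nonneg b))
      ... | false with Y t s <? Y₀ + ζ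
      ...   | no Y≮ = begin
        avg (λ x → Ψ (suc t) (next s x))
          ≤⟨ avg-mono (λ x → ≤-trans (Ψ≤φ (suc t) (next s x)) (p⊓q≤p (ζ * ζ) _)) ⟩
        avg (λ x → ζ * ζ)
          ≡⟨ trans (avg-const (ζ * ζ)) (sym (φ-above (Y t s - Y₀) (≤-cert (Y t s - (Y₀ + ζ)) (p≤q⇒0≤q-p (≮⇒≥ Y≮)) (id₁ (Y t s) Y₀ ζ)))) ⟩
        φ (Y t s - Y₀)
          ≤⟨ ≤-cert (b * b) (square-nonneg b) refl ⟩
        φ (Y t s - Y₀) + b * b ∎
        where
        open ≤-Reasoning
        id₁ : ∀ y y₀ ζ → ζ + (y - (y₀ + ζ)) ≡ y - y₀
        id₁ = solve-∀ ring
      ...   | yes Y< = begin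
        avg (λ x → Ψ (suc t) (next s x))
          ≤⟨ avg-mono (λ x → ≤-trans (Ψ≤φ (suc t) (next s x)) (≤-trans (≤-reflexive (cong φ (id₁ (Y (suc t) (next s x)) y Y₀)))
               (φ-increment (y - Y₀) (Δ x) (proj₁ (increment t s x t<T i eq Y<)) (proj₂ (increment t s x t<T i eq Y<))))) ⟩
        avg (λ x → p * p + 2ℚ * p * Δ x + b * b)
          ≡⟨ trans (avg-+ (λ x → p * p + 2ℚ * p * Δ x) (λ _ → b * b)) (cong₂ _+_ (trans (avg-+ (λ _ → p * p) (λ x → 2ℚ * p * Δ x))
               (cong₂ _+_ (avg-const (p * p)) (avg-* (2ℚ * p) Δ))) (avg-const (b * b))) ⟩
        p * p + 2ℚ * p * avg Δ + b * b
          ≤⟨ +-monoˡ-≤ (b * b) (+-monoʳ-≤ (p * p) (≤-trans (*-monoˡ (2ℚ * p) (*-nonneg 0≤2 (0≤⁺ (y - Y₀))) avgΔ≤0) (≤-reflexive (*-zeroʳ (2ℚ * p))))) ⟩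
        p * p + 0ℚ + b * b
          ≡⟨ cong (_+ b * b) (trans (+-identityʳ (p * p)) (sym (φ-below (y - Y₀) (≤-cert (Y₀ + ζ - y) (p≤q⇒0≤q-p (<⇒≤ Y<)) (id₂ y Y₀ ζ))))) ⟩
        φ (y - Y₀) + b * b ∎
        where
        open ≤-Reasoning
        y p : ℚ
        y = Y t s
        p = 0ℚ ⊔ (y - Y₀)
        Δ : X → ℚ
        Δ x = Y (suc t) (next s x) - y
        id₁ : ∀ y' y y₀ → y' - y₀ ≡ y - y₀ + (y' - y)
        id₁ = solve-∀ ring
        id₂ : ∀ y y₀ ζ → y - y₀ + (y₀ + ζ - y) ≡ ζ
        id₂ = solve-∀ ring
        avgΔ≤0 : avg Δ ≤ 0ℚ
        avgΔ≤0 = begin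
          avg Δ ≡⟨ trans (avg-+ (λ x → Y (suc t) (next s x)) (λ _ → - y)) (cong (_+_ (avg (λ x → Y (suc t) (next s x)))) (avg-const (- y))) ⟩
          avg (λ x → Y (suc t) (next s x)) - y ≤⟨ +-monoˡ-≤ (- y) (drift t s t<T i eq Y<) ⟩
          y - y ≡⟨ +-inverseʳ y ⟩
          0ℚ ∎

      -- Markov's inequality for `Ψ`, which starts at 0 because Y 0 s ≤ Y₀, gains at most b² per
      -- round on average, and equals ζ² at bad states.
      chebyshev : ∀ (bad : S → Bool) → (∀ s → I s → bad s ≡ true → good s ≡ false × Y₀ + ζ ≤ Y T s) →
        ∀ s → I s → Y 0 s ≤ Y₀ → ζ * ζ * Exp T (λ s → ⟦ bad s ⟧) s ≤ fromℕ T * (b * b)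
      chebyshev bad bad⇒ s i Y≤Y₀ = begin
        ζ * ζ * Exp T (λ s → ⟦ bad s ⟧) s ≡⟨ sym (Exp-* T (ζ * ζ) (λ s → ⟦ bad s ⟧) s) ⟩
        Exp T (λ s → ζ * ζ * ⟦ bad s ⟧) s ≤⟨ Exp-mono T bad≤Ψ s i ⟩
        Exp T (Ψ T) s ≤⟨ Exp-supermartingale (b * b) T Ψ Ψ-drift s i ⟩
        Ψ 0 s + fromℕ T * (b * b) ≤⟨ +-monoˡ-≤ (fromℕ T * (b * b)) (≤-trans (Ψ≤φ 0 s) (φ-nonpos (Y 0 s - Y₀) (≤-cert (Y₀ - Y 0 s) (p≤q⇒0≤q-p Y≤Y₀) (id₁ (Y 0 s) Y₀)))) ⟩
        0ℚ + fromℕ T * (b * b) ≡⟨ +-identityˡ _ ⟩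
        fromℕ T * (b * b) ∎
        where
        open ≤-Reasoning
        id₁ : ∀ y y₀ → y - y₀ + (y₀ - y) ≡ 0ℚ
        id₁ = solve-∀ ring
        id₂ : ∀ y y₀ ζ → ζ + (y - (y₀ + ζ)) ≡ y - y₀
        id₂ = solve-∀ ring
        bad≤Ψ : ∀ s → I s → ζ * ζ * ⟦ bad s ⟧ ≤ Ψ T s
        bad≤Ψ s i with bad s in eq
        ... | false = ≤-trans (≤-reflexive (*-zeroʳ (ζ * ζ))) Ψ≥0
          where Ψ≥0 : 0ℚ ≤ Ψ T s
                Ψ≥0 with good s
                ... | true = ≤-refl
                ... | false = φ-nonneg (Y T s - Y₀)
        ... | true with bad⇒ s i eq
        ...   | ng , Y≥ rewrite ng = ≤-reflexive (trans (*-identityʳ (ζ * ζ))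
                  (sym (φ-above (Y T s - Y₀) (≤-cert (Y T s - (Y₀ + ζ)) (p≤q⇒0≤q-p Y≥) (id₂ (Y T s) Y₀ ζ)))))

-- Components under random edges

source target : ∀ {n} → Edge n → Fin n
source ((i , _) , _) = i
target ((_ , j) , _) = j

edge-from-zero : ∀ {n} → Fin n → Edge (suc n)
edge-from-zero j = (zero , suc j) , ℕ.s≤s ℕ.z≤n

shift-edge : ∀ {n} → Edge n → Edge (suc n)
shift-edge ((i , j) , i<j) = (suc i , suc j) , ℕ.s≤s i<j

edges : ∀ n → List (Edge n)
edges zero = []
edges (suc n) = map edge-from-zero (allFin n) ++ map shift-edge (edges n)

length-edges : ∀ n → length (edges n) ≡ n C 2
length-edges zero = refl
length-edges (suc n) = begin
  length (edges (suc n)) ≡⟨ length-++ (map edge-from-zero (allFin n)) ⟩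
  length (map edge-from-zero (allFin n)) ℕ.+ length (map shift-edge (edges n))
    ≡⟨ cong₂ ℕ._+_ (trans (length-map edge-from-zero (allFin n)) (length-tabulate id)) (trans (length-map shift-edge (edges n)) (length-edges n)) ⟩
  n ℕ.+ n C 2 ≡⟨ cong (ℕ._+ n C 2) (sym (nC1≡n n)) ⟩
  n C 1 ℕ.+ n C 2 ≡⟨ nCk+nC[k+1]≡[n+1]C[k+1] n 1 ⟩
  suc n C 2 ∎
  where open ≡-Reasoning

edges-unique : ∀ n → Unique (edges n)
edges-unique zero = []
edges-unique (suc n) = Unique.++⁺ (Unique.map⁺ (λ { refl → refl }) (Unique.allFin⁺ n))
  (Unique.map⁺ shift-injective (edges-unique n)) disjoint
  where
  shift-injective : ∀ {e f : Edge n} → shift-edge e ≡ shift-edge f → e ≡ f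
  shift-injective {(i , j) , p} {(.i , .j) , .p} refl = refl
  disjoint : ∀ {e} → ¬ (e ∈ₗ map edge-from-zero (allFin n) × e ∈ₗ map shift-edge (edges n))
  disjoint (∈₁ , ∈₂) with ∈-map⁻ edge-from-zero ∈₁ | ∈-map⁻ shift-edge ∈₂
  ... | _ , _ , refl | _ , _ , ()

-- Every edge stands for two ordered pairs, and the diagonal supplies the rest. Averages over a
-- random edge thus become double sums over vertices, which can be estimated row by row.
∑-edges : ∀ n (g : Fin n → Fin n → ℚ) →
  ∑ (edges n) (λ e → g (source e) (target e) + g (target e) (source e)) + ∑ (allFin n) (λ i → g i i)
  ≡ ∑ (allFin n) (λ i → ∑ (allFin n) (g i))
∑-edges zero g = refl
∑-edges (suc n) g = begin
  ∑ (edges (suc n)) h + ∑ (allFin (suc n)) (λ i → g i i)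
    ≡⟨ cong₂ _+_ (trans (∑-++ (map edge-from-zero (allFin n)) _ h)
         (cong₂ _+_ (trans (∑-map edge-from-zero (allFin n) h) (∑-+ (allFin n) (λ j → g zero (suc j)) (λ j → g (suc j) zero)))
                    (∑-map shift-edge (edges n) h)))
         (∑-allFin-suc n (λ i → g i i)) ⟩
  row + column + ∑ (edges n) (h ∘ shift-edge) + (g zero zero + diagonal)
    ≡⟨ eq row column (∑ (edges n) (h ∘ shift-edge)) (g zero zero) diagonal ⟩
  g zero zero + row + (column + (∑ (edges n) (h ∘ shift-edge) + diagonal))
    ≡⟨ cong₂ (λ a b → a + (column + b)) (sym (∑-allFin-suc n (g zero))) (∑-edges n (λ i j → g (suc i) (suc j))) ⟩
  ∑ (allFin (suc n)) (g zero) + (column + ∑ (allFin n) (λ i → ∑ (allFin n) (λ j → g (suc i) (suc j))))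
    ≡⟨ cong (_+_ (∑ (allFin (suc n)) (g zero))) (trans (sym (∑-+ (allFin n) (λ i → g (suc i) zero) (λ i → ∑ (allFin n) (λ j → g (suc i) (suc j)))))
         (∑-cong (allFin n) (λ i → sym (∑-allFin-suc n (g (suc i)))))) ⟩
  ∑ (allFin (suc n)) (g zero) + ∑ (allFin n) (λ i → ∑ (allFin (suc n)) (g (suc i)))
    ≡⟨ sym (∑-allFin-suc n (λ i → ∑ (allFin (suc n)) (g i))) ⟩
  ∑ (allFin (suc n)) (λ i → ∑ (allFin (suc n)) (g i)) ∎
  where
  open ≡-Reasoning
  h : Edge (suc n) → ℚ
  h e = g (source e) (target e) + g (target e) (source e)
  row column diagonal : ℚ
  row = ∑ (allFin n) (λ j → g zero (suc j))
  column = ∑ (allFin n) (λ j → g (suc j) zero)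
  diagonal = ∑ (allFin n) (λ i → g (suc i) (suc i))
  eq : ∀ r c e z d → r + c + e + (z + d) ≡ z + r + (c + (e + d))
  eq = solve-∀ ring

∑-allFin-const : ∀ n c → ∑ (allFin n) (λ _ → c) ≡ fromℕ n * c
∑-allFin-const n c = trans (∑-const (allFin n) c) (cong (λ k → fromℕ k * c) (length-tabulate {n = n} id))

-- The case g = 1 of `∑-edges`. This factor 2 is the origin of the 1/2 in the number of rounds.
edges-bound : ∀ n → 2ℚ * fromℕ (length (edges n)) ≤ fromℕ n * fromℕ n
edges-bound n = ≤-cert (fromℕ n) (fromℕ-nonneg n) (begin
  2ℚ * e + fromℕ n ≡⟨ eq e (fromℕ n) ⟩
  e * (1ℚ + 1ℚ) + fromℕ n * 1ℚ ≡⟨ sym (cong₂ _+_ (∑-const (edges n) (1ℚ + 1ℚ)) (∑-allFin-const n 1ℚ)) ⟩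
  ∑ (edges n) (λ _ → 1ℚ + 1ℚ) + ∑ (allFin n) (λ _ → 1ℚ) ≡⟨ ∑-edges n (λ _ _ → 1ℚ) ⟩
  ∑ (allFin n) (λ _ → ∑ (allFin n) (λ _ → 1ℚ)) ≡⟨ trans (∑-allFin-const n _) (cong (fromℕ n *_) (trans (∑-allFin-const n 1ℚ) (*-identityʳ (fromℕ n)))) ⟩
  fromℕ n * fromℕ n ∎)
  where
  open ≡-Reasoning
  e : ℚ
  e = fromℕ (length (edges n))
  eq : ∀ e n → (1ℚ + 1ℚ) * e + n ≡ e * (1ℚ + 1ℚ) + n * 1ℚ
  eq = solve-∀ ring

indicator : Bool → ℕ
indicator b = if b then 1 else 0

module _ {A : Set} where

  count-cong : ∀ (xs : List A) {P Q} → (∀ x → P x ≡ Q x) → count xs P ≡ count xs Q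
  count-cong [] h = refl
  count-cong (x ∷ xs) h = cong₂ (λ b c → indicator b ℕ.+ c) (h x) (count-cong xs h)

  count-+ : ∀ (xs : List A) P Q R → (∀ x → indicator (R x) ≡ indicator (P x) ℕ.+ indicator (Q x)) →
            count xs R ≡ count xs P ℕ.+ count xs Q
  count-+ [] P Q R h = refl
  count-+ (x ∷ xs) P Q R h = trans (cong₂ ℕ._+_ (h x) (count-+ xs P Q R h))
    (+-interchange (indicator (P x)) (indicator (Q x)) (count xs P) (count xs Q))
    where open import Algebra.Properties.CommutativeSemigroup ℕ.+-commutativeSemigroup using () renaming (interchange to +-interchange)

  count-mono : ∀ (xs : List A) {P Q} → (∀ x → P x ≡ true → Q x ≡ true) → count xs P ℕ.≤ count xs Q
  count-mono [] h = ℕ.z≤n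
  count-mono (x ∷ xs) {P} {Q} h = ℕ.+-mono-≤ le (count-mono xs h)
    where le : indicator (P x) ℕ.≤ indicator (Q x)
          le with P x in eq
          ... | false = ℕ.z≤n
          ... | true = ℕ.≤-reflexive (cong indicator (sym (h x eq)))

  count-positive : ∀ {xs : List A} {P x} → x ∈ₗ xs → P x ≡ true → 1 ℕ.≤ count xs P
  count-positive {x ∷ xs} {P} (here refl) Px rewrite Px = ℕ.s≤s ℕ.z≤n
  count-positive {y ∷ xs} {P} (there x∈xs) Px = ℕ.≤-trans (count-positive x∈xs Px) (ℕ.m≤n+m (count xs P) (indicator (P y)))

does-true : ∀ {P : Set} (d : Dec P) → does d ≡ true → P
does-true (yes p) _ = p

true-does : ∀ {P : Set} (d : Dec P) → P → does d ≡ true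
true-does (yes _) _ = refl
true-does (no ¬p) p = contradiction p ¬p

false-does : ∀ {P : Set} (d : Dec P) → ¬ P → does d ≡ false
false-does (yes p) ¬p = contradiction p ¬p
false-does (no _) _ = refl

does-false : ∀ {P : Set} (d : Dec P) → does d ≡ false → ¬ P
does-false (no ¬p) _ = ¬p

does-iff : ∀ {P Q : Set} (d : Dec P) (e : Dec Q) → (P → Q) → (Q → P) → does d ≡ does e
does-iff (yes p) e f g = sym (true-does e (f p))
does-iff (no ¬p) e f g = sym (false-does e (¬p ∘ g))

∧-true : ∀ {a b} → a ∧ b ≡ true → a ≡ true × b ≡ true
∧-true {true} {true} _ = refl , refl

-- A state assigns to each vertex the label of its component. Only edges inside α joining different parts
-- are used, and only vertices of α are counted.
module Components (n : ℕ) (α : Fin n → Bool) (part : Fin n → ℕ) where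

  Labelling : Set
  Labelling = Fin n → Fin n

  ∑α : (Fin n → ℚ) → ℚ
  ∑α f = ∑ (allFin n) (λ v → ⟦ α v ⟧ * f v)

  ∑α-mono : ∀ {f g} → (∀ v → α v ≡ true → f v ≤ g v) → ∑α f ≤ ∑α g
  ∑α-mono {f} {g} h = ∑-mono (allFin n) le
    where le : ∀ v → ⟦ α v ⟧ * f v ≤ ⟦ α v ⟧ * g v
          le v with α v in eq
          ... | true = *-monoˡ 1ℚ 0≤1 (h v eq)
          ... | false = ≤-reflexive (trans (*-zeroˡ (f v)) (sym (*-zeroˡ (g v))))

  ∑α-cong : ∀ {f g} → (∀ v → f v ≡ g v) → ∑α f ≡ ∑α g
  ∑α-cong h = ∑-cong (allFin n) (λ v → cong (⟦ α v ⟧ *_) (h v))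

  ∑α-+ : ∀ f g → ∑α (λ v → f v + g v) ≡ ∑α f + ∑α g
  ∑α-+ f g = trans (∑-cong (allFin n) (λ v → *-distribˡ-+ ⟦ α v ⟧ (f v) (g v))) (∑-+ (allFin n) _ _)

  ∑α-* : ∀ c f → ∑α (λ v → c * f v) ≡ c * ∑α f
  ∑α-* c f = trans (∑-cong (allFin n) (λ v → eq ⟦ α v ⟧ c (f v))) (∑-*ˡ (allFin n) c _)
    where eq : ∀ a c f → a * (c * f) ≡ c * (a * f)
          eq = solve-∀ ring

  ∑α-*ʳ : ∀ c f → ∑α (λ v → f v * c) ≡ ∑α f * c
  ∑α-*ʳ c f = trans (∑α-cong (λ v → *-comm (f v) c)) (trans (∑α-* c f) (*-comm c (∑α f)))

  ∑α-- : ∀ f g → ∑α (λ v → f v - g v) ≡ ∑α f - ∑α g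
  ∑α-- f g = trans (∑-cong (allFin n) (λ v → eq ⟦ α v ⟧ (f v) (g v))) (∑-- (allFin n) _ _)
    where eq : ∀ a f g → a * (f - g) ≡ a * f - a * g
          eq = solve-∀ ring

  ∑α-nonneg : ∀ {f} → (∀ v → 0ℚ ≤ f v) → 0ℚ ≤ ∑α f
  ∑α-nonneg h = ∑-nonneg (allFin n) (λ v → *-nonneg (⟦⟧-nonneg (α v)) (h v))

  |α| : ℚ
  |α| = ∑α (λ _ → 1ℚ)

  |α|≤n : |α| ≤ fromℕ n
  |α|≤n = ≤-trans (∑-mono (allFin n) (λ v → ≤-trans (≤-reflexive (*-identityʳ ⟦ α v ⟧)) (⟦⟧≤1 (α v))))
    (≤-reflexive (trans (∑-allFin-const n 1ℚ) (*-identityʳ (fromℕ n))))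

  ∑α-const : ∀ c → ∑α (λ _ → c) ≡ |α| * c
  ∑α-const c = trans (∑α-cong (λ _ → sym (*-identityˡ c))) (∑α-*ʳ c (λ _ → 1ℚ))

  same : Labelling → Fin n → Fin n → Bool
  same lab u v = does (lab u Fin.≟ lab v)

  same-sym : ∀ lab u v → same lab u v ≡ same lab v u
  same-sym lab u v = does-iff (lab u Fin.≟ lab v) (lab v Fin.≟ lab u) sym sym

  allowed : Fin n → Fin n → Bool
  allowed u v = α u ∧ (α v ∧ not (does (part u ℕ.≟ part v)))

  allowed-sym : ∀ u v → allowed u v ≡ allowed v u
  allowed-sym u v = trans (cong (λ b → α u ∧ (α v ∧ not b)) (does-iff (part u ℕ.≟ part v) (part v ℕ.≟ part u) sym sym))
    (Bool-swap (α u) (α v) (not (does (part v ℕ.≟ part u))))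
    where
    Bool-swap : ∀ a b c → a ∧ (b ∧ c) ≡ b ∧ (a ∧ c)
    Bool-swap true true c = refl
    Bool-swap true false c = refl
    Bool-swap false true c = refl
    Bool-swap false false c = refl

  merge : Labelling → Fin n → Fin n → Labelling
  merge lab i j w = if does (lab w Fin.≟ lab j) then lab i else lab w

  next : Labelling → Edge n → Labelling
  next lab e = if allowed (source e) (target e) then merge lab (source e) (target e) else lab

  size : Labelling → Fin n → ℕ
  size lab v = count (allFin n) (λ w → α w ∧ same lab w v)

  fromℕ-size : ∀ lab v → fromℕ (size lab v) ≡ ∑α (λ w → ⟦ same lab w v ⟧)
  fromℕ-size lab v = trans (fromℕ-count (allFin n) _) (∑-cong (allFin n) (λ w → ⟦∧⟧ (α w) (same lab w v)))

  size-cong : ∀ lab {u v} → lab u ≡ lab v → size lab u ≡ size lab v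
  size-cong lab eq = cong (λ l → count (allFin n) (λ w → α w ∧ does (lab w Fin.≟ l))) eq

  size-positive : ∀ lab v → α v ≡ true → 1 ℕ.≤ size lab v
  size-positive lab v αv = count-positive (∈-allFin v) (trans (cong (_∧ same lab v v) αv) (true-does (lab v Fin.≟ lab v) refl))

  merge-same : ∀ lab i j {u v} → lab u ≡ lab v → merge lab i j u ≡ merge lab i j v
  merge-same lab i j eq = cong (λ l → if does (l Fin.≟ lab j) then lab i else l) eq

  next-same : ∀ lab e {u v} → lab u ≡ lab v → next lab e u ≡ next lab e v
  next-same lab e eq with allowed (source e) (target e)
  ... | true = merge-same lab (source e) (target e) eq
  ... | false = eq

  size-next : ∀ lab e v → size lab v ℕ.≤ size (next lab e) v
  size-next lab e v = count-mono (allFin n) le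
    where le : ∀ w → α w ∧ same lab w v ≡ true → α w ∧ same (next lab e) w v ≡ true
          le w h with ∧-true {α w} h
          ... | αw , s = cong₂ _∧_ αw (true-does (next lab e w Fin.≟ next lab e v) (next-same lab e (does-true (lab w Fin.≟ lab v) s)))

  merge-absorbed : ∀ lab i j w → lab w ≡ lab j → merge lab i j w ≡ lab i
  merge-absorbed lab i j w eq = cong (λ b → if b then lab i else lab w) (true-does (lab w Fin.≟ lab j) eq)

  merge-kept : ∀ lab i j w → lab w ≢ lab j → merge lab i j w ≡ lab w
  merge-kept lab i j w neq = cong (λ b → if b then lab i else lab w) (false-does (lab w Fin.≟ lab j) neq)

  size-merged : ∀ lab i j w → lab i ≢ lab j → lab w ≡ lab i ⊎ lab w ≡ lab j →
                size (merge lab i j) w ≡ size lab i ℕ.+ size lab j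
  size-merged lab i j w i≢j w∈ = count-+ (allFin n) _ _ _ pointwise
    where
    merge-w : merge lab i j w ≡ lab i
    merge-w = [ (λ eq → trans (merge-kept lab i j w (λ e → i≢j (trans (sym eq) e))) eq) , merge-absorbed lab i j w ] w∈
    pointwise : ∀ v → indicator (α v ∧ same (merge lab i j) v w) ≡
                indicator (α v ∧ same lab v i) ℕ.+ indicator (α v ∧ same lab v j)
    pointwise v with α v
    ... | false = refl
    ... | true = trans (cong (λ l → indicator (does (merge lab i j v Fin.≟ l))) merge-w) (by-label (lab v Fin.≟ lab j))
      where
      by-label : Dec (lab v ≡ lab j) → indicator (does (merge lab i j v Fin.≟ lab i)) ≡ indicator (same lab v i) ℕ.+ indicator (same lab v j)
      by-label (yes eq) = trans (cong indicator (true-does (merge lab i j v Fin.≟ lab i) (merge-absorbed lab i j v eq)))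
        (sym (cong₂ (λ a b → indicator a ℕ.+ indicator b) (false-does (lab v Fin.≟ lab i) (λ e → i≢j (trans (sym e) eq))) (true-does (lab v Fin.≟ lab j) eq)))
      by-label (no neq) = trans (cong (λ l → indicator (does (l Fin.≟ lab i))) (merge-kept lab i j v neq))
        (trans (sym (ℕ.+-identityʳ _)) (cong (λ b → indicator (same lab v i) ℕ.+ indicator b) (sym (false-does (lab v Fin.≟ lab j) neq))))

  size-unmerged : ∀ lab i j w → lab w ≢ lab i → lab w ≢ lab j → size (merge lab i j) w ≡ size lab w
  size-unmerged lab i j w w≢i w≢j = count-cong (allFin n) (λ v → cong (α v ∧_) (pointwise v (lab v Fin.≟ lab j)))
    where
    pointwise : ∀ v → Dec (lab v ≡ lab j) → same (merge lab i j) v w ≡ same lab v w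
    pointwise v (yes eq) = trans (cong₂ (λ l m → does (l Fin.≟ m)) (merge-absorbed lab i j v eq) (merge-kept lab i j w w≢j))
      (trans (false-does (lab i Fin.≟ lab w) (w≢i ∘ sym)) (sym (false-does (lab v Fin.≟ lab w) (λ e → w≢j (trans (sym e) eq)))))
    pointwise v (no neq) = cong₂ (λ l m → does (l Fin.≟ m)) (merge-kept lab i j v neq) (merge-kept lab i j w w≢j)

  -- Grouped by components this is ∑ |C| f(|C|), so a merge affects two summands only.
  Potential : (ℕ → ℚ) → Labelling → ℚ
  Potential f lab = ∑α (λ v → f (size lab v))

  -- What the vertices of a component of order `a` lose together when it joins one of order `b`; the
  -- other side loses `loss f b a`.
  loss : (ℕ → ℚ) → ℕ → ℕ → ℚ
  loss f a b = fromℕ a * (f a - f (a ℕ.+ b))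

  Potential-merge : ∀ f lab i j → lab i ≢ lab j → let a = size lab i; b = size lab j in
    Potential f lab ≡ Potential f (merge lab i j) + (loss f a b + loss f b a)
  Potential-merge f lab i j i≢j = begin
    ∑α (λ w → f (size lab w))
      ≡⟨ ∑α-cong (λ w → pointwise w (lab w Fin.≟ lab i) (lab w Fin.≟ lab j)) ⟩
    ∑α (λ w → f (size (merge lab i j) w) + (⟦ same lab w i ⟧ * x + ⟦ same lab w j ⟧ * y))
      ≡⟨ ∑α-+ _ _ ⟩
    Potential f (merge lab i j) + ∑α (λ w → ⟦ same lab w i ⟧ * x + ⟦ same lab w j ⟧ * y)
      ≡⟨ cong (_+_ (Potential f (merge lab i j))) (trans (∑α-+ _ _) (cong₂ _+_
           (trans (∑α-*ʳ x (λ w → ⟦ same lab w i ⟧)) (cong (_* x) (sym (fromℕ-size lab i))))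
           (trans (∑α-*ʳ y (λ w → ⟦ same lab w j ⟧)) (cong (_* y) (sym (fromℕ-size lab j)))))) ⟩
    Potential f (merge lab i j) + (loss f a b + loss f b a) ∎
    where
    open ≡-Reasoning
    a b : ℕ
    a = size lab i
    b = size lab j
    x y : ℚ
    x = f a - f (a ℕ.+ b)
    y = f b - f (b ℕ.+ a)
    pointwise : ∀ w (p : Dec (lab w ≡ lab i)) (q : Dec (lab w ≡ lab j)) →
      f (size lab w) ≡ f (size (merge lab i j) w) + (⟦ does p ⟧ * x + ⟦ does q ⟧ * y)
    pointwise w (yes p) (yes q) = contradiction (trans (sym p) q) i≢j
    pointwise w (yes p) (no q) = trans (cong f (size-cong lab p))
      (trans (eq (f a) (f (a ℕ.+ b)) y) (cong (λ z → f z + (1ℚ * x + 0ℚ * y)) (sym (size-merged lab i j w i≢j (inj₁ p)))))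
      where eq : ∀ u v y → u ≡ v + (1ℚ * (u - v) + 0ℚ * y)
            eq = solve-∀ ring
    pointwise w (no p) (yes q) = trans (cong f (size-cong lab q))
      (trans (eq (f b) (f (b ℕ.+ a)) x) (cong (λ z → f z + (0ℚ * x + 1ℚ * y)) (trans (ℕ.+-comm b a) (sym (size-merged lab i j w i≢j (inj₂ q))))))
      where eq : ∀ u v x → u ≡ v + (0ℚ * x + 1ℚ * (u - v))
            eq = solve-∀ ring
    pointwise w (no p) (no q) = trans (cong f (sym (size-unmerged lab i j w p q))) (eq (f (size (merge lab i j) w)) x y)
      where eq : ∀ u x y → u ≡ u + (0ℚ * x + 0ℚ * y)
            eq = solve-∀ ring

  link : Labelling → Fin n → Fin n → Bool
  link lab u v = allowed u v ∧ not (same lab u v)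

  link-sym : ∀ lab u v → link lab u v ≡ link lab v u
  link-sym lab u v = cong₂ (λ a b → a ∧ not b) (allowed-sym u v) (same-sym lab u v)

  drop : (ℕ → ℚ) → Labelling → Fin n → Fin n → ℚ
  drop f lab u v = ⟦ link lab u v ⟧ * loss f (size lab u) (size lab v)

  Potential-cong : ∀ f {lab lab′} → (∀ w → lab w ≡ lab′ w) → Potential f lab ≡ Potential f lab′
  Potential-cong f {lab} {lab′} h = ∑α-cong (λ v → cong f (count-cong (allFin n)
    (λ w → cong₂ (λ l m → α w ∧ does (l Fin.≟ m)) (h w) (h v))))

  -- An exact identity for a single edge. The loss is split between the two orientations of the
  -- edge, as `∑-edges` requires.
  Potential-next : ∀ f lab e → Potential f lab ≡
    Potential f (next lab e) + (drop f lab (source e) (target e) + drop f lab (target e) (source e))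
  Potential-next f lab e@((i , j) , _) rewrite link-sym lab j i with allowed i j
  ... | false = unlinked (Potential f lab) ℓ ℓ′
    where
    ℓ ℓ′ : ℚ
    ℓ = loss f (size lab i) (size lab j)
    ℓ′ = loss f (size lab j) (size lab i)
    unlinked : ∀ u x y → u ≡ u + (0ℚ * x + 0ℚ * y)
    unlinked = solve-∀ ring
  ... | true with lab i Fin.≟ lab j
  ...   | no i≢j = trans (Potential-merge f lab i j i≢j) (linked (Potential f (merge lab i j))
                     (loss f (size lab i) (size lab j)) (loss f (size lab j) (size lab i)))
    where
    linked : ∀ u x y → u + (x + y) ≡ u + (1ℚ * x + 1ℚ * y)
    linked = solve-∀ ring
  -- An edge within a component: `merge` replaces the label of j by the equal label of i, so the
  -- labelling is unchanged, though only pointwise.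
  ...   | yes i≡j = trans (Potential-cong f unchanged) (unlinked (Potential f (merge lab i j))
                      (loss f (size lab i) (size lab j)) (loss f (size lab j) (size lab i)))
    where
    unlinked : ∀ u x y → u ≡ u + (0ℚ * x + 0ℚ * y)
    unlinked = solve-∀ ring
    unchanged : ∀ w → lab w ≡ merge lab i j w
    unchanged w with lab w Fin.≟ lab j
    ... | yes w≡j = trans w≡j (sym i≡j)
    ... | no _ = refl

  link-irreflexive : ∀ lab u → link lab u u ≡ false
  link-irreflexive lab u rewrite true-does (lab u Fin.≟ lab u) refl = Bool.∧-zeroʳ (allowed u u)

  ∑-Potential-next : ∀ f lab → ∑ (edges n) (λ e → Potential f (next lab e))
    ≡ fromℕ (length (edges n)) * Potential f lab - ∑ (allFin n) (λ u → ∑ (allFin n) (drop f lab u))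
  ∑-Potential-next f lab = begin
    ∑ (edges n) (λ e → Potential f (next lab e))
      ≡⟨ eq₁ _ D ⟩
    ∑ (edges n) (λ e → Potential f (next lab e)) + D - D
      ≡⟨ cong (_- D) (trans (sym (∑-+ (edges n) _ _)) (∑-cong (edges n) (λ e → sym (Potential-next f lab e)))) ⟩
    ∑ (edges n) (λ e → Potential f lab) - D
      ≡⟨ cong₂ _-_ (∑-const (edges n) (Potential f lab)) D≡ ⟩
    fromℕ (length (edges n)) * Potential f lab - ∑ (allFin n) (λ u → ∑ (allFin n) (drop f lab u)) ∎
    where
    open ≡-Reasoning
    D : ℚ
    D = ∑ (edges n) (λ e → drop f lab (source e) (target e) + drop f lab (target e) (source e))
    eq₁ : ∀ x d → x ≡ x + d - d
    eq₁ = solve-∀ ring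
    diagonal : ∑ (allFin n) (λ u → drop f lab u u) ≡ 0ℚ
    diagonal = trans (∑-cong (allFin n) (λ u → trans (cong (λ b → ⟦ b ⟧ * loss f (size lab u) (size lab u)) (link-irreflexive lab u)) (*-zeroˡ (loss f (size lab u) (size lab u)))))
      (trans (∑-const (allFin n) 0ℚ) (*-zeroʳ (fromℕ (length (allFin n)))))
    D≡ : D ≡ ∑ (allFin n) (λ u → ∑ (allFin n) (drop f lab u))
    D≡ = trans (sym (+-identityʳ D)) (trans (cong (_+_ D) (sym diagonal)) (∑-edges n (drop f lab)))

-- The two phases

-- The value at 0 is junk.
recip : ℕ → ℚ
recip zero = 0ℚ
recip (suc n) = proj₁ (reciprocal (fromℕ (suc n)) (fromℕ-suc-positive n))

*-recip : ∀ n → 1 ℕ.≤ n → fromℕ n * recip n ≡ 1ℚ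
*-recip (suc n) _ = proj₂ (proj₂ (reciprocal (fromℕ (suc n)) (fromℕ-suc-positive n)))

recip-nonneg : ∀ n → 0ℚ ≤ recip n
recip-nonneg zero = ≤-refl
recip-nonneg (suc n) = <⇒≤ (proj₁ (proj₂ (reciprocal (fromℕ (suc n)) (fromℕ-suc-positive n))))

recip-antitone : ∀ {m n} → 1 ℕ.≤ m → m ℕ.≤ n → recip n ≤ recip m
recip-antitone {m} {n} 1≤m m≤n = begin
  recip n ≡⟨ sym (*-identityʳ (recip n)) ⟩
  recip n * 1ℚ ≡⟨ cong (recip n *_) (sym (*-recip m 1≤m)) ⟩
  recip n * (fromℕ m * recip m) ≤⟨ *-monoˡ (recip n) (recip-nonneg n) (*-mono-≤ (fromℕ-nonneg m) (recip-nonneg m) (fromℕ-mono m≤n) ≤-refl) ⟩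
  recip n * (fromℕ n * recip m) ≡⟨ eq (recip n) (fromℕ n) (recip m) ⟩
  fromℕ n * recip n * recip m ≡⟨ trans (cong (_* recip m) (*-recip n (ℕ.≤-trans 1≤m m≤n))) (*-identityˡ (recip m)) ⟩
  recip m ∎
  where
  open ≤-Reasoning
  eq : ∀ r n s → r * (n * s) ≡ n * r * s
  eq = solve-∀ ring

true⇒T : ∀ {b} → b ≡ true → Bool.T b
true⇒T refl = tt

T⇒true : ∀ {b} → Bool.T b → b ≡ true
T⇒true {true} _ = refl

module Giant (n : ℕ) (α : Fin n → Bool) (part : Fin n → ℕ)
  (1/E : ℚ) (0≤1/E : 0ℚ ≤ 1/E) (E*1/E : fromℕ (length (edges n)) * 1/E ≡ 1ℚ)
  (θ d : ℚ)
  (part-bound : ∀ u → ∑ (allFin n) (λ v → ⟦ α v ⟧ * ⟦ does (part u ℕ.≟ part v) ⟧) ≤ d)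
  where

  open Components n α part
  open Process (edges n) 1/E 0≤1/E E*1/E next public

  large? : ∀ lab → Dec (∃ λ v → α v ≡ true × θ ≤ fromℕ (size lab v))
  large? lab = Fin.any? (λ v → (α v Bool.≟ true) ×-dec (θ ≤? fromℕ (size lab v)))

  -- The goal of both phases, never lost again because components only grow. Until it is reached
  -- every component has order at most `θ`, which keeps the edges inside components rare.
  good : Labelling → Bool
  good lab = does (large? lab)

  good-next : ∀ lab e → good lab ≡ true → good (next lab e) ≡ true
  good-next lab e g with does-true (large? lab) g
  ... | v , αv , θ≤ = true-does (large? (next lab e)) (v , αv , ≤-trans θ≤ (fromℕ-mono (size-next lab e v)))

  small : ∀ lab → good lab ≡ false → ∀ v → α v ≡ true → fromℕ (size lab v) ≤ θ
  small lab ng v αv = <⇒≤ (≰⇒> (λ θ≤ → does-false (large? lab) ng (v , αv , θ≤)))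

  link-α : ∀ lab u v → α u ≡ false → link lab u v ≡ false
  link-α lab u v αu rewrite αu = refl

  -- The subtracted terms account for the part and for the component of u.
  link-sum : ∀ lab → good lab ≡ false → ∀ u → α u ≡ true → ∀ y → (∀ v → 0ℚ ≤ y v) → (∀ v → y v ≤ 1ℚ) →
    ∑α y - d - θ ≤ ∑ (allFin n) (λ v → ⟦ link lab u v ⟧ * y v)
  link-sum lab ng u αu y 0≤y y≤1 = begin
    ∑α y - d - θ
      ≤⟨ +-mono-≤ (+-monoʳ-≤ (∑α y) (neg-antimono-≤ (part-bound u))) (neg-antimono-≤ same-bound) ⟩
    ∑α y - ∑α (λ v → ⟦ does (part u ℕ.≟ part v) ⟧) - ∑α (λ v → ⟦ same lab u v ⟧)
      ≡⟨ sym (trans (∑α-- (λ v → y v - ⟦ does (part u ℕ.≟ part v) ⟧) (λ v → ⟦ same lab u v ⟧))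
           (cong (_- ∑α (λ v → ⟦ same lab u v ⟧)) (∑α-- y (λ v → ⟦ does (part u ℕ.≟ part v) ⟧)))) ⟩
    ∑α (λ v → y v - ⟦ does (part u ℕ.≟ part v) ⟧ - ⟦ same lab u v ⟧)
      ≤⟨ ∑-mono (allFin n) pointwise ⟩
    ∑ (allFin n) (λ v → ⟦ link lab u v ⟧ * y v) ∎
    where
    open ≤-Reasoning
    same-bound : ∑α (λ v → ⟦ same lab u v ⟧) ≤ θ
    same-bound = ≤-trans (≤-reflexive (trans (∑α-cong (λ v → cong ⟦_⟧ (same-sym lab u v))) (sym (fromℕ-size lab u)))) (small lab ng u αu)
    by-cases : ∀ a p s z → 0ℚ ≤ z → z ≤ 1ℚ → ⟦ a ⟧ * (z - ⟦ p ⟧ - ⟦ s ⟧) ≤ ⟦ (a ∧ not p) ∧ not s ⟧ * z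
    by-cases false p s z 0≤z z≤1 = ≤-reflexive (trans (*-zeroˡ (z - ⟦ p ⟧ - ⟦ s ⟧)) (sym (*-zeroˡ z)))
    by-cases true false false z 0≤z z≤1 = ≤-reflexive (eq z)
      where eq : ∀ z → 1ℚ * (z - 0ℚ - 0ℚ) ≡ 1ℚ * z
            eq = solve-∀ ring
    by-cases true true false z 0≤z z≤1 = ≤-cert (1ℚ - z) (p≤q⇒0≤q-p z≤1) (eq z)
      where eq : ∀ z → 1ℚ * (z - 1ℚ - 0ℚ) + (1ℚ - z) ≡ 0ℚ * z
            eq = solve-∀ ring
    by-cases true false true z 0≤z z≤1 = ≤-cert (1ℚ - z) (p≤q⇒0≤q-p z≤1) (eq z)
      where eq : ∀ z → 1ℚ * (z - 0ℚ - 1ℚ) + (1ℚ - z) ≡ 0ℚ * z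
            eq = solve-∀ ring
    by-cases true true true z 0≤z z≤1 = ≤-cert (1ℚ - z + 1ℚ) (+-nonneg (p≤q⇒0≤q-p z≤1) 0≤1) (eq z)
      where eq : ∀ z → 1ℚ * (z - 1ℚ - 1ℚ) + (1ℚ - z + 1ℚ) ≡ 0ℚ * z
            eq = solve-∀ ring
    pointwise : ∀ v → ⟦ α v ⟧ * (y v - ⟦ does (part u ℕ.≟ part v) ⟧ - ⟦ same lab u v ⟧) ≤ ⟦ link lab u v ⟧ * y v
    pointwise v rewrite αu = by-cases (α v) (does (part u ℕ.≟ part v)) (same lab u v) (y v) (0≤y v) (y≤1 v)

  total-drop : (ℕ → ℚ) → Labelling → ℚ
  total-drop f lab = ∑ (allFin n) (λ u → ∑ (allFin n) (drop f lab u))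

  avg-Potential : ∀ f lab → avg (λ e → Potential f (next lab e)) ≡ Potential f lab - 1/E * total-drop f lab
  avg-Potential f lab = trans (cong (1/E *_) (∑-Potential-next f lab)) (trans (eq 1/E E (Potential f lab) (total-drop f lab))
    (cong (λ z → z * Potential f lab - 1/E * total-drop f lab) E*1/E) ⟨ trans ⟩ cong (_- 1/E * total-drop f lab) (*-identityˡ (Potential f lab)))
    where
    eq : ∀ i e p t → i * (e * p - t) ≡ e * i * p - i * t
    eq = solve-∀ ring
    infixl 5 _⟨_⟩_
    _⟨_⟩_ : ∀ {A B C : Set} → A → (A → B → C) → B → C
    a ⟨ f ⟩ b = f a b

  -- For powers the loss factors as a x^a (1 - x^b). Summed over u the first factor gives x P′(x),
  -- and summed over the v linked to u the second gives |α| - P up to `d + θ`, by `link-sum`: the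
  -- nonlinear term of the Burgers equation.
  total-drop-pow : ∀ x lab → 0ℚ ≤ x → x ≤ 1ℚ → good lab ≡ false →
    ∑α (λ u → fromℕ (size lab u) * pow x (size lab u)) * (|α| - Potential (pow x) lab - d - θ) ≤ total-drop (pow x) lab
  total-drop-pow x lab 0≤x x≤1 ng = begin
    ∑α g * (|α| - Potential (pow x) lab - d - θ)
      ≡⟨ sym (∑α-*ʳ _ g) ⟩
    ∑α (λ u → g u * (|α| - Potential (pow x) lab - d - θ))
      ≤⟨ ∑-mono (allFin n) per-vertex ⟩
    total-drop (pow x) lab ∎
    where
    open ≤-Reasoning
    g y : Fin n → ℚ
    g u = fromℕ (size lab u) * pow x (size lab u)
    y v = 1ℚ - pow x (size lab v)
    0≤y : ∀ v → 0ℚ ≤ y v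
    0≤y v = p≤q⇒0≤q-p (pow≤1 (size lab v) 0≤x x≤1)
    y≤1 : ∀ v → y v ≤ 1ℚ
    y≤1 v = ≤-cert (pow x (size lab v)) (pow-nonneg (size lab v) 0≤x) (eq (pow x (size lab v)))
      where eq : ∀ p → 1ℚ - p + p ≡ 1ℚ
            eq = solve-∀ ring
    loss-pow : ∀ a b → loss (pow x) a b ≡ fromℕ a * pow x a * (1ℚ - pow x b)
    loss-pow a b = trans (cong (λ z → fromℕ a * (pow x a - z)) (pow-+ x a b)) (eq (fromℕ a) (pow x a) (pow x b))
      where eq : ∀ a p q → a * (p - p * q) ≡ a * p * (1ℚ - q)
            eq = solve-∀ ring
    row : ∀ u → ∑ (allFin n) (drop (pow x) lab u) ≡ g u * ∑ (allFin n) (λ v → ⟦ link lab u v ⟧ * y v)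
    row u = trans (∑-cong (allFin n) (λ v → trans (cong (⟦ link lab u v ⟧ *_) (loss-pow (size lab u) (size lab v))) (eq ⟦ link lab u v ⟧ (g u) (y v))))
      (∑-*ˡ (allFin n) (g u) (λ v → ⟦ link lab u v ⟧ * y v))
      where eq : ∀ l g y → l * (g * y) ≡ g * (l * y)
            eq = solve-∀ ring
    per-vertex : ∀ u → ⟦ α u ⟧ * (g u * (|α| - Potential (pow x) lab - d - θ)) ≤ ∑ (allFin n) (drop (pow x) lab u)
    per-vertex u = by-α (α u) refl
      where
      by-α : ∀ b → α u ≡ b → ⟦ b ⟧ * (g u * (|α| - Potential (pow x) lab - d - θ)) ≤ ∑ (allFin n) (drop (pow x) lab u)
      by-α true αu = begin
        1ℚ * (g u * (|α| - Potential (pow x) lab - d - θ))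
          ≡⟨ trans (*-identityˡ _) (cong (λ z → g u * (z - d - θ)) (sym (∑α-- (λ _ → 1ℚ) (λ v → pow x (size lab v))))) ⟩
        g u * (∑α y - d - θ)
          ≤⟨ *-monoˡ (g u) (*-nonneg (fromℕ-nonneg (size lab u)) (pow-nonneg (size lab u) 0≤x)) (link-sum lab ng u αu y 0≤y y≤1) ⟩
        g u * ∑ (allFin n) (λ v → ⟦ link lab u v ⟧ * y v)
          ≡⟨ sym (row u) ⟩
        ∑ (allFin n) (drop (pow x) lab u) ∎
      by-α false αu = ≤-reflexive (trans (*-zeroˡ (g u * (|α| - Potential (pow x) lab - d - θ))) (sym (trans (∑-cong (allFin n)
          (λ v → trans (cong (λ b → ⟦ b ⟧ * loss (pow x) (size lab u) (size lab v)) (link-α lab u v αu)) (*-zeroˡ (loss (pow x) (size lab u) (size lab v)))))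
          (trans (∑-const (allFin n) 0ℚ) (*-zeroʳ (fromℕ (length (allFin n))))))))

  drop-bounds : ∀ f B → (∀ a b → 0ℚ ≤ loss f a b) → (∀ a b → loss f a b ≤ B) → 0ℚ ≤ B →
    ∀ lab u v → 0ℚ ≤ drop f lab u v × drop f lab u v ≤ B
  drop-bounds f B 0≤loss loss≤B 0≤B lab u v = *-nonneg (⟦⟧-nonneg (link lab u v)) (0≤loss a b) ,
    ≤-trans (*-mono-≤ (⟦⟧-nonneg (link lab u v)) 0≤B (⟦⟧≤1 (link lab u v)) (loss≤B a b)) (≤-reflexive (*-identityˡ B))
    where a b : ℕ
          a = size lab u
          b = size lab v

  Potential-decrease : ∀ f B → (∀ a b → 0ℚ ≤ loss f a b) → (∀ a b → loss f a b ≤ B) → 0ℚ ≤ B →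
    ∀ lab e → - (B + B) ≤ Potential f (next lab e) - Potential f lab × Potential f (next lab e) - Potential f lab ≤ 0ℚ
  Potential-decrease f B 0≤loss loss≤B 0≤B lab e@((i , j) , _) =
    subst (- (B + B) ≤_) (sym difference) (neg-antimono-≤ (+-mono-≤ (proj₂ ij) (proj₂ ji))) ,
    subst (_≤ 0ℚ) (sym difference) (neg-antimono-≤ (+-nonneg (proj₁ ij) (proj₁ ji)))
    where
    ij : 0ℚ ≤ drop f lab i j × drop f lab i j ≤ B
    ij = drop-bounds f B 0≤loss loss≤B 0≤B lab i j
    ji : 0ℚ ≤ drop f lab j i × drop f lab j i ≤ B
    ji = drop-bounds f B 0≤loss loss≤B 0≤B lab j i
    difference : Potential f (next lab e) - Potential f lab ≡ - (drop f lab i j + drop f lab j i)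
    difference = trans (cong (_-_ (Potential f (next lab e))) (Potential-next f lab e)) (eq (Potential f (next lab e)) (drop f lab i j + drop f lab j i))
      where eq : ∀ p d → p - (p + d) ≡ - d
            eq = solve-∀ ring

  -- First phase: the generating function ∑ x^|C(v)| is followed along the characteristic x t of the Burgers
  -- equation that it satisfies in the mean-field limit; along it, its drift is nonpositive.
  module Subcritical (x₀ h κ M ζ : ℚ) (T : ℕ) (1≤2x₀ : 1ℚ ≤ 2ℚ * x₀) (0≤h : 0ℚ ≤ h) (0<κ : 0ℚ < κ) (0≤M : 0ℚ ≤ M) (κM : κ * M ≡ 1ℚ)
    (0≤ζ : 0ℚ ≤ ζ) (x-end : x₀ + fromℕ T * h ≡ 1ℚ - κ) (hn≤1 : h * fromℕ n ≤ 1ℚ)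
    (slack : 0ℚ ≤ (1ℚ - x₀) * |α| - ζ - 2ℚ * M - d - θ)
    (speed : E * h ≤ x₀ * ((1ℚ - x₀) * |α| - ζ - 2ℚ * M - d - θ))
    where

    x : ℕ → ℚ
    x t = x₀ + fromℕ t * h

    x-suc : ∀ t → x (suc t) - x t ≡ h
    x-suc t = trans (cong (λ z → x₀ + z * h - x t) (fromℕ-suc t)) (eq x₀ (fromℕ t) h)
      where eq : ∀ x t h → x + (1ℚ + t) * h - (x + t * h) ≡ h
            eq = solve-∀ ring

    0≤x₀ : 0ℚ ≤ x₀
    0≤x₀ = *-cancelˡ 2ℚ (positive⁻¹ 2ℚ) (≤-trans (≤-reflexive (*-zeroʳ 2ℚ)) (≤-trans 0≤1 1≤2x₀))

    x₀≤x : ∀ t → x₀ ≤ x t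
    x₀≤x t = ≤-cert (fromℕ t * h) (*-nonneg (fromℕ-nonneg t) 0≤h) refl

    0≤x : ∀ t → 0ℚ ≤ x t
    0≤x t = ≤-trans 0≤x₀ (x₀≤x t)

    1≤2x : ∀ t → 1ℚ ≤ 2ℚ * x t
    1≤2x t = ≤-trans 1≤2x₀ (*-monoˡ 2ℚ 0≤2 (x₀≤x t))

    0<x : ∀ t → 0ℚ < x t
    0<x t = *-cancelˡ-<-nonNeg 2ℚ (≤-<-trans (≤-reflexive (*-zeroʳ 2ℚ)) (<-≤-trans 0<1 (1≤2x t)))

    x≤1-κ : ∀ t → t ℕ.≤ T → x t ≤ 1ℚ - κ
    x≤1-κ t t≤T = subst (x t ≤_) x-end (+-monoʳ-≤ x₀ (*-mono-≤ (fromℕ-nonneg t) 0≤h (fromℕ-mono t≤T) ≤-refl))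

    x≤1 : ∀ t → t ℕ.≤ T → x t ≤ 1ℚ
    x≤1 t t≤T = ≤-trans (x≤1-κ t t≤T) (≤-cert κ (<⇒≤ 0<κ) (eq κ))
      where eq : ∀ κ → 1ℚ - κ + κ ≡ 1ℚ
            eq = solve-∀ ring

    -- By `pow-decay`, since 1 - x ≥ κ = 1 / M up to the last round. All losses and increments of
    -- the first phase are bounded through this.
    decay : ∀ t → t ℕ.≤ T → ∀ c → fromℕ c * pow (x t) c ≤ M
    decay t t≤T c = begin
      cx ≡⟨ sym (*-identityˡ cx) ⟩
      1ℚ * cx ≡⟨ trans (cong (_* cx) (sym κM)) (eq κ M cx) ⟩
      M * (κ * cx) ≤⟨ *-monoˡ M 0≤M (*-mono-≤ (<⇒≤ 0<κ) 0≤cx κ≤1-x ≤-refl) ⟩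
      M * ((1ℚ - x t) * cx) ≤⟨ *-monoˡ M 0≤M (≤-trans (pow-decay c (0≤x t) (x≤1 t t≤T)) (≤-cert (pow (x t) c) (pow-nonneg c (0≤x t)) (eq₂ (pow (x t) c)))) ⟩
      M * 1ℚ ≡⟨ *-identityʳ M ⟩
      M ∎
      where
      open ≤-Reasoning
      cx : ℚ
      cx = fromℕ c * pow (x t) c
      0≤cx : 0ℚ ≤ cx
      0≤cx = *-nonneg (fromℕ-nonneg c) (pow-nonneg c (0≤x t))
      κ≤1-x : κ ≤ 1ℚ - x t
      κ≤1-x = ≤-cert (1ℚ - κ - x t) (p≤q⇒0≤q-p (x≤1-κ t t≤T)) (eq₁ κ (x t))
        where eq₁ : ∀ κ x → κ + (1ℚ - κ - x) ≡ 1ℚ - x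
              eq₁ = solve-∀ ring
      eq : ∀ κ M c → κ * M * c ≡ M * (κ * c)
      eq = solve-∀ ring
      eq₂ : ∀ p → 1ℚ - p + p ≡ 1ℚ
      eq₂ = solve-∀ ring

    Y : ℕ → Labelling → ℚ
    Y t lab = Potential (pow (x t)) lab

    G : ℕ → Labelling → ℚ
    G t lab = ∑α (λ u → fromℕ (size lab u) * pow (x t) (size lab u))

    G-nonneg : ∀ t lab → 0ℚ ≤ G t lab
    G-nonneg t lab = ∑α-nonneg (λ u → *-nonneg (fromℕ-nonneg (size lab u)) (pow-nonneg (size lab u) (0≤x t)))

    -- The gain from moving x while the labelling is fixed. `G (suc t)` is x P′(x) at the new x, the
    -- same factor as in `total-drop-pow`, so that gain and loss can be compared.
    advance : ∀ t lab → x (suc t) * (Potential (pow (x (suc t))) lab - Y t lab) ≤ h * G (suc t) lab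
    advance t lab = begin
      x (suc t) * (Potential (pow (x (suc t))) lab - Y t lab)
        ≡⟨ trans (cong (x (suc t) *_) (sym (∑α-- _ _))) (sym (∑α-* (x (suc t)) _)) ⟩
      ∑α (λ v → x (suc t) * (pow (x (suc t)) (size lab v) - pow (x t) (size lab v)))
        ≤⟨ ∑α-mono (λ v _ → pow-tangent (size lab v) (0≤x t) x≤) ⟩
      ∑α (λ v → (x (suc t) - x t) * (fromℕ (size lab v) * pow (x (suc t)) (size lab v)))
        ≡⟨ trans (∑α-* (x (suc t) - x t) _) (cong (_* G (suc t) lab) (x-suc t)) ⟩
      h * G (suc t) lab ∎
      where
      open ≤-Reasoning
      x≤ : x t ≤ x (suc t)
      x≤ = 0≤q-p⇒p≤q (subst (0ℚ ≤_) (sym (x-suc t)) 0≤h)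

    -- Here G ≤ n M by `decay` and h n ≤ 1; dividing by x ≥ 1/2 accounts for the factor 2.
    advance≤2M : ∀ t lab → t ℕ.< T → Potential (pow (x (suc t))) lab - Y t lab ≤ 2ℚ * M
    advance≤2M t lab t<T = *-cancelˡ (x (suc t)) (0<x (suc t)) (begin
      x (suc t) * (Potential (pow (x (suc t))) lab - Y t lab) ≤⟨ advance t lab ⟩
      h * G (suc t) lab ≤⟨ *-monoˡ h 0≤h (≤-trans (∑α-mono (λ u _ → decay (suc t) t<T (size lab u))) (≤-trans (≤-reflexive (∑α-const M)) (*-mono-≤ (∑α-nonneg (λ _ → 0≤1)) 0≤M |α|≤n ≤-refl))) ⟩
      h * (fromℕ n * M) ≡⟨ sym (*-assoc h (fromℕ n) M) ⟩
      h * fromℕ n * M ≤⟨ *-mono-≤ (*-nonneg 0≤h (fromℕ-nonneg n)) 0≤M hn≤1 ≤-refl ⟩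
      1ℚ * M ≤⟨ *-mono-≤ 0≤1 0≤M (1≤2x (suc t)) ≤-refl ⟩
      2ℚ * x (suc t) * M ≡⟨ eq 2ℚ (x (suc t)) M ⟩
      x (suc t) * (2ℚ * M) ∎)
      where
      open ≤-Reasoning
      eq : ∀ a x m → a * x * m ≡ x * (a * m)
      eq = solve-∀ ring

    advance≥0 : ∀ t lab → 0ℚ ≤ Potential (pow (x (suc t))) lab - Y t lab
    advance≥0 t lab = p≤q⇒0≤q-p (∑α-mono (λ v _ → pow-mono (size lab v) (0≤x t) x≤))
      where
      x≤ : x t ≤ x (suc t)
      x≤ = 0≤q-p⇒p≤q (subst (0ℚ ≤_) (sym (x-suc t)) 0≤h)

    drift : ∀ t lab → t ℕ.< T → ⊤ → good lab ≡ false → Y t lab < x₀ * |α| + ζ → avg (λ e → Y (suc t) (next lab e)) ≤ Y t lab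
    drift t lab t<T _ ng Y< = begin
      avg (λ e → Y (suc t) (next lab e)) ≡⟨ avg-Potential (pow x′) lab ⟩
      P′ - 1/E * D ≤⟨ ≤-cert (1/E * D - (P′ - Y t lab)) (p≤q⇒0≤q-p enough) (eq₁ P′ (1/E * D) (Y t lab)) ⟩
      Y t lab ∎
      where
      open ≤-Reasoning
      x′ P′ D F B g : ℚ
      x′ = x (suc t)
      P′ = Potential (pow x′) lab
      D = total-drop (pow x′) lab
      g = G (suc t) lab
      F = |α| - P′ - d - θ
      B = (1ℚ - x₀) * |α| - ζ - 2ℚ * M - d - θ
      eq₁ : ∀ p d y → p - d + (d - (p - y)) ≡ y
      eq₁ = solve-∀ ring
      -- The assumption that Y is below its level enters here: P′ exceeds Y by at most 2M, so |α| -
      -- P′ is at least (1 - x₀) |α| - ζ - 2M.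
      B≤F : B ≤ F
      B≤F = ≤-cert ((2ℚ * M - (P′ - Y t lab)) + (x₀ * |α| + ζ - Y t lab))
        (+-nonneg (p≤q⇒0≤q-p (advance≤2M t lab t<T)) (p≤q⇒0≤q-p (<⇒≤ Y<))) (eq x₀ |α| ζ (2ℚ * M) d θ P′ (Y t lab))
        where eq : ∀ x a ζ m d θ p y → (1ℚ - x) * a - ζ - m - d - θ + ((m - (p - y)) + (x * a + ζ - y)) ≡ a - p - d - θ
              eq = solve-∀ ring
      Eh≤x′F : E * h ≤ x′ * F
      Eh≤x′F = ≤-trans speed (*-mono-≤ 0≤x₀ (≤-trans slack B≤F) (x₀≤x (suc t)) B≤F)
      enough : P′ - Y t lab ≤ 1/E * D
      enough = *-cancelˡ x′ (0<x (suc t)) (begin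
        x′ * (P′ - Y t lab) ≤⟨ advance t lab ⟩
        h * g ≡⟨ trans (sym (*-identityˡ (h * g))) (trans (cong (_* (h * g)) (sym E*1/E)) (eq E 1/E h g)) ⟩
        E * h * (1/E * g) ≤⟨ *-mono-≤ (*-nonneg (fromℕ-nonneg _) 0≤h) (*-nonneg 0≤1/E (G-nonneg (suc t) lab)) Eh≤x′F ≤-refl ⟩
        x′ * F * (1/E * g) ≡⟨ eq₂ x′ F 1/E g ⟩
        x′ * (1/E * (g * F)) ≤⟨ *-monoˡ x′ (0≤x (suc t)) (*-monoˡ 1/E 0≤1/E (total-drop-pow x′ lab (0≤x (suc t)) (x≤1 (suc t) t<T) ng)) ⟩
        x′ * (1/E * D) ∎)
        where
        eq : ∀ e i h g → e * i * (h * g) ≡ e * h * (i * g)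
        eq = solve-∀ ring
        eq₂ : ∀ x f i g → x * f * (i * g) ≡ x * (i * (g * f))
        eq₂ = solve-∀ ring

    loss-nonneg : ∀ t → t ℕ.≤ T → ∀ a b → 0ℚ ≤ loss (pow (x t)) a b
    loss-nonneg t t≤T a b = *-nonneg (fromℕ-nonneg a) (p≤q⇒0≤q-p {pow (x t) (a ℕ.+ b)} {pow (x t) a} (≤-trans (≤-reflexive (pow-+ (x t) a b))
      (≤-trans (*-monoˡ (pow (x t) a) (pow-nonneg a (0≤x t)) (pow≤1 b (0≤x t) (x≤1 t t≤T))) (≤-reflexive (*-identityʳ (pow (x t) a))))))

    loss≤M : ∀ t → t ℕ.≤ T → ∀ a b → loss (pow (x t)) a b ≤ M
    loss≤M t t≤T a b = ≤-trans (≤-cert (fromℕ a * pow (x t) (a ℕ.+ b)) (*-nonneg (fromℕ-nonneg a) (pow-nonneg (a ℕ.+ b) (0≤x t)))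
      (eq (fromℕ a) (pow (x t) a) (pow (x t) (a ℕ.+ b)))) (decay t t≤T a)
      where eq : ∀ a p q → a * (p - q) + a * q ≡ a * p
            eq = solve-∀ ring

    -- A merge lowers the potential by at most 2M and the advance of x raises it by at most 2M. The
    -- two have opposite signs, so the bounds do not add up.
    increment : ∀ t lab e → t ℕ.< T → ⊤ → good lab ≡ false → Y t lab < x₀ * |α| + ζ →
      - (2ℚ * M) ≤ Y (suc t) (next lab e) - Y t lab × Y (suc t) (next lab e) - Y t lab ≤ 2ℚ * M
    increment t lab e t<T _ _ _ =
      ≤-trans (≤-reflexive (eq₁ M)) (subst (- (M + M) + 0ℚ ≤_) (eq (Y (suc t) (next lab e)) (Y (suc t) lab) (Y t lab)) (+-mono-≤ (proj₁ decrease) (advance≥0 t lab))) ,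
      ≤-trans (subst (_≤ 0ℚ + 2ℚ * M) (eq (Y (suc t) (next lab e)) (Y (suc t) lab) (Y t lab)) (+-mono-≤ (proj₂ decrease) (advance≤2M t lab t<T))) (≤-reflexive (+-identityˡ (2ℚ * M)))
      where
      decrease = Potential-decrease (pow (x (suc t))) M (loss-nonneg (suc t) t<T) (loss≤M (suc t) t<T) 0≤M lab e
      eq : ∀ a b c → a - b + (b - c) ≡ a - c
      eq = solve-∀ ring
      eq₁ : ∀ m → - ((1ℚ + 1ℚ) * m) ≡ - (m + m) + 0ℚ
      eq₁ = solve-∀ ring

    failed : Labelling → Bool
    failed lab = not (good lab) ∧ does (x₀ * |α| + ζ ≤? Potential (pow (1ℚ - κ)) lab)

    failure-bound : ζ * ζ * Exp T (λ s → ⟦ failed s ⟧) id ≤ fromℕ T * (2ℚ * M * (2ℚ * M))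
    failure-bound = chebyshev failed failed⇒ id tt initial
      where
      open Concentration (λ _ → ⊤) (λ _ _ _ → tt) good good-next Y (x₀ * |α|) ζ (2ℚ * M) 0≤ζ T drift increment
      failed⇒ : ∀ s → ⊤ → failed s ≡ true → good s ≡ false × x₀ * |α| + ζ ≤ Y T s
      failed⇒ s _ f with good s | ∧-true {not (good s)} f
      ... | false | _ , le = refl , subst (λ z → x₀ * |α| + ζ ≤ Potential (pow z) s) (sym x-end) (does-true (x₀ * |α| + ζ ≤? Potential (pow (1ℚ - κ)) s) le)
      initial : Y 0 id ≤ x₀ * |α|
      initial = ≤-trans (∑α-mono pow≤x₀) (≤-reflexive (trans (∑α-const x₀) (*-comm |α| x₀)))
        where
        x0≡ : x 0 ≡ x₀
        x0≡ = trans (cong (λ z → x₀ + z * h) fromℕ-0) (eq x₀ h)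
          where eq : ∀ x h → x + 0ℚ * h ≡ x
                eq = solve-∀ ring
        -- Of the initial components only the order being at least 1 is used: x^c ≤ x for c ≥ 1.
        pow≤x₀ : ∀ v → α v ≡ true → pow (x 0) (size id v) ≤ x₀
        pow≤x₀ v αv with size id v | size-positive id v αv
        ... | suc c | _ = ≤-trans (*-monoˡ (x 0) (0≤x 0) (pow≤1 c (0≤x 0) (x≤1 0 ℕ.z≤n))) (≤-reflexive (trans (*-identityʳ (x 0)) x0≡))

  big : ℕ → Labelling → ℚ
  big K lab = ∑α (λ v → ⟦ K ℕ.≤ᵇ size lab v ⟧)

  big-next : ∀ K lab e → big K lab ≤ big K (next lab e)
  big-next K lab e = ∑α-mono (λ v _ → grows v)
    where
    grows : ∀ v → ⟦ K ℕ.≤ᵇ size lab v ⟧ ≤ ⟦ K ℕ.≤ᵇ size (next lab e) v ⟧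
    grows v with K ℕ.≤ᵇ size lab v in eq
    ... | false = ⟦⟧-nonneg (K ℕ.≤ᵇ size (next lab e) v)
    ... | true = ≤-reflexive (cong ⟦_⟧ (sym (T⇒true (ℕ.≤⇒≤ᵇ (ℕ.≤-trans (ℕ.≤ᵇ⇒≤ K (size lab v) (true⇒T eq)) (size-next lab e v))))))

  -- Second phase: as long as no component is large, a positive proportion of the edges joins two components of
  -- order at least K. The potential ∑ 1/max(|C(v)|, K) counts these components (each exactly once), and initially
  -- it is at most n/K, so it would become negative within the rounds of the phase.
  module Sprinkling (K : ℕ) (1≤K : 1 ℕ.≤ K) (W p ζ : ℚ) (T : ℕ) (0≤p : 0ℚ ≤ p) (p≤2 : p ≤ 2ℚ) (0≤ζ : 0ℚ ≤ ζ) (0≤W : 0ℚ ≤ W)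
    (slack : 0ℚ ≤ W - d - θ) (rate : 2ℚ * (p * E) ≤ W * (W - d - θ)) (long : fromℕ n * recip K + ζ ≤ fromℕ T * p)
    where

    f : ℕ → ℚ
    f c = recip (K ℕ.⊔ c)

    f-antitone : ∀ {a b} → a ℕ.≤ b → f b ≤ f a
    f-antitone {a} {b} a≤b = recip-antitone (ℕ.≤-trans 1≤K (ℕ.m≤m⊔n K a)) (ℕ.⊔-monoʳ-≤ K a≤b)

    *-f≤1 : ∀ c → fromℕ c * f c ≤ 1ℚ
    *-f≤1 c = ≤-trans (*-mono-≤ (fromℕ-nonneg c) (recip-nonneg (K ℕ.⊔ c)) (fromℕ-mono (ℕ.m≤n⊔m K c)) ≤-refl)
      (≤-reflexive (*-recip (K ℕ.⊔ c) (ℕ.≤-trans 1≤K (ℕ.m≤m⊔n K c))))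

    *-f≡1 : ∀ c → K ℕ.≤ c → fromℕ c * f c ≡ 1ℚ
    *-f≡1 c K≤c = trans (cong (λ m → fromℕ c * recip m) (ℕ.m≤n⇒m⊔n≡n K≤c)) (*-recip c (ℕ.≤-trans 1≤K K≤c))

    loss-nonneg : ∀ a b → 0ℚ ≤ loss f a b
    loss-nonneg a b = *-nonneg (fromℕ-nonneg a) (p≤q⇒0≤q-p (f-antitone (ℕ.m≤m+n a b)))

    loss≤1 : ∀ a b → loss f a b ≤ 1ℚ
    loss≤1 a b = ≤-trans (≤-cert (fromℕ a * f (a ℕ.+ b)) (*-nonneg (fromℕ-nonneg a) (recip-nonneg (K ℕ.⊔ (a ℕ.+ b))))
      (eq (fromℕ a) (f a) (f (a ℕ.+ b)))) (*-f≤1 a)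
      where eq : ∀ a p q → a * (p - q) + a * q ≡ a * p
            eq = solve-∀ ring

    -- Every component of order at least K contributes exactly 1 to the potential, and two of them
    -- become one.
    loss-big : ∀ a b → K ℕ.≤ a → K ℕ.≤ b → loss f a b + loss f b a ≡ 1ℚ
    loss-big a b K≤a K≤b = begin
      loss f a b + loss f b a
        ≡⟨ cong (λ c → loss f a b + fromℕ b * (f b - f c)) (ℕ.+-comm b a) ⟩
      fromℕ a * (f a - f (a ℕ.+ b)) + fromℕ b * (f b - f (a ℕ.+ b))
        ≡⟨ eq (fromℕ a) (fromℕ b) (f a) (f b) (f (a ℕ.+ b)) ⟩
      fromℕ a * f a + fromℕ b * f b - (fromℕ a + fromℕ b) * f (a ℕ.+ b)
        ≡⟨ cong₂ _-_ (cong₂ _+_ (*-f≡1 a K≤a) (*-f≡1 b K≤b)) (trans (cong (_* f (a ℕ.+ b)) (sym (fromℕ-+ a b))) (*-f≡1 (a ℕ.+ b) (ℕ.≤-trans K≤a (ℕ.m≤m+n a b)))) ⟩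
      1ℚ + 1ℚ - 1ℚ ≡⟨⟩
      1ℚ ∎
      where
      open ≡-Reasoning
      eq : ∀ a b x y z → a * (x - z) + b * (y - z) ≡ a * x + b * y - (a + b) * z
      eq = solve-∀ ring

    Enough : Labelling → Set
    Enough lab = W ≤ big K lab

    Enough-next : ∀ lab e → Enough lab → Enough (next lab e)
    Enough-next lab e i = ≤-trans i (big-next K lab e)

    -- For a pair of big components only the sum of the two losses is known to be 1, so the double
    -- sum is symmetrised, hence the factor 2. By `link-sum` each of the at least W vertices in big
    -- components is linked to at least W - d - θ others of this kind.
    total-drop-big : ∀ lab → good lab ≡ false → Enough lab → W * (W - d - θ) ≤ 2ℚ * total-drop f lab
    total-drop-big lab ng i = begin
      W * (W - d - θ)
        ≤⟨ *-mono-≤ 0≤W (≤-trans slack W≤) i W≤ ⟩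
      big K lab * (big K lab - d - θ)
        ≡⟨ sym (∑α-*ʳ (big K lab - d - θ) is-big) ⟩
      ∑α (λ u → is-big u * (big K lab - d - θ))
        ≤⟨ ∑-mono (allFin n) per-vertex ⟩
      ∑ (allFin n) (λ u → ∑ (allFin n) (λ v → drop f lab u v + drop f lab v u))
        ≡⟨ trans (∑-cong (allFin n) (λ u → ∑-+ (allFin n) (drop f lab u) (λ v → drop f lab v u)))
             (∑-+ (allFin n) (λ u → ∑ (allFin n) (drop f lab u)) (λ u → ∑ (allFin n) (λ v → drop f lab v u))) ⟩
      total-drop f lab + ∑ (allFin n) (λ u → ∑ (allFin n) (λ v → drop f lab v u))
        ≡⟨ cong (_+_ (total-drop f lab)) (∑-swap (allFin n) (allFin n) (λ u v → drop f lab v u)) ⟩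
      total-drop f lab + total-drop f lab
        ≡⟨ eq (total-drop f lab) ⟩
      2ℚ * total-drop f lab ∎
      where
      open ≤-Reasoning
      eq : ∀ t → t + t ≡ (1ℚ + 1ℚ) * t
      eq = solve-∀ ring
      is-big : Fin n → ℚ
      is-big v = ⟦ K ℕ.≤ᵇ size lab v ⟧
      W≤ : W - d - θ ≤ big K lab - d - θ
      W≤ = +-monoˡ-≤ (- θ) (+-monoˡ-≤ (- d) i)
      both : ∀ u v → ⟦ link lab u v ⟧ * (is-big u * is-big v) ≤ drop f lab u v + drop f lab v u
      both u v = subst (λ b → ⟦ link lab u v ⟧ * (is-big u * is-big v) ≤ drop f lab u v + ⟦ b ⟧ * loss f (size lab v) (size lab u)) (link-sym lab u v)
        (≤-trans (*-monoˡ ⟦ link lab u v ⟧ (⟦⟧-nonneg (link lab u v)) bound) (≤-reflexive (*-distribˡ-+ ⟦ link lab u v ⟧ (loss f a b) (loss f b a))))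
        where
        a b : ℕ
        a = size lab u
        b = size lab v
        bound : is-big u * is-big v ≤ loss f a b + loss f b a
        bound with K ℕ.≤ᵇ a in K≤a | K ℕ.≤ᵇ b in K≤b
        ... | true | true = ≤-reflexive (sym (loss-big a b (ℕ.≤ᵇ⇒≤ K a (true⇒T K≤a)) (ℕ.≤ᵇ⇒≤ K b (true⇒T K≤b))))
        ... | true | false = +-nonneg (loss-nonneg a b) (loss-nonneg b a)
        ... | false | true = +-nonneg (loss-nonneg a b) (loss-nonneg b a)
        ... | false | false = +-nonneg (loss-nonneg a b) (loss-nonneg b a)
      per-vertex : ∀ u → ⟦ α u ⟧ * (is-big u * (big K lab - d - θ)) ≤ ∑ (allFin n) (λ v → drop f lab u v + drop f lab v u)
      per-vertex u = by-α (α u) refl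
        where
        row : is-big u * ∑ (allFin n) (λ v → ⟦ link lab u v ⟧ * is-big v) ≤ ∑ (allFin n) (λ v → drop f lab u v + drop f lab v u)
        row = ≤-trans (≤-reflexive (trans (sym (∑-*ˡ (allFin n) (is-big u) (λ v → ⟦ link lab u v ⟧ * is-big v)))
          (∑-cong (allFin n) (λ v → eq′ (is-big u) ⟦ link lab u v ⟧ (is-big v))))) (∑-mono (allFin n) (both u))
          where eq′ : ∀ a l b → a * (l * b) ≡ l * (a * b)
                eq′ = solve-∀ ring
        by-α : ∀ b → α u ≡ b → ⟦ b ⟧ * (is-big u * (big K lab - d - θ)) ≤ ∑ (allFin n) (λ v → drop f lab u v + drop f lab v u)
        by-α true αu = ≤-trans (≤-reflexive (*-identityˡ (is-big u * (big K lab - d - θ)))) (≤-trans (*-monoˡ (is-big u) (⟦⟧-nonneg (K ℕ.≤ᵇ size lab u))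
          (link-sum lab ng u αu is-big (λ v → ⟦⟧-nonneg (K ℕ.≤ᵇ size lab v)) (λ v → ⟦⟧≤1 (K ℕ.≤ᵇ size lab v)))) row)
        by-α false αu = ≤-trans (≤-reflexive (*-zeroˡ (is-big u * (big K lab - d - θ))))
          (∑-nonneg (allFin n) (λ v → +-nonneg (proj₁ (drop-bounds f 1ℚ loss-nonneg loss≤1 0≤1 lab u v)) (proj₁ (drop-bounds f 1ℚ loss-nonneg loss≤1 0≤1 lab v u))))

    -- The potential falls by at least `p` per round on average while no component is large; adding
    -- `t p` leaves a supermartingale.
    Y : ℕ → Labelling → ℚ
    Y t lab = Potential f lab + fromℕ t * p

    drift : ∀ t lab → t ℕ.< T → Enough lab → good lab ≡ false → Y t lab < fromℕ n * recip K + ζ → avg (λ e → Y (suc t) (next lab e)) ≤ Y t lab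
    drift t lab _ i ng _ = begin
      avg (λ e → Y (suc t) (next lab e))
        ≡⟨ trans (avg-+ (λ e → Potential f (next lab e)) (λ _ → fromℕ (suc t) * p)) (cong₂ _+_ (avg-Potential f lab) (trans (avg-const (fromℕ (suc t) * p)) (cong (_* p) (fromℕ-suc t)))) ⟩
      Potential f lab - 1/E * D + (1ℚ + fromℕ t) * p
        ≤⟨ ≤-cert (1/E * D - p) (p≤q⇒0≤q-p p≤D/E) (eq (Potential f lab) (1/E * D) (fromℕ t) p) ⟩
      Y t lab ∎
      where
      open ≤-Reasoning
      D : ℚ
      D = total-drop f lab
      eq : ∀ q d t p → q - d + (1ℚ + t) * p + (d - p) ≡ q + t * p
      eq = solve-∀ ring
      p≤D/E : p ≤ 1/E * D
      p≤D/E = *-cancelˡ 2ℚ (positive⁻¹ 2ℚ) (begin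
        2ℚ * p ≡⟨ trans (sym (*-identityˡ (2ℚ * p))) (trans (cong (_* (2ℚ * p)) (sym E*1/E)) (eq₁ E 1/E 2ℚ p)) ⟩
        1/E * (2ℚ * (p * E)) ≤⟨ *-monoˡ 1/E 0≤1/E (≤-trans rate (total-drop-big lab ng i)) ⟩
        1/E * (2ℚ * D) ≡⟨ eq₂ 1/E 2ℚ D ⟩
        2ℚ * (1/E * D) ∎)
        where
        eq₁ : ∀ e i t p → e * i * (t * p) ≡ i * (t * (p * e))
        eq₁ = solve-∀ ring
        eq₂ : ∀ i t d → i * (t * d) ≡ t * (i * d)
        eq₂ = solve-∀ ring

    increment : ∀ t lab e → t ℕ.< T → Enough lab → good lab ≡ false → Y t lab < fromℕ n * recip K + ζ →
      - 2ℚ ≤ Y (suc t) (next lab e) - Y t lab × Y (suc t) (next lab e) - Y t lab ≤ 2ℚ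
    increment t lab e _ _ _ _ =
      subst (- 2ℚ ≤_) (sym difference) (≤-trans (proj₁ decrease) (≤-cert p 0≤p refl)) ,
      subst (_≤ 2ℚ) (sym difference) (≤-trans (+-mono-≤ (proj₂ decrease) p≤2) (≤-reflexive (+-identityˡ 2ℚ)))
      where
      decrease = Potential-decrease f 1ℚ loss-nonneg loss≤1 0≤1 lab e
      difference : Y (suc t) (next lab e) - Y t lab ≡ Potential f (next lab e) - Potential f lab + p
      difference = trans (cong (λ z → Potential f (next lab e) + z * p - Y t lab) (fromℕ-suc t)) (eq (Potential f (next lab e)) (Potential f lab) (fromℕ t) p)
        where eq : ∀ a b t p → a + (1ℚ + t) * p - (b + t * p) ≡ a - b + p
              eq = solve-∀ ring

    failure-bound : ∀ lab → Enough lab → ζ * ζ * Exp T (λ s → ⟦ not (good s) ⟧) lab ≤ fromℕ T * (2ℚ * 2ℚ)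
    failure-bound lab i = chebyshev (λ s → not (good s)) not-good⇒ lab i initial
      where
      open Concentration Enough Enough-next good good-next Y (fromℕ n * recip K) ζ 2ℚ 0≤ζ T drift increment
      not-good⇒ : ∀ s → Enough s → not (good s) ≡ true → good s ≡ false × fromℕ n * recip K + ζ ≤ Y T s
      -- The potential is nonnegative, so by `long` the term T p alone reaches the level at the end,
      -- whatever the state is.
      not-good⇒ s _ g = Bool.not-injective g , ≤-trans long (≤-cert (Potential f s) (∑α-nonneg (λ v → recip-nonneg (K ℕ.⊔ size s v))) (+-comm (fromℕ T * p) (Potential f s)))
      initial : Y 0 lab ≤ fromℕ n * recip K
      initial = begin
        Potential f lab + fromℕ 0 * p ≡⟨ trans (cong (λ z → Potential f lab + z * p) fromℕ-0) (trans (cong (_+_ (Potential f lab)) (*-zeroˡ p)) (+-identityʳ (Potential f lab))) ⟩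
        Potential f lab ≤⟨ ∑α-mono (λ v _ → recip-antitone 1≤K (ℕ.m≤m⊔n K (size lab v))) ⟩
        ∑α (λ _ → recip K) ≡⟨ ∑α-const (recip K) ⟩
        |α| * recip K ≤⟨ *-mono-≤ (∑α-nonneg (λ _ → 0≤1)) (recip-nonneg K) |α|≤n ≤-refl ⟩
        fromℕ n * recip K ∎
        where open ≤-Reasoning

  Exp-not-good : ∀ m lab → good lab ≡ true → Exp m (λ s → ⟦ not (good s) ⟧) lab ≤ 0ℚ
  Exp-not-good m lab g = ≤-trans
    (Exp-mono (λ s → good s ≡ true) good-next m (λ s g → ≤-reflexive (cong (λ b → ⟦ not b ⟧) g)) lab g)
    (≤-reflexive (Exp-const m 0ℚ lab))

-- Choice of constants

½-split : ∀ δ → δ * ½ + δ * ½ ≡ δ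
½-split δ = trans (sym (*-distribˡ-+ δ ½ ½)) (*-identityʳ δ)

-- The constants of the construction with k = s² parts of q points: l n is both the order of the components
-- sought and the error allowed to the first potential.
module Constants (σ q : ℕ) (5≤σ : 5 ℕ.≤ σ) (1≤q : 1 ℕ.≤ q) where

  -- With l n as the unit, μ |α| is about s = σ + 5 units. Four are consumed by errors in `B-bound`
  -- and one by the factor x₀ of the speed, in `σ≤x₀[σ+1]`. The value of `K` comes from the second
  -- phase: its at least n / (2σ) rounds with drift 1 / Q² have to outweigh 2 n / K.
  s k Q K : ℕ
  s = σ ℕ.+ 5
  k = s ℕ.* s
  Q = q ℕ.* k
  K = 4 ℕ.* σ ℕ.* (Q ℕ.* Q)

  1≤σ : 1 ℕ.≤ σ
  1≤σ = ℕ.≤-trans (ℕ.s≤s ℕ.z≤n) 5≤σ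
  1≤s : 1 ℕ.≤ s
  1≤s = ℕ.≤-trans 1≤σ (ℕ.m≤m+n σ 5)
  1≤k : 1 ℕ.≤ k
  1≤k = ℕ.*-mono-≤ 1≤s 1≤s
  1≤Q : 1 ℕ.≤ Q
  1≤Q = ℕ.*-mono-≤ 1≤q 1≤k
  1≤K : 1 ℕ.≤ K
  1≤K = ℕ.*-mono-≤ (ℕ.*-mono-≤ {1} {4} (ℕ.s≤s ℕ.z≤n) 1≤σ) (ℕ.*-mono-≤ 1≤Q 1≤Q)

  -- The choice of `κ` gives κ K = l, which makes the vertices in components of order below K
  -- negligible in `big-bound`; `M` is 1 / κ.
  l μ κ M 1/K sℚ qℚ Qℚ Kℚ : ℚ
  sℚ = fromℕ s
  qℚ = fromℕ q
  Qℚ = fromℕ Q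
  Kℚ = fromℕ K
  l = recip Q
  μ = recip s
  1/K = recip K
  κ = l * 1/K
  M = Kℚ * Qℚ

  Ql : Qℚ * l ≡ 1ℚ
  Ql = *-recip Q 1≤Q
  sμ : sℚ * μ ≡ 1ℚ
  sμ = *-recip s 1≤s
  K1/K : Kℚ * 1/K ≡ 1ℚ
  K1/K = *-recip K 1≤K

  0≤l : 0ℚ ≤ l
  0≤l = recip-nonneg Q
  0≤μ : 0ℚ ≤ μ
  0≤μ = recip-nonneg s
  0≤1/K : 0ℚ ≤ 1/K
  0≤1/K = recip-nonneg K
  0≤κ : 0ℚ ≤ κ
  0≤κ = *-nonneg 0≤l 0≤1/K
  0≤M : 0ℚ ≤ M
  0≤M = *-nonneg (fromℕ-nonneg K) (fromℕ-nonneg Q)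

  recip≤1 : ∀ m → 1 ℕ.≤ m → recip m ≤ 1ℚ
  recip≤1 m 1≤m = ≤-trans (≤-trans (≤-reflexive (sym (*-identityˡ (recip m))))
    (*-mono-≤ 0≤1 (recip-nonneg m) (subst (_≤ fromℕ m) fromℕ-1 (fromℕ-mono 1≤m)) ≤-refl)) (≤-reflexive (*-recip m 1≤m))

  l≤1 : l ≤ 1ℚ
  l≤1 = recip≤1 Q 1≤Q

  recip-positive : ∀ m → 1 ℕ.≤ m → 0ℚ < recip m
  recip-positive (suc m) _ = proj₁ (proj₂ (reciprocal (fromℕ (suc m)) (fromℕ-suc-positive m)))

  0<l : 0ℚ < l
  0<l = recip-positive Q 1≤Q

  0<1/K : 0ℚ < 1/K
  0<1/K = recip-positive K 1≤K

  0<κ : 0ℚ < κ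
  0<κ = *-positive 0<l 0<1/K

  κM : κ * M ≡ 1ℚ
  κM = trans (eq l 1/K Kℚ Qℚ) (cong₂ _*_ Ql K1/K)
    where eq : ∀ l r k q → l * r * (k * q) ≡ q * l * (k * r)
          eq = solve-∀ ring

  κK : κ * Kℚ ≡ l
  κK = trans (eq l 1/K Kℚ) (trans (cong (l *_) K1/K) (*-identityʳ l))
    where eq : ∀ l r k → l * r * k ≡ l * (k * r)
          eq = solve-∀ ring

  Q≡ : Qℚ ≡ qℚ * (sℚ * sℚ)
  Q≡ = trans (fromℕ-* q k) (cong (qℚ *_) (fromℕ-* s s))

  lqs : l * (qℚ * sℚ) ≡ μ
  lqs = begin
    l * (qℚ * sℚ) ≡⟨ sym (*-identityʳ _) ⟩
    l * (qℚ * sℚ) * 1ℚ ≡⟨ cong (l * (qℚ * sℚ) *_) (sym sμ) ⟩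
    l * (qℚ * sℚ) * (sℚ * μ) ≡⟨ eq l qℚ sℚ μ ⟩
    qℚ * (sℚ * sℚ) * l * μ ≡⟨ cong (λ z → z * l * μ) (sym Q≡) ⟩
    Qℚ * l * μ ≡⟨ trans (cong (_* μ) Ql) (*-identityˡ μ) ⟩
    μ ∎
    where
    open ≡-Reasoning
    eq : ∀ l q s m → l * (q * s) * (s * m) ≡ q * (s * s) * l * m
    eq = solve-∀ ring

  1≤fromℕ : ∀ {m} → 1 ℕ.≤ m → 1ℚ ≤ fromℕ m
  1≤fromℕ {m} 1≤m = subst (_≤ fromℕ m) fromℕ-1 (fromℕ-mono 1≤m)

  l≤μ : l ≤ μ
  l≤μ = ≤-trans (≤-reflexive (sym (*-identityʳ l))) (subst (l * 1ℚ ≤_) lqs (*-monoˡ l 0≤l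
    (≤-trans (≤-reflexive (sym (*-identityˡ 1ℚ))) (*-mono-≤ 0≤1 (fromℕ-nonneg s) (1≤fromℕ 1≤q) (1≤fromℕ 1≤s)))))

  κ≤μ : κ ≤ μ
  κ≤μ = ≤-trans (*-monoˡ l 0≤l (recip≤1 K 1≤K)) (≤-trans (≤-reflexive (*-identityʳ l)) l≤μ)

  2μ≤1 : 2ℚ * μ ≤ 1ℚ
  2μ≤1 = subst (2ℚ * μ ≤_) sμ (*-mono-≤ 0≤2 0≤μ (subst (_≤ sℚ) 2≡ (fromℕ-mono {2} {s} (ℕ.≤-trans (ℕ.s≤s (ℕ.s≤s ℕ.z≤n)) (ℕ.m≤n+m 5 σ)))) ≤-refl)
    where 2≡ : fromℕ 2 ≡ 2ℚ
          2≡ = trans (fromℕ-suc 1) (cong (1ℚ +_) fromℕ-1)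

  0≤1-κ : 0ℚ ≤ 1ℚ - κ
  0≤1-κ = p≤q⇒0≤q-p (≤-trans κ≤μ (recip≤1 s 1≤s))

  1-κ≤1 : 1ℚ - κ ≤ 1ℚ
  1-κ≤1 = ≤-cert κ 0≤κ (eq κ)
    where eq : ∀ κ → 1ℚ - κ + κ ≡ 1ℚ
          eq = solve-∀ ring

  -- By Bernoulli's inequality a vertex in a component of order below K contributes at most κ K = l.
  module _ (n : ℕ) (α : Fin n → Bool) (part : Fin n → ℕ) where
    open Components n α part

    big-bound : ∀ lab → |α| - Potential (pow (1ℚ - κ)) lab ≤ ∑α (λ v → ⟦ K ℕ.≤ᵇ size lab v ⟧) + l * |α|
    big-bound lab = begin
      |α| - Potential (pow (1ℚ - κ)) lab ≡⟨ sym (∑α-- (λ _ → 1ℚ) (λ v → pow (1ℚ - κ) (size lab v))) ⟩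
      ∑α (λ v → 1ℚ - pow (1ℚ - κ) (size lab v)) ≤⟨ ∑α-mono (λ v _ → pointwise (size lab v)) ⟩
      ∑α (λ v → ⟦ K ℕ.≤ᵇ size lab v ⟧ + l) ≡⟨ trans (∑α-+ (λ v → ⟦ K ℕ.≤ᵇ size lab v ⟧) (λ _ → l)) (cong (_+_ (∑α (λ v → ⟦ K ℕ.≤ᵇ size lab v ⟧))) (trans (∑α-const l) (*-comm |α| l))) ⟩
      ∑α (λ v → ⟦ K ℕ.≤ᵇ size lab v ⟧) + l * |α| ∎
      where
      open ≤-Reasoning
      pointwise : ∀ c → 1ℚ - pow (1ℚ - κ) c ≤ ⟦ K ℕ.≤ᵇ c ⟧ + l
      pointwise c with K ℕ.≤ᵇ c in K≤c
      ... | true = ≤-cert (pow (1ℚ - κ) c + l) (+-nonneg (pow-nonneg c 0≤1-κ) 0≤l) (eq (pow (1ℚ - κ) c) l)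
        where eq : ∀ p l → 1ℚ - p + (p + l) ≡ 1ℚ + l
              eq = solve-∀ ring
      ... | false = begin
        1ℚ - pow (1ℚ - κ) c ≤⟨ bernoulli c 0≤1-κ 1-κ≤1 ⟩
        fromℕ c * (1ℚ - (1ℚ - κ)) ≡⟨ eq (fromℕ c) κ ⟩
        κ * fromℕ c ≤⟨ *-monoˡ κ 0≤κ (fromℕ-mono c≤K) ⟩
        κ * Kℚ ≡⟨ trans κK (sym (+-identityˡ l)) ⟩
        0ℚ + l ∎
        where
        eq : ∀ c κ → c * (1ℚ - (1ℚ - κ)) ≡ κ * c
        eq = solve-∀ ring
        c≤K : c ℕ.≤ K
        c≤K = ℕ.<⇒≤ (ℕ.≰⇒> (λ K≤ → true≢false (trans (sym (T⇒true (ℕ.≤⇒≤ᵇ K≤))) K≤c)))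
          where true≢false : true ≢ false
                true≢false ()

  fromℕ-s : sℚ ≡ fromℕ σ + fromℕ 5
  fromℕ-s = fromℕ-+ σ 5

  fromℕ-5 : fromℕ 5 ≡ 1ℚ + (1ℚ + (1ℚ + (1ℚ + 1ℚ)))
  fromℕ-5 = trans (fromℕ-suc 4) (cong (1ℚ +_) (trans (fromℕ-suc 3) (cong (1ℚ +_)
    (trans (fromℕ-suc 2) (cong (1ℚ +_) (trans (fromℕ-suc 1) (cong (1ℚ +_) fromℕ-1)))))))

  s≡ : sℚ ≡ fromℕ σ + (1ℚ + (1ℚ + (1ℚ + (1ℚ + 1ℚ))))
  s≡ = trans fromℕ-s (cong (_+_ (fromℕ σ)) fromℕ-5)

  -- `H` is n / Q rounded down, so l n lies between H and H + 1. The hypotheses `n-large₂` and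
  -- `n-large₃` make Chebyshev's inequality effective: the accumulated squared increments are linear
  -- in n, whereas ζ² is quadratic.
  module Whp (C₁ δ : ℚ) (0≤δ : 0ℚ ≤ δ) (n : ℕ) (α : Fin n → Bool) (part : Fin n → ℕ) (H T₁ T₂ : ℕ)
    (1/E : ℚ) (0≤1/E : 0ℚ ≤ 1/E) (E*1/E : fromℕ (length (edges n)) * 1/E ≡ 1ℚ)
    (α-large : fromℕ (k ℕ.* H) ≤ ∑ (allFin n) (λ v → ⟦ α v ⟧ * 1ℚ))
    (part-small : ∀ u → ∑ (allFin n) (λ v → ⟦ α v ⟧ * ⟦ does (part u ℕ.≟ part v) ⟧) ≤ fromℕ (suc H))
    (QH≤n : Q ℕ.* H ℕ.≤ n) (n≤QH : n ℕ.≤ Q ℕ.* suc H)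
    (1≤T₁ : 1 ℕ.≤ T₁) (T₁-long : n ℕ.* q ℕ.* s ℕ.≤ 2 ℕ.* T₁ ℕ.* σ) (T₂-long : n ℕ.≤ 2 ℕ.* σ ℕ.* T₂)
    (T₁≤Cn : fromℕ T₁ ≤ C₁ * fromℕ n) (T₂≤Cn : fromℕ T₂ ≤ C₁ * fromℕ n)
    (n-large₁ : sℚ + 1ℚ + 2ℚ * M ≤ l * fromℕ n)
    (n-large₂ : C₁ * (2ℚ * M * (2ℚ * M)) ≤ l * l * (δ * ½) * fromℕ n)
    (n-large₃ : C₁ * (2ℚ * 2ℚ) ≤ 1/K * 1/K * (δ * ½) * fromℕ n)
    (0<n : 0ℚ < fromℕ n)
    where

    N z : ℚ
    N = fromℕ n
    z = l * N

    0≤N : 0ℚ ≤ N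
    0≤N = fromℕ-nonneg n
    0≤z : 0ℚ ≤ z
    0≤z = *-nonneg 0≤l 0≤N
    0<z : 0ℚ < z
    0<z = *-positive 0<l 0<n

    open Components n α part

    Hz : fromℕ H ≤ z
    Hz = begin
      fromℕ H ≡⟨ trans (sym (*-identityˡ _)) (trans (cong (_* fromℕ H) (sym Ql)) (eq Qℚ l (fromℕ H))) ⟩
      l * (Qℚ * fromℕ H) ≤⟨ *-monoˡ l 0≤l (subst (_≤ N) (fromℕ-* Q H) (fromℕ-mono QH≤n)) ⟩
      z ∎
      where
      open ≤-Reasoning
      eq : ∀ q l h → q * l * h ≡ l * (q * h)
      eq = solve-∀ ring

    zH : z ≤ 1ℚ + fromℕ H
    zH = begin
      l * N ≤⟨ *-monoˡ l 0≤l (subst (N ≤_) (fromℕ-* Q (suc H)) (fromℕ-mono n≤QH)) ⟩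
      l * (Qℚ * fromℕ (suc H)) ≡⟨ trans (eq Qℚ l (fromℕ (suc H))) (trans (cong (_* fromℕ (suc H)) Ql) (trans (*-identityˡ _) (fromℕ-suc H))) ⟩
      1ℚ + fromℕ H ∎
      where
      open ≤-Reasoning
      eq : ∀ q l h → l * (q * h) ≡ q * l * h
      eq = solve-∀ ring

    part-bound : ∀ u → ∑ (allFin n) (λ v → ⟦ α v ⟧ * ⟦ does (part u ℕ.≟ part v) ⟧) ≤ 1ℚ + z
    part-bound u = ≤-trans (part-small u) (≤-trans (≤-reflexive (fromℕ-suc H)) (+-monoʳ-≤ 1ℚ Hz))

    -- All k = s² parts have at least H ≥ z - 1 vertices on the line, and μ s = 1.
    α-bound : sℚ * (z - 1ℚ) ≤ μ * |α|
    α-bound = begin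
      sℚ * (z - 1ℚ) ≤⟨ *-monoˡ sℚ (fromℕ-nonneg s) (≤-cert (1ℚ + fromℕ H - z) (p≤q⇒0≤q-p zH) (eq z (fromℕ H))) ⟩
      sℚ * fromℕ H ≡⟨ trans (sym (*-identityˡ _)) (cong (_* (sℚ * fromℕ H)) (sym sμ)) ⟩
      sℚ * μ * (sℚ * fromℕ H) ≡⟨ eq₂ sℚ μ (fromℕ H) ⟩
      μ * (sℚ * sℚ * fromℕ H) ≡⟨ cong (μ *_) (sym (trans (fromℕ-* k H) (cong (_* fromℕ H) (fromℕ-* s s)))) ⟩
      μ * fromℕ (k ℕ.* H) ≤⟨ *-monoˡ μ 0≤μ α-large ⟩
      μ * |α| ∎
      where
      open ≤-Reasoning
      eq : ∀ z h → z - 1ℚ + (1ℚ + h - z) ≡ h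
      eq = solve-∀ ring
      eq₂ : ∀ s m h → s * m * (s * h) ≡ m * (s * s * h)
      eq₂ = solve-∀ ring

    open Giant n α part 1/E 0≤1/E E*1/E z (1ℚ + z) part-bound public

    2E≤N² : 2ℚ * E ≤ N * N
    2E≤N² = edges-bound n

    1/T₁ h x₀ B T : ℚ
    1/T₁ = recip T₁
    h = (μ - κ) * 1/T₁
    x₀ = 1ℚ - μ
    B = (1ℚ - x₀) * |α| - z - 2ℚ * M - (1ℚ + z) - z
    T = fromℕ T₁

    0≤h : 0ℚ ≤ h
    0≤h = *-nonneg (p≤q⇒0≤q-p κ≤μ) (recip-nonneg T₁)

    T1/T : T * 1/T₁ ≡ 1ℚ
    T1/T = *-recip T₁ 1≤T₁

    Th : T * h ≡ μ - κ
    Th = trans (eq T (μ - κ) 1/T₁) (trans (cong ((μ - κ) *_) T1/T) (*-identityʳ (μ - κ)))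
      where eq : ∀ t m r → t * (m * r) ≡ m * (t * r)
            eq = solve-∀ ring

    Th≤μ : T * h ≤ μ
    Th≤μ = ≤-trans (≤-reflexive Th) (≤-cert κ 0≤κ (eq μ κ))
      where eq : ∀ μ κ → μ - κ + κ ≡ μ
            eq = solve-∀ ring

    0<T : 0ℚ < T
    0<T = <-≤-trans 0<1 (1≤fromℕ 1≤T₁)

    1≤2x₀ : 1ℚ ≤ 2ℚ * x₀
    1≤2x₀ = ≤-cert (1ℚ - 2ℚ * μ) (p≤q⇒0≤q-p 2μ≤1) (eq μ)
      where eq : ∀ μ → 1ℚ + (1ℚ - (1ℚ + 1ℚ) * μ) ≡ (1ℚ + 1ℚ) * (1ℚ - μ)
            eq = solve-∀ ring

    x-end : x₀ + fromℕ T₁ * h ≡ 1ℚ - κ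
    x-end = trans (cong (_+_ x₀) Th) (eq μ κ)
      where eq : ∀ μ κ → 1ℚ - μ + (μ - κ) ≡ 1ℚ - κ
            eq = solve-∀ ring

    σℚ : ℚ
    σℚ = fromℕ σ

    rounds : N * qℚ * sℚ ≤ 2ℚ * T * σℚ
    rounds = subst₂ _≤_ (trans (fromℕ-* (n ℕ.* q) s) (cong (_* sℚ) (fromℕ-* n q)))
      (trans (fromℕ-* (2 ℕ.* T₁) σ) (cong (_* σℚ) (trans (fromℕ-* 2 T₁) (cong (_* T) (trans (fromℕ-suc 1) (cong (1ℚ +_) fromℕ-1))))))
      (fromℕ-mono T₁-long)

    0≤σ : 0ℚ ≤ σℚ
    0≤σ = fromℕ-nonneg σ

    5≤σℚ : fromℕ 5 ≤ σℚ
    5≤σℚ = fromℕ-mono 5≤σ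

    N≤2T : N ≤ 2ℚ * T
    N≤2T = *-cancelˡ sℚ (<-≤-trans 0<1 (1≤fromℕ 1≤s)) (begin
      sℚ * N ≡⟨ eq sℚ N ⟩
      N * 1ℚ * sℚ ≤⟨ *-mono-≤ (*-nonneg 0≤N 0≤1) (fromℕ-nonneg s) (*-monoˡ N 0≤N (1≤fromℕ 1≤q)) ≤-refl ⟩
      N * qℚ * sℚ ≤⟨ rounds ⟩
      2ℚ * T * σℚ ≤⟨ *-monoˡ (2ℚ * T) (*-nonneg 0≤2 (<⇒≤ 0<T)) (fromℕ-mono (ℕ.m≤m+n σ 5)) ⟩
      2ℚ * T * sℚ ≡⟨ *-comm (2ℚ * T) sℚ ⟩
      sℚ * (2ℚ * T) ∎)
      where
      open ≤-Reasoning
      eq : ∀ s n → s * n ≡ n * 1ℚ * s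
      eq = solve-∀ ring

    hn≤1 : h * N ≤ 1ℚ
    hn≤1 = *-cancelˡ T 0<T (begin
      T * (h * N) ≡⟨ sym (*-assoc T h N) ⟩
      T * h * N ≤⟨ *-mono-≤ (*-nonneg (<⇒≤ 0<T) 0≤h) (*-nonneg 0≤2 (<⇒≤ 0<T)) Th≤μ N≤2T ⟩
      μ * (2ℚ * T) ≡⟨ eq μ 2ℚ T ⟩
      T * (2ℚ * μ) ≤⟨ *-monoˡ T (<⇒≤ 0<T) 2μ≤1 ⟩
      T * 1ℚ ∎)
      where
      open ≤-Reasoning
      eq : ∀ m t T → m * (t * T) ≡ T * (t * m)
      eq = solve-∀ ring

    -- s - 4 = σ + 1 units of z are left for the drift.
    B-bound : (σℚ + 1ℚ) * z ≤ B
    B-bound = ≤-cert ((μ * |α| - sℚ * (z - 1ℚ)) + (z - (sℚ + 1ℚ + 2ℚ * M)))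
      (+-nonneg (p≤q⇒0≤q-p α-bound) (p≤q⇒0≤q-p n-large₁))
      (trans (cong (λ w → (σℚ + 1ℚ) * z + ((μ * |α| - w * (z - 1ℚ)) + (z - (w + 1ℚ + 2ℚ * M)))) s≡) (trans (eq σℚ z μ |α| (2ℚ * M)) refl))
      where
      eq : ∀ σ z μ a m → (σ + 1ℚ) * z + ((μ * a - (σ + (1ℚ + (1ℚ + (1ℚ + (1ℚ + 1ℚ))))) * (z - 1ℚ)) + (z - (σ + (1ℚ + (1ℚ + (1ℚ + (1ℚ + 1ℚ)))) + 1ℚ + m)))
         ≡ (1ℚ - (1ℚ - μ)) * a - z - m - (1ℚ + z) - z
      eq = solve-∀ ring

    slack : 0ℚ ≤ B
    slack = ≤-trans (*-nonneg (+-nonneg 0≤σ 0≤1) 0≤z) B-bound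

    -- The loss μ (σ + 1) is at most μ s = 1.
    σ≤x₀[σ+1] : σℚ ≤ x₀ * (σℚ + 1ℚ)
    σ≤x₀[σ+1] = ≤-cert (sℚ * μ - μ * (σℚ + 1ℚ)) (p≤q⇒0≤q-p (≤-trans (*-monoˡ μ 0≤μ σ+1≤s) (≤-reflexive (*-comm μ sℚ))))
      (trans (cong (λ w → σℚ + (w - μ * (σℚ + 1ℚ))) sμ) (eq σℚ μ))
      where
      σ+1≤s : σℚ + 1ℚ ≤ sℚ
      σ+1≤s = subst (σℚ + 1ℚ ≤_) (sym fromℕ-s) (+-monoʳ-≤ σℚ (1≤fromℕ (ℕ.s≤s ℕ.z≤n)))
      eq : ∀ σ μ → σ + (1ℚ - μ * (σ + 1ℚ)) ≡ (1ℚ - μ) * (σ + 1ℚ)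
      eq = solve-∀ ring

    -- This inequality dictates the length of the first phase. Multiplied by 2 T₁, its left side is
    -- at most n² μ = n q s z, because μ = l q s, and its right side is at least 2 T₁ σ z.
    speed : E * h ≤ x₀ * B
    speed = *-cancelˡ (2ℚ * T) (*-positive (positive⁻¹ 2ℚ) 0<T) (begin
      2ℚ * T * (E * h) ≡⟨ eq 2ℚ T E h ⟩
      2ℚ * E * (T * h) ≤⟨ *-mono-≤ (*-nonneg 0≤2 (fromℕ-nonneg _)) 0≤μ 2E≤N² Th≤μ ⟩
      N * N * μ ≡⟨ trans (cong (N * N *_) (sym lqs)) (eq₂ N l qℚ sℚ) ⟩
      N * qℚ * sℚ * z ≤⟨ *-mono-≤ (*-nonneg (*-nonneg 0≤N (fromℕ-nonneg q)) (fromℕ-nonneg s)) 0≤z rounds ≤-refl ⟩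
      2ℚ * T * σℚ * z ≤⟨ *-mono-≤ (*-nonneg 0≤2T 0≤σ) 0≤z (*-monoˡ (2ℚ * T) 0≤2T σ≤x₀[σ+1]) ≤-refl ⟩
      2ℚ * T * (x₀ * (σℚ + 1ℚ)) * z ≡⟨ eq₃ (2ℚ * T) x₀ (σℚ + 1ℚ) z ⟩
      2ℚ * T * (x₀ * ((σℚ + 1ℚ) * z)) ≤⟨ *-monoˡ (2ℚ * T) 0≤2T (*-monoˡ x₀ 0≤x₀ B-bound) ⟩
      2ℚ * T * (x₀ * B) ∎)
      where
      open ≤-Reasoning
      0≤2T : 0ℚ ≤ 2ℚ * T
      0≤2T = *-nonneg 0≤2 (<⇒≤ 0<T)
      0≤x₀ : 0ℚ ≤ x₀
      0≤x₀ = p≤q⇒0≤q-p (recip≤1 s 1≤s)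
      eq : ∀ a t e h → a * t * (e * h) ≡ a * e * (t * h)
      eq = solve-∀ ring
      eq₂ : ∀ n l q s → n * n * (l * (q * s)) ≡ n * q * s * (l * n)
      eq₂ = solve-∀ ring
      eq₃ : ∀ t x σ z → t * (x * σ) * z ≡ t * (x * (σ * z))
      eq₃ = solve-∀ ring

    open Subcritical x₀ h κ M z T₁ 1≤2x₀ 0≤h 0<κ 0≤M κM 0≤z x-end hn≤1 slack speed using (failed) renaming (failure-bound to failure-bound₁)

    failure₁ : Exp T₁ (λ lab → ⟦ failed lab ⟧) id ≤ δ * ½
    failure₁ = *-cancelˡ (z * z) (*-positive 0<z 0<z) (begin
      z * z * Exp T₁ (λ lab → ⟦ failed lab ⟧) id ≤⟨ failure-bound₁ ⟩
      T * (2ℚ * M * (2ℚ * M)) ≤⟨ *-mono-≤ (<⇒≤ 0<T) (square-nonneg (2ℚ * M)) T₁≤Cn ≤-refl ⟩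
      C₁ * N * (2ℚ * M * (2ℚ * M)) ≡⟨ eq C₁ N (2ℚ * M * (2ℚ * M)) ⟩
      N * (C₁ * (2ℚ * M * (2ℚ * M))) ≤⟨ *-monoˡ N 0≤N n-large₂ ⟩
      N * (l * l * (δ * ½) * N) ≡⟨ eq₂ N l (δ * ½) ⟩
      z * z * (δ * ½) ∎)
      where
      open ≤-Reasoning
      eq : ∀ c n m → c * n * m ≡ n * (c * m)
      eq = solve-∀ ring
      eq₂ : ∀ n l d → n * (l * l * d * n) ≡ l * n * (l * n) * d
      eq₂ = solve-∀ ring

    -- Five units suffice to leave at least one after subtracting a part and a component, and by
    -- `enough` the first phase supplies them. The level `ζ₂` equals the bound n / K on the initial
    -- potential.
    W p ζ₂ : ℚ
    W = z + (z + (z + (z + z)))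
    p = l * l
    ζ₂ = N * 1/K

    0≤W : 0ℚ ≤ W
    0≤W = +-nonneg 0≤z (+-nonneg 0≤z (+-nonneg 0≤z (+-nonneg 0≤z 0≤z)))

    1≤z : 1ℚ ≤ z
    1≤z = ≤-trans (≤-cert (sℚ + 2ℚ * M) (+-nonneg (fromℕ-nonneg s) (*-nonneg 0≤2 0≤M)) (eq sℚ (2ℚ * M))) n-large₁
      where eq : ∀ s m → 1ℚ + (s + m) ≡ s + 1ℚ + m
            eq = solve-∀ ring

    z≤slack₂ : z ≤ W - (1ℚ + z) - z
    z≤slack₂ = ≤-cert ((z - 1ℚ) + z) (+-nonneg (p≤q⇒0≤q-p 1≤z) 0≤z) (eq z)
      where eq : ∀ z → z + ((z - 1ℚ) + z) ≡ z + (z + (z + (z + z))) - (1ℚ + z) - z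
            eq = solve-∀ ring

    slack₂ : 0ℚ ≤ W - (1ℚ + z) - z
    slack₂ = ≤-trans 0≤z z≤slack₂

    rate : 2ℚ * (p * E) ≤ W * (W - (1ℚ + z) - z)
    rate = begin
      2ℚ * (p * E) ≡⟨ eq 2ℚ p E ⟩
      p * (2ℚ * E) ≤⟨ *-monoˡ p (*-nonneg 0≤l 0≤l) 2E≤N² ⟩
      p * (N * N) ≡⟨ eq₂ l N ⟩
      z * z ≤⟨ *-mono-≤ 0≤z slack₂ (≤-cert (z + (z + (z + z))) (+-nonneg 0≤z (+-nonneg 0≤z (+-nonneg 0≤z 0≤z))) refl) z≤slack₂ ⟩
      W * (W - (1ℚ + z) - z) ∎
      where
      open ≤-Reasoning
      eq : ∀ a p e → a * (p * e) ≡ p * (a * e)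
      eq = solve-∀ ring
      eq₂ : ∀ l n → l * l * (n * n) ≡ l * n * (l * n)
      eq₂ = solve-∀ ring

    Kp : Kℚ * p ≡ fromℕ 4 * σℚ
    Kp = trans (cong (_* p) (trans (fromℕ-* (4 ℕ.* σ) (Q ℕ.* Q)) (cong₂ _*_ (fromℕ-* 4 σ) (fromℕ-* Q Q))))
      (trans (eq (fromℕ 4) σℚ Qℚ l) (trans (cong (λ w → fromℕ 4 * σℚ * (w * w)) Ql) (*-identityʳ _)))
      where eq : ∀ f σ q l → f * σ * (q * q) * (l * l) ≡ f * σ * (q * l * (q * l))
            eq = solve-∀ ring

    2N≤ : 2ℚ * N ≤ fromℕ 4 * σℚ * fromℕ T₂
    2N≤ = ≤-trans (*-monoˡ 2ℚ 0≤2 (subst (N ≤_) (trans (fromℕ-* (2 ℕ.* σ) T₂) (cong (_* fromℕ T₂) (fromℕ-* 2 σ))) (fromℕ-mono T₂-long)))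
      (≤-reflexive (trans (eq 2ℚ (fromℕ 2) σℚ (fromℕ T₂)) (cong (λ w → w * σℚ * fromℕ T₂) (trans (cong (_* fromℕ 2) (sym two)) (sym (fromℕ-* 2 2))))))
      where
      two : fromℕ 2 ≡ 2ℚ
      two = trans (fromℕ-suc 1) (cong (1ℚ +_) fromℕ-1)
      eq : ∀ a b σ t → a * (b * σ * t) ≡ a * b * σ * t
      eq = solve-∀ ring

    long : N * 1/K + ζ₂ ≤ fromℕ T₂ * p
    long = begin
      N * 1/K + N * 1/K ≡⟨ eq N 1/K ⟩
      1/K * (2ℚ * N) ≤⟨ *-monoˡ 1/K 0≤1/K 2N≤ ⟩
      1/K * (fromℕ 4 * σℚ * fromℕ T₂) ≡⟨ cong (λ w → 1/K * (w * fromℕ T₂)) (sym Kp) ⟩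
      1/K * (Kℚ * p * fromℕ T₂) ≡⟨ eq₂ 1/K Kℚ p (fromℕ T₂) ⟩
      Kℚ * 1/K * (fromℕ T₂ * p) ≡⟨ trans (cong (_* (fromℕ T₂ * p)) K1/K) (*-identityˡ _) ⟩
      fromℕ T₂ * p ∎
      where
      open ≤-Reasoning
      eq : ∀ n r → n * r + n * r ≡ r * ((1ℚ + 1ℚ) * n)
      eq = solve-∀ ring
      eq₂ : ∀ r k p t → r * (k * p * t) ≡ k * r * (t * p)
      eq₂ = solve-∀ ring

    p≤2 : p ≤ 2ℚ
    p≤2 = ≤-trans (*-mono-≤ 0≤l 0≤1 l≤1 l≤1) (≤-cert 1ℚ 0≤1 refl)

    0≤ζ₂ : 0ℚ ≤ ζ₂
    0≤ζ₂ = *-nonneg 0≤N 0≤1/K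

    open Sprinkling K 1≤K W p ζ₂ T₂ (*-nonneg 0≤l 0≤l) p≤2 0≤ζ₂ 0≤W slack₂ rate long using (Enough) renaming (failure-bound to failure-bound₂)

    failure₂ : ∀ lab → Enough lab → Exp T₂ (λ lab → ⟦ not (good lab) ⟧) lab ≤ δ * ½
    failure₂ lab i = *-cancelˡ (ζ₂ * ζ₂) (*-positive 0<ζ₂ 0<ζ₂) (begin
      ζ₂ * ζ₂ * Exp T₂ (λ lab → ⟦ not (good lab) ⟧) lab ≤⟨ failure-bound₂ lab i ⟩
      fromℕ T₂ * (2ℚ * 2ℚ) ≤⟨ *-mono-≤ (fromℕ-nonneg T₂) (square-nonneg 2ℚ) T₂≤Cn ≤-refl ⟩
      C₁ * N * (2ℚ * 2ℚ) ≡⟨ eq C₁ N (2ℚ * 2ℚ) ⟩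
      N * (C₁ * (2ℚ * 2ℚ)) ≤⟨ *-monoˡ N 0≤N n-large₃ ⟩
      N * (1/K * 1/K * (δ * ½) * N) ≡⟨ eq₂ N 1/K (δ * ½) ⟩
      ζ₂ * ζ₂ * (δ * ½) ∎)
      where
      open ≤-Reasoning
      0<ζ₂ : 0ℚ < ζ₂
      0<ζ₂ = *-positive 0<n 0<1/K
      eq : ∀ c n m → c * n * m ≡ n * (c * m)
      eq = solve-∀ ring
      eq₂ : ∀ n l d → n * (l * l * d * n) ≡ n * l * (n * l) * d
      eq₂ = solve-∀ ring

    -- Unless the first phase failed, P ≤ x₀ |α| + z and hence |α| - P ≥ μ |α| - z. Of the s units
    -- in μ |α| one goes to this z, one to l |α| ≤ z in `big-bound` and one to rounding; the
    -- remaining σ + 2 exceed 5 because σ ≥ 5.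
    enough : ∀ lab → good lab ≡ false → failed lab ≡ false → Enough lab
    enough lab ng nf = ≤-cert (((big K lab + l * |α|) - (|α| - P)) + ((x₀ * |α| + z) - P) + ((μ * |α| - sℚ * (z - 1ℚ)) + l * (N - |α|) + (z - (sℚ + 1ℚ + 2ℚ * M)) + (1ℚ + 2ℚ * M)) + ((σℚ - fromℕ 5) * z + (z + z)))
      (+-nonneg (+-nonneg (+-nonneg (p≤q⇒0≤q-p (big-bound n α part lab)) (p≤q⇒0≤q-p P≤))
        (+-nonneg (+-nonneg (+-nonneg (p≤q⇒0≤q-p α-bound) (*-nonneg 0≤l (p≤q⇒0≤q-p |α|≤n))) (p≤q⇒0≤q-p n-large₁)) (+-nonneg 0≤1 (*-nonneg 0≤2 0≤M))))
        (+-nonneg (*-nonneg (p≤q⇒0≤q-p 5≤σℚ) 0≤z) (+-nonneg 0≤z 0≤z)))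
      (trans (cong₂ (λ w f → W + (((big K lab + l * |α|) - (|α| - P)) + ((x₀ * |α| + z) - P) + ((μ * |α| - w * (z - 1ℚ)) + l * (N - |α|) + (z - (w + 1ℚ + 2ℚ * M)) + (1ℚ + 2ℚ * M)) + ((σℚ - f) * z + (z + z)))) s≡ fromℕ-5)
        (eq (big K lab) l |α| P μ σℚ N (2ℚ * M)))
      where
      eq : ∀ b l a P μ σ N m → l * N + (l * N + (l * N + (l * N + l * N))) + (((b + l * a) - (a - P)) + (((1ℚ - μ) * a + l * N) - P) + ((μ * a - (σ + (1ℚ + (1ℚ + (1ℚ + (1ℚ + 1ℚ))))) * (l * N - 1ℚ)) + l * (N - a) + (l * N - ((σ + (1ℚ + (1ℚ + (1ℚ + (1ℚ + 1ℚ))))) + 1ℚ + m)) + (1ℚ + m)) + ((σ - (1ℚ + (1ℚ + (1ℚ + (1ℚ + 1ℚ))))) * (l * N) + (l * N + l * N))) ≡ b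
      eq = solve-∀ ring
      P : ℚ
      P = Potential (pow (1ℚ - κ)) lab
      P≤ : P ≤ x₀ * |α| + z
      P≤ = <⇒≤ (≰⇒> (λ le → contradiction (trans (sym (cong₂ _∧_ (cong not ng) (true-does (x₀ * |α| + z ≤? P) le))) nf) λ ()))

    -- By the Markov property the second phase is estimated separately from each labelling in which
    -- the first may end: a good one stays good, a failed one is counted with probability 1, and any
    -- other satisfies `Enough`.
    failure : Exp (T₁ ℕ.+ T₂) (λ lab → ⟦ not (good lab) ⟧) id ≤ δ
    failure = begin
      Exp (T₁ ℕ.+ T₂) (λ lab → ⟦ not (good lab) ⟧) id
        ≡⟨ Exp-++ T₁ T₂ (λ lab → ⟦ not (good lab) ⟧) id ⟩
      Exp T₁ (Exp T₂ (λ lab → ⟦ not (good lab) ⟧)) id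
        ≤⟨ Exp-mono (λ _ → ⊤) (λ _ _ _ → tt) T₁ (λ lab _ → by-cases lab) id tt ⟩
      Exp T₁ (λ lab → ⟦ failed lab ⟧ + δ * ½) id
        ≡⟨ trans (Exp-+ T₁ (λ lab → ⟦ failed lab ⟧) (λ _ → δ * ½) id) (cong (_+_ (Exp T₁ (λ lab → ⟦ failed lab ⟧) id)) (Exp-const T₁ (δ * ½) id)) ⟩
      Exp T₁ (λ lab → ⟦ failed lab ⟧) id + δ * ½
        ≤⟨ +-monoˡ-≤ (δ * ½) failure₁ ⟩
      δ * ½ + δ * ½
        ≡⟨ ½-split δ ⟩
      δ ∎
      where
      open ≤-Reasoning
      0≤½δ : 0ℚ ≤ δ * ½
      0≤½δ = *-nonneg 0≤δ (nonNegative⁻¹ ½)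
      by-cases : ∀ lab → Exp T₂ (λ lab → ⟦ not (good lab) ⟧) lab ≤ ⟦ failed lab ⟧ + δ * ½
      by-cases lab = go (good lab) (failed lab) refl refl
        where
        go : ∀ g f → good lab ≡ g → failed lab ≡ f → Exp T₂ (λ lab → ⟦ not (good lab) ⟧) lab ≤ ⟦ f ⟧ + δ * ½
        go true f g≡ _ = ≤-trans (Exp-not-good T₂ lab g≡) (+-nonneg (⟦⟧-nonneg f) 0≤½δ)
        go false true _ _ = begin
          Exp T₂ (λ lab → ⟦ not (good lab) ⟧) lab ≤⟨ Exp-mono (λ _ → ⊤) (λ _ _ _ → tt) T₂ (λ lab _ → ⟦⟧≤1 (not (good lab))) lab tt ⟩
          Exp T₂ (λ _ → 1ℚ) lab ≡⟨ Exp-const T₂ 1ℚ lab ⟩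
          1ℚ ≤⟨ ≤-cert (δ * ½) 0≤½δ refl ⟩
          1ℚ + δ * ½ ∎
        go false false g≡ f≡ = ≤-trans (failure₂ lab (enough lab g≡ f≡)) (≤-reflexive (sym (+-identityˡ (δ * ½))))

-- The transversal design

-- The lines of the transversal design: line ℓ, with slope ℓ % q and intercept ℓ / q, meets part j in one point.
line : ∀ q .{{_ : NonZero q}} → ℕ → ℕ → ℕ
line q ℓ j = (ℓ / q ℕ.+ ℓ % q ℕ.* j) % q

%-≡⇒∣ : ∀ q .{{_ : NonZero q}} m n → m % q ≡ n % q → ℤ.+ q ℤ.∣ ℤ.+ m ℤ.- ℤ.+ n
%-≡⇒∣ q m n eq = ℤ.divides (ℤ.+ (m / q) ℤ.- ℤ.+ (n / q)) (begin
  ℤ.+ m ℤ.- ℤ.+ n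
    ≡⟨ cong₂ ℤ._-_ (expand m) (expand n) ⟩
  (ℤ.+ (m % q) ℤ.+ ℤ.+ (m / q) ℤ.* ℤ.+ q) ℤ.- (ℤ.+ (n % q) ℤ.+ ℤ.+ (n / q) ℤ.* ℤ.+ q)
    ≡⟨ cong (λ r → (ℤ.+ r ℤ.+ ℤ.+ (m / q) ℤ.* ℤ.+ q) ℤ.- (ℤ.+ (n % q) ℤ.+ ℤ.+ (n / q) ℤ.* ℤ.+ q)) eq ⟩
  (ℤ.+ (n % q) ℤ.+ ℤ.+ (m / q) ℤ.* ℤ.+ q) ℤ.- (ℤ.+ (n % q) ℤ.+ ℤ.+ (n / q) ℤ.* ℤ.+ q)
    ≡⟨ cancel (ℤ.+ (n % q)) (ℤ.+ (m / q)) (ℤ.+ (n / q)) (ℤ.+ q) ⟩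
  (ℤ.+ (m / q) ℤ.- ℤ.+ (n / q)) ℤ.* ℤ.+ q ∎)
  where
  open ≡-Reasoning
  expand : ∀ m → ℤ.+ m ≡ ℤ.+ (m % q) ℤ.+ ℤ.+ (m / q) ℤ.* ℤ.+ q
  expand m = trans (cong ℤ.+_ (m≡m%n+[m/n]*n m q)) (trans (ℤ.pos-+ (m % q) (m / q ℕ.* q)) (cong (λ z → ℤ.+ (m % q) ℤ.+ z) (ℤ.pos-* (m / q) q)))
  cancel : ∀ r a b q → (r ℤ.+ a ℤ.* q) ℤ.- (r ℤ.+ b ℤ.* q) ≡ (a ℤ.- b) ℤ.* q
  cancel = ℤ-Solver.solve-∀

∣-small⇒≡ : ∀ {q m n} → m ℕ.< q → n ℕ.< q → q ℕ.∣ ℤ.∣ ℤ.+ m ℤ.- ℤ.+ n ∣ → m ≡ n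
∣-small⇒≡ {q} {m} {n} m<q n<q q∣ = ℤ.+-injective (ℤ.i-j≡0⇒i≡j (ℤ.+ m) (ℤ.+ n) (ℤ.∣i∣≡0⇒i≡0 (is-zero ℤ.∣ ℤ.+ m ℤ.- ℤ.+ n ∣ small q∣)))
  where
  small : ℤ.∣ ℤ.+ m ℤ.- ℤ.+ n ∣ ℕ.< q
  small = ℕ.≤-<-trans (ℕ.≤-trans (ℕ.≤-reflexive (cong ℤ.∣_∣ (ℤ.m-n≡m⊖n m n))) (ℤ.∣m⊝n∣≤m⊔n m n)) (ℕ.⊔-lub m<q n<q)
  is-zero : ∀ d → d ℕ.< q → q ℕ.∣ d → d ≡ 0
  is-zero zero _ _ = refl
  is-zero (suc d) d<q q∣d = contradiction q∣d (ℕ.>⇒∤ d<q)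

-- A common divisor of d ≤ k and k! t + 1 divides k!, hence 1.
coprime-below : ∀ k t {d} → 1 ℕ.≤ d → d ℕ.≤ k → Coprime (k ! ℕ.* t ℕ.+ 1) d
coprime-below k t {suc d} _ d≤k {e} (e∣q , e∣d) = ℕ.∣1⇒≡1 (ℕ.∣m+n∣m⇒∣n e∣q (ℕ.∣-trans e∣k! (ℕ.m∣m*n t)))
  where
  e∣k! : e ℕ.∣ k !
  e∣k! = ℕ.∣-trans e∣d (ℕ.∣-trans (ℕ.m∣m*n (d !)) (ℕ.m≤n⇒m!∣n! d≤k))

module _ (q k t : ℕ) .{{_ : NonZero q}} (q≡ : q ≡ k ! ℕ.* t ℕ.+ 1) where

  -- Subtracting the two congruences gives q ∣ (j - j′)(b - b′) for the slopes b and b′. As |j - j′|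
  -- is positive and at most k, it is coprime to q, so the slopes agree, and then the intercepts do.
  -- Lines below q² have intercepts below q, so congruence is equality.
  line-injective : ∀ {ℓ ℓ′ j j′} → ℓ ℕ.< q ℕ.* q → ℓ′ ℕ.< q ℕ.* q → j ℕ.< k → j′ ℕ.< k → j ≢ j′ →
    line q ℓ j ≡ line q ℓ′ j → line q ℓ j′ ≡ line q ℓ′ j′ → ℓ ≡ ℓ′
  line-injective {ℓ} {ℓ′} {j} {j′} ℓ< ℓ′< j< j′< j≢j′ eq eq′ = begin
    ℓ ≡⟨ m≡m%n+[m/n]*n ℓ q ⟩
    ℓ % q ℕ.+ ℓ / q ℕ.* q ≡⟨ cong₂ (λ b a → b ℕ.+ a ℕ.* q) slopes intercepts ⟩
    ℓ′ % q ℕ.+ ℓ′ / q ℕ.* q ≡⟨ sym (m≡m%n+[m/n]*n ℓ′ q) ⟩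
    ℓ′ ∎
    where
    open ≡-Reasoning
    a b a′ b′ : ℤ
    a = ℤ.+ (ℓ / q)
    b = ℤ.+ (ℓ % q)
    a′ = ℤ.+ (ℓ′ / q)
    b′ = ℤ.+ (ℓ′ % q)
    at : ∀ i → line q ℓ i ≡ line q ℓ′ i → ℤ.+ q ℤ.∣ (a ℤ.+ b ℤ.* ℤ.+ i) ℤ.- (a′ ℤ.+ b′ ℤ.* ℤ.+ i)
    at i e = subst (ℤ.+ q ℤ.∣_) (cong₂ ℤ._-_ (expand ℓ) (expand ℓ′)) (%-≡⇒∣ q (ℓ / q ℕ.+ ℓ % q ℕ.* i) (ℓ′ / q ℕ.+ ℓ′ % q ℕ.* i) e)
      where
      expand : ∀ ℓ → ℤ.+ (ℓ / q ℕ.+ ℓ % q ℕ.* i) ≡ ℤ.+ (ℓ / q) ℤ.+ ℤ.+ (ℓ % q) ℤ.* ℤ.+ i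
      expand ℓ = trans (ℤ.pos-+ (ℓ / q) (ℓ % q ℕ.* i)) (cong (λ z → ℤ.+ (ℓ / q) ℤ.+ z) (ℤ.pos-* (ℓ % q) i))
    j-j′ : ℤ
    j-j′ = ℤ.+ j ℤ.- ℤ.+ j′
    product-divisible : q ℕ.∣ ℤ.∣ j-j′ ∣ ℕ.* ℤ.∣ b ℤ.- b′ ∣
    product-divisible = subst (q ℕ.∣_) (ℤ.abs-* j-j′ (b ℤ.- b′)) (ℤ.∣⇒∣ᵤ (subst (ℤ.+ q ℤ.∣_) (factor a b a′ b′ (ℤ.+ j) (ℤ.+ j′)) (ℤ.∣m∣n⇒∣m-n (at j eq) (at j′ eq′))))
      where
      factor : ∀ a b a′ b′ j j′ → ((a ℤ.+ b ℤ.* j) ℤ.- (a′ ℤ.+ b′ ℤ.* j)) ℤ.- ((a ℤ.+ b ℤ.* j′) ℤ.- (a′ ℤ.+ b′ ℤ.* j′)) ≡ (j ℤ.- j′) ℤ.* (b ℤ.- b′)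
      factor = ℤ-Solver.solve-∀
    1≤|j-j′| : 1 ℕ.≤ ℤ.∣ j-j′ ∣
    1≤|j-j′| with ℤ.∣ j-j′ ∣ in z
    ... | suc _ = ℕ.s≤s ℕ.z≤n
    ... | zero = contradiction (ℤ.+-injective (ℤ.i-j≡0⇒i≡j (ℤ.+ j) (ℤ.+ j′) (ℤ.∣i∣≡0⇒i≡0 z))) j≢j′
    |j-j′|≤k : ℤ.∣ j-j′ ∣ ℕ.≤ k
    |j-j′|≤k = ℕ.≤-trans (ℕ.≤-reflexive (cong ℤ.∣_∣ (ℤ.m-n≡m⊖n j j′))) (ℕ.≤-trans (ℤ.∣m⊝n∣≤m⊔n j j′) (ℕ.⊔-lub (ℕ.<⇒≤ j<) (ℕ.<⇒≤ j′<)))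
    slopes : ℓ % q ≡ ℓ′ % q
    slopes = ∣-small⇒≡ (m%n<n ℓ q) (m%n<n ℓ′ q)
      (coprime-divisor (subst (λ m → Coprime m ℤ.∣ j-j′ ∣) (sym q≡) (coprime-below k t 1≤|j-j′| |j-j′|≤k)) product-divisible)
    intercepts : ℓ / q ≡ ℓ′ / q
    intercepts = ∣-small⇒≡ (m<n*o⇒m/o<n ℓ<) (m<n*o⇒m/o<n ℓ′<)
      (ℤ.∣⇒∣ᵤ (subst (ℤ.+ q ℤ.∣_) (trans (cong (λ c → (a ℤ.+ b ℤ.* ℤ.+ j) ℤ.- (a′ ℤ.+ ℤ.+ c ℤ.* ℤ.+ j)) (sym slopes)) (cancel a a′ (b ℤ.* ℤ.+ j))) (at j eq)))
      where
      cancel : ∀ a a′ c → (a ℤ.+ c) ℤ.- (a′ ℤ.+ c) ≡ a ℤ.- a′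
      cancel = ℤ-Solver.solve-∀

-- The least q ≡ 1 modulo F with r ≤ q².
side : ℕ → ℕ → ℕ
side F zero = 1
side F (suc r) with suc r ℕ.≤? side F r ℕ.* side F r
... | yes _ = side F r
... | no _ = side F r ℕ.+ F

side-≡1 : ∀ F r → Σ ℕ λ t → side F r ≡ F ℕ.* t ℕ.+ 1
side-≡1 F zero = 0 , sym (cong (ℕ._+ 1) (ℕ.*-zeroʳ F))
side-≡1 F (suc r) with suc r ℕ.≤? side F r ℕ.* side F r | side-≡1 F r
... | yes _ | t , eq = t , eq
... | no _ | t , eq = suc t , trans (cong (ℕ._+ F) eq) (rearrange F t)
  where rearrange : ∀ F t → F ℕ.* t ℕ.+ 1 ℕ.+ F ≡ F ℕ.* suc t ℕ.+ 1
        rearrange = ℕ-Solver.solve-∀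

side-large : ∀ F r → 1 ℕ.≤ F → r ℕ.≤ side F r ℕ.* side F r
side-large F zero 1≤F = ℕ.z≤n
side-large F (suc r) 1≤F with suc r ℕ.≤? side F r ℕ.* side F r | side-large F r 1≤F
... | yes le | _ = le
... | no _ | ih = ℕ.≤-trans (ℕ.s≤s ih) (ℕ.<-≤-trans {side F r ℕ.* side F r} {suc (side F r) ℕ.* suc (side F r)} (ℕ.*-mono-< (ℕ.n<1+n (side F r)) (ℕ.n<1+n (side F r)))
    (ℕ.*-mono-≤ 1+≤ 1+≤))
  where 1+≤ : suc (side F r) ℕ.≤ side F r ℕ.+ F
        1+≤ = ℕ.≤-trans (ℕ.≤-reflexive (ℕ.+-comm 1 (side F r))) (ℕ.+-monoʳ-≤ (side F r) 1≤F)

-- Here p is the value before the last increase, which took place because p² was too small.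
side-small : ∀ F r → side F r ≡ 1 ⊎ Σ ℕ λ p → side F r ≡ p ℕ.+ F × p ℕ.* p ℕ.≤ r
side-small F zero = inj₁ refl
side-small F (suc r) with suc r ℕ.≤? side F r ℕ.* side F r | side-small F r
... | yes _ | inj₁ eq = inj₁ eq
... | yes _ | inj₂ (p , eq , le) = inj₂ (p , eq , ℕ.≤-trans le (ℕ.n≤1+n r))
... | no r≰ | _ = inj₂ (side F r , refl , ℕ.<⇒≤ (ℕ.≰⇒> r≰))

-- (σ q)² ≤ (σ + 1)² r: with q = p + F, p² ≤ r and (σ F)² ≤ r, use 2 p (σ F) ≤ p² + (σ F)² ≤ 2 r.
side-upper : ∀ F r σ → 1 ℕ.≤ r → σ ℕ.* F ℕ.* (σ ℕ.* F) ℕ.≤ r →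
  σ ℕ.* side F r ℕ.* (σ ℕ.* side F r) ℕ.≤ suc σ ℕ.* suc σ ℕ.* r
side-upper F r σ 1≤r σF≤ with side F r | side-small F r
... | .1 | inj₁ refl = ℕ.≤-trans (ℕ.≤-reflexive (cong₂ ℕ._*_ (ℕ.*-identityʳ σ) (ℕ.*-identityʳ σ)))
    (ℕ.≤-trans (ℕ.*-mono-≤ (ℕ.n≤1+n σ) (ℕ.n≤1+n σ)) (ℕ.≤-trans (ℕ.≤-reflexive (sym (ℕ.*-identityʳ _))) (ℕ.*-monoʳ-≤ (suc σ ℕ.* suc σ) 1≤r)))
... | .(p ℕ.+ F) | inj₂ (p , refl , p²≤r) = begin
  σ ℕ.* (p ℕ.+ F) ℕ.* (σ ℕ.* (p ℕ.+ F)) ≡⟨ expand σ p F ⟩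
  σ ℕ.* σ ℕ.* (p ℕ.* p) ℕ.+ (σ ℕ.* (2 ℕ.* (p ℕ.* (σ ℕ.* F))) ℕ.+ σ ℕ.* F ℕ.* (σ ℕ.* F))
    ≤⟨ ℕ.+-mono-≤ (ℕ.*-monoʳ-≤ (σ ℕ.* σ) p²≤r) (ℕ.+-mono-≤ (ℕ.*-monoʳ-≤ σ (ℕ.≤-trans (2ab≤a²+b² p (σ ℕ.* F)) (ℕ.+-mono-≤ p²≤r σF≤))) σF≤) ⟩
  σ ℕ.* σ ℕ.* r ℕ.+ (σ ℕ.* (r ℕ.+ r) ℕ.+ r) ≡⟨ collect σ r ⟩
  suc σ ℕ.* suc σ ℕ.* r ∎
  where
  open ℕ.≤-Reasoning
  expand : ∀ σ p F → σ ℕ.* (p ℕ.+ F) ℕ.* (σ ℕ.* (p ℕ.+ F)) ≡ σ ℕ.* σ ℕ.* (p ℕ.* p) ℕ.+ (σ ℕ.* (2 ℕ.* (p ℕ.* (σ ℕ.* F))) ℕ.+ σ ℕ.* F ℕ.* (σ ℕ.* F))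
  expand = ℕ-Solver.solve-∀
  collect : ∀ σ r → σ ℕ.* σ ℕ.* r ℕ.+ (σ ℕ.* (r ℕ.+ r) ℕ.+ r) ≡ suc σ ℕ.* suc σ ℕ.* r
  collect = ℕ-Solver.solve-∀
  2ab≤a²+b² : ∀ a b → 2 ℕ.* (a ℕ.* b) ℕ.≤ a ℕ.* a ℕ.+ b ℕ.* b
  2ab≤a²+b² a b with ℕ.≤-total a b
  ... | inj₁ a≤b = subst (λ b → 2 ℕ.* (a ℕ.* b) ℕ.≤ a ℕ.* a ℕ.+ b ℕ.* b) (ℕ.m+[n∸m]≡n a≤b) (ℕ.≤-trans (ℕ.m≤m+n _ (d ℕ.* d)) (ℕ.≤-reflexive (square a d)))
    where d : ℕ
          d = b ℕ.∸ a
          square : ∀ a d → 2 ℕ.* (a ℕ.* (a ℕ.+ d)) ℕ.+ d ℕ.* d ≡ a ℕ.* a ℕ.+ (a ℕ.+ d) ℕ.* (a ℕ.+ d)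
          square = ℕ-Solver.solve-∀
  ... | inj₂ b≤a = subst (λ a → 2 ℕ.* (a ℕ.* b) ℕ.≤ a ℕ.* a ℕ.+ b ℕ.* b) (ℕ.m+[n∸m]≡n b≤a) (ℕ.≤-trans (ℕ.m≤m+n _ (d ℕ.* d)) (ℕ.≤-reflexive (square b d)))
    where d : ℕ
          d = a ℕ.∸ b
          square : ∀ b d → 2 ℕ.* ((b ℕ.+ d) ℕ.* b) ℕ.+ d ℕ.* d ≡ (b ℕ.+ d) ℕ.* (b ℕ.+ d) ℕ.+ b ℕ.* b
          square = ℕ-Solver.solve-∀

-- A sequence tending to infinity so slowly that G (slow r) ≤ r from some point on.
slow : (ℕ → ℕ) → ℕ → ℕ
slow G zero = 5
slow G (suc r) with G (suc (slow G r)) ℕ.≤? suc r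
... | yes _ = suc (slow G r)
... | no _ = slow G r

slow≥5 : ∀ G r → 5 ℕ.≤ slow G r
slow≥5 G zero = ℕ.≤-refl
slow≥5 G (suc r) with G (suc (slow G r)) ℕ.≤? suc r
... | yes _ = ℕ.≤-trans (slow≥5 G r) (ℕ.n≤1+n (slow G r))
... | no _ = slow≥5 G r

-- The first alternative is the stretch before the first increase, where G 5 may still exceed r. The
-- starting value 5 is the least that the constants of the construction admit.
slow-bound : ∀ G r → slow G r ≡ 5 ⊎ G (slow G r) ℕ.≤ r
slow-bound G zero = inj₁ refl
slow-bound G (suc r) with G (suc (slow G r)) ℕ.≤? suc r
... | yes le = inj₂ le
... | no _ with slow-bound G r
...   | inj₁ eq = inj₁ eq
...   | inj₂ le = inj₂ (ℕ.≤-trans le (ℕ.n≤1+n r))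

slow-suc : ∀ G r → slow G r ℕ.≤ slow G (suc r)
slow-suc G r with G (suc (slow G r)) ℕ.≤? suc r
... | yes _ = ℕ.n≤1+n (slow G r)
... | no _ = ℕ.≤-refl

slow-increases : ∀ G r → G (suc (slow G r)) ℕ.≤ suc r → slow G (suc r) ≡ suc (slow G r)
slow-increases G r h with G (suc (slow G r)) ℕ.≤? suc r
... | yes _ = refl
... | no ≰ = contradiction h ≰

slow-mono : ∀ G {r r′} → r ℕ.≤ r′ → slow G r ℕ.≤ slow G r′
slow-mono G r≤r′ = go (ℕ.≤⇒≤′ r≤r′)
  where
  go : ∀ {r r′} → r ℕ.≤′ r′ → slow G r ℕ.≤ slow G r′
  go ℕ.≤′-refl = ℕ.≤-refl
  go (ℕ.≤′-step {n} h) = ℕ.≤-trans (go h) (slow-suc G n)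

-- If the value is still S at some r₀ ≥ G (S + 1), the very next step raises it.
slow-unbounded : ∀ G S → Σ ℕ λ R → ∀ r → R ℕ.≤ r → S ℕ.≤ slow G r
slow-unbounded G zero = 0 , λ _ _ → ℕ.z≤n
slow-unbounded G (suc S) with slow-unbounded G S
... | R , h = suc r₀ , λ r r₀<r → ℕ.≤-trans reached (slow-mono G r₀<r)
  where
  r₀ : ℕ
  r₀ = R ℕ.⊔ G (suc S)
  reached : suc S ℕ.≤ slow G (suc r₀)
  reached with ℕ.m≤n⇒m<n∨m≡n (h r₀ (ℕ.m≤m⊔n R (G (suc S))))
  ... | inj₁ S< = ℕ.≤-trans S< (slow-suc G r₀)
  ... | inj₂ S≡ = subst (suc S ℕ.≤_) (sym (slow-increases G r₀ (subst (λ z → G (suc z) ℕ.≤ suc r₀) S≡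
          (ℕ.≤-trans (ℕ.m≤n⊔m R (G (suc S))) (ℕ.n≤1+n r₀))))) (ℕ.≤-reflexive (cong suc S≡))

-- Counting the vertices of a colour class

count-below : (ℕ → Bool) → ℕ → ℕ
count-below P zero = 0
count-below P (suc n) = indicator (P 0) ℕ.+ count-below (P ∘ suc) n

count-below-∑ : ∀ P n → fromℕ (count-below P n) ≡ ∑ (allFin n) (λ v → ⟦ P (toℕ v) ⟧)
count-below-∑ P zero = fromℕ-0
count-below-∑ P (suc n) = trans (fromℕ-+ (indicator (P 0)) (count-below (P ∘ suc) n))
  (trans (cong₂ _+_ (first (P 0)) (count-below-∑ (P ∘ suc) n)) (sym (∑-allFin-suc n (λ v → ⟦ P (toℕ v) ⟧))))
  where first : ∀ b → fromℕ (indicator b) ≡ ⟦ b ⟧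
        first true = fromℕ-1
        first false = fromℕ-0

count-below-cong : ∀ {P Q} n → (∀ i → i ℕ.< n → P i ≡ Q i) → count-below P n ≡ count-below Q n
count-below-cong zero h = refl
count-below-cong (suc n) h = cong₂ (λ b c → indicator b ℕ.+ c) (h 0 (ℕ.s≤s ℕ.z≤n)) (count-below-cong n (λ i i<n → h (suc i) (ℕ.s≤s i<n)))

count-below-+ : ∀ P m n → count-below P (m ℕ.+ n) ≡ count-below P m ℕ.+ count-below (λ i → P (m ℕ.+ i)) n
count-below-+ P zero n = refl
count-below-+ P (suc m) n = trans (cong (indicator (P 0) ℕ.+_) (count-below-+ (P ∘ suc) m n)) (sym (ℕ.+-assoc (indicator (P 0)) _ _))

count-below-mono : ∀ P {m n} → m ℕ.≤ n → count-below P m ℕ.≤ count-below P n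
count-below-mono P {m} {n} m≤n = subst (λ n → count-below P m ℕ.≤ count-below P n) (ℕ.m+[n∸m]≡n m≤n)
  (subst (count-below P m ℕ.≤_) (sym (count-below-+ P m (n ℕ.∸ m))) (ℕ.m≤m+n _ _))

count-below-point : ∀ {i n} → i ℕ.< n → count-below (λ j → does (j ℕ.≟ i)) n ≡ 1
count-below-point {zero} {suc n} _ = cong suc (none n)
  where none : ∀ n → count-below (λ _ → false) n ≡ 0
        none zero = refl
        none (suc n) = none n
count-below-point {suc i} {suc n} (ℕ.s≤s i<n) = count-below-point i<n

count-below-periodic : ∀ P p → (∀ i → P (p ℕ.+ i) ≡ P i) → ∀ h → count-below P (h ℕ.* p) ≡ h ℕ.* count-below P p
count-below-periodic P p per zero = refl
count-below-periodic P p per (suc h) = trans (count-below-+ P p (h ℕ.* p))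
  (cong (count-below P p ℕ.+_) (trans (count-below-cong (h ℕ.* p) (λ i _ → per i)) (count-below-periodic P p per h)))

module Design (q k : ℕ) {{_ : ℕ.NonZero q}} {{_ : ℕ.NonZero k}} where

  -- Together they encode the residue of a vertex modulo q k, so for every n all q k classes have n
  -- / (q k) vertices, rounded up or down.
  part point : ℕ → ℕ
  part i = i % k
  point i = (i / k) % q

  onLine : ℕ → ℕ → Bool
  onLine ℓ i = does (line q ℓ (part i) ℕ.≟ point i)

  onLine-in-part : ℕ → ℕ → ℕ → Bool
  onLine-in-part ℓ j i = onLine ℓ i ∧ does (j ℕ.≟ part i)

  -- The line meets part j in the single point x, and j + x k is the one number below q k with this
  -- part and this point.
  one-per-period : ∀ ℓ j → j ℕ.< k → count-below (onLine-in-part ℓ j) (q ℕ.* k) ≡ 1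
  one-per-period ℓ j j<k = trans (count-below-cong (q ℕ.* k) pointwise) (count-below-point i₀<)
    where
    x i₀ : ℕ
    x = line q ℓ j
    i₀ = j ℕ.+ x ℕ.* k
    x<q : x ℕ.< q
    x<q = m%n<n (ℓ / q ℕ.+ ℓ % q ℕ.* j) q
    i₀< : i₀ ℕ.< q ℕ.* k
    i₀< = ℕ.<-≤-trans (ℕ.+-monoˡ-< (x ℕ.* k) j<k) (ℕ.*-monoˡ-≤ k x<q)
    pointwise : ∀ i → i ℕ.< q ℕ.* k → onLine-in-part ℓ j i ≡ does (i ℕ.≟ i₀)
    pointwise i i< = does-iff ((line q ℓ (part i) ℕ.≟ point i) ×-dec (j ℕ.≟ part i)) (i ℕ.≟ i₀) to from
      where
      to : line q ℓ (part i) ≡ point i × j ≡ part i → i ≡ i₀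
      to (on , refl) = trans (m≡m%n+[m/n]*n i k) (cong (λ y → i % k ℕ.+ y ℕ.* k) (trans (sym (m<n⇒m%n≡m (m<n*o⇒m/o<n i<))) (sym on)))
      from : i ≡ i₀ → line q ℓ (part i) ≡ point i × j ≡ part i
      from refl = trans (cong (line q ℓ) part≡) (sym (trans (cong (_% q) div≡) (m<n⇒m%n≡m x<q))) , sym part≡
        where
        part≡ : part i₀ ≡ j
        part≡ = trans ([m+kn]%n≡m%n j x k) (m<n⇒m%n≡m j<k)
        div≡ : i₀ / k ≡ x
        div≡ = trans (+-distrib-/-∣ʳ j (divides x refl)) (cong₂ ℕ._+_ (m<n⇒m/n≡0 j<k) (m*n/n≡m x k))

  periodic : ∀ ℓ j i → onLine-in-part ℓ j (q ℕ.* k ℕ.+ i) ≡ onLine-in-part ℓ j i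
  periodic ℓ j i = cong₂ (λ a b → does (line q ℓ a ℕ.≟ b) ∧ does (j ℕ.≟ a)) part≡ point≡
    where
    part≡ : part (q ℕ.* k ℕ.+ i) ≡ part i
    part≡ = trans (cong (_% k) (ℕ.+-comm (q ℕ.* k) i)) ([m+kn]%n≡m%n i q k)
    point≡ : point (q ℕ.* k ℕ.+ i) ≡ point i
    point≡ = trans (cong (_% q) (trans (+-distrib-/-∣ˡ i (divides q refl)) (trans (cong (ℕ._+ i / k) (m*n/n≡m q k)) (ℕ.+-comm q (i / k)))))
      (trans (cong (λ y → (i / k ℕ.+ y) % q) (sym (ℕ.*-identityˡ q))) ([m+kn]%n≡m%n (i / k) 1 q))

  in-part-lower : ∀ ℓ j → j ℕ.< k → ∀ {n} H → q ℕ.* k ℕ.* H ℕ.≤ n → H ℕ.≤ count-below (onLine-in-part ℓ j) n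
  in-part-lower ℓ j j<k {n} H ≤n = ℕ.≤-trans (ℕ.≤-reflexive (sym counted)) (count-below-mono (onLine-in-part ℓ j) (ℕ.≤-trans (ℕ.≤-reflexive (ℕ.*-comm H (q ℕ.* k))) ≤n))
    where counted : count-below (onLine-in-part ℓ j) (H ℕ.* (q ℕ.* k)) ≡ H
          counted = trans (count-below-periodic (onLine-in-part ℓ j) (q ℕ.* k) (periodic ℓ j) H) (trans (cong (H ℕ.*_) (one-per-period ℓ j j<k)) (ℕ.*-identityʳ H))

  in-part-upper : ∀ ℓ j → j ℕ.< k → ∀ {n} H → n ℕ.≤ q ℕ.* k ℕ.* H → count-below (onLine-in-part ℓ j) n ℕ.≤ H
  in-part-upper ℓ j j<k {n} H n≤ = ℕ.≤-trans (count-below-mono (onLine-in-part ℓ j) (ℕ.≤-trans n≤ (ℕ.≤-reflexive (ℕ.*-comm (q ℕ.* k) H)))) (ℕ.≤-reflexive counted)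
    where counted : count-below (onLine-in-part ℓ j) (H ℕ.* (q ℕ.* k)) ≡ H
          counted = trans (count-below-periodic (onLine-in-part ℓ j) (q ℕ.* k) (periodic ℓ j) H) (trans (cong (H ℕ.*_) (one-per-period ℓ j j<k)) (ℕ.*-identityʳ H))

  line-small-in-parts : ∀ ℓ n H → n ℕ.≤ q ℕ.* k ℕ.* H → ∀ (u : Fin n) →
    ∑ (allFin n) (λ v → ⟦ onLine ℓ (toℕ v) ⟧ * ⟦ does (part (toℕ u) ℕ.≟ part (toℕ v)) ⟧) ≤ fromℕ H
  line-small-in-parts ℓ n H n≤ u = ≤-trans (≤-reflexive (trans
      (∑-cong (allFin n) (λ v → sym (⟦∧⟧ (onLine ℓ (toℕ v)) (does (part (toℕ u) ℕ.≟ part (toℕ v))))))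
      (sym (count-below-∑ (onLine-in-part ℓ (part (toℕ u))) n))))
    (fromℕ-mono (in-part-upper ℓ (part (toℕ u)) (m%n<n (toℕ u) k) H n≤))

  line-large : ∀ ℓ n H → q ℕ.* k ℕ.* H ℕ.≤ n → fromℕ (k ℕ.* H) ≤ ∑ (allFin n) (λ v → ⟦ onLine ℓ (toℕ v) ⟧ * 1ℚ)
  line-large ℓ n H ≤n = begin
    fromℕ (k ℕ.* H)
      ≡⟨ trans (fromℕ-* k H) (sym (∑-allFin-const k (fromℕ H))) ⟩
    ∑ (allFin k) (λ _ → fromℕ H)
      ≤⟨ ∑-mono (allFin k) (λ j → ≤-trans (fromℕ-mono (in-part-lower ℓ (toℕ j) (Fin.toℕ<n j) H ≤n)) (≤-reflexive (count-below-∑ (onLine-in-part ℓ (toℕ j)) n))) ⟩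
    ∑ (allFin k) (λ j → ∑ (allFin n) (λ v → ⟦ onLine-in-part ℓ (toℕ j) (toℕ v) ⟧))
      ≡⟨ ∑-swap (allFin k) (allFin n) (λ j v → ⟦ onLine-in-part ℓ (toℕ j) (toℕ v) ⟧) ⟩
    ∑ (allFin n) (λ v → ∑ (allFin k) (λ j → ⟦ onLine-in-part ℓ (toℕ j) (toℕ v) ⟧))
      ≡⟨ ∑-cong (allFin n) (λ v → trans (∑-cong (allFin k) (λ j → ⟦∧⟧ (onLine ℓ (toℕ v)) (does (toℕ j ℕ.≟ part (toℕ v)))))
           (trans (∑-*ˡ (allFin k) ⟦ onLine ℓ (toℕ v) ⟧ (λ j → ⟦ does (toℕ j ℕ.≟ part (toℕ v)) ⟧)) (cong (⟦ onLine ℓ (toℕ v) ⟧ *_) (one-part (toℕ v))))) ⟩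
    ∑ (allFin n) (λ v → ⟦ onLine ℓ (toℕ v) ⟧ * 1ℚ) ∎
    where
    open ≤-Reasoning
    one-part : ∀ i → ∑ (allFin k) (λ j → ⟦ does (toℕ j ℕ.≟ part i) ⟧) ≡ 1ℚ
    one-part i = trans (sym (count-below-∑ (λ j → does (j ℕ.≟ part i)) k)) (trans (cong fromℕ (count-below-point (m%n<n i k))) fromℕ-1)

  -- Edges inside a part and edges on none of the first r lines get an irrelevant colour.
  colour : ∀ r {n} → Edge n → Fin (suc r)
  colour r e with Fin.any? {n = suc r} (λ ℓ → (onLine (toℕ ℓ) (toℕ (source e)) Bool.≟ true) ×-dec (onLine (toℕ ℓ) (toℕ (target e)) Bool.≟ true))
  ... | yes (ℓ , _) = ℓ
  ... | no _ = zero

  -- The search in `colour` may return any line through both ends; for ends in different parts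
  -- `line-injective` leaves only one.
  colour-line : ∀ t → q ≡ k ! ℕ.* t ℕ.+ 1 → ∀ r → suc r ℕ.≤ q ℕ.* q → ∀ {n} (e : Edge n) ℓ →
    onLine (toℕ ℓ) (toℕ (source e)) ≡ true → onLine (toℕ ℓ) (toℕ (target e)) ≡ true →
    part (toℕ (source e)) ≢ part (toℕ (target e)) → colour r e ≡ ℓ
  colour-line t q≡ r r≤q² e ℓ onS onT parts≢
    with Fin.any? {n = suc r} (λ ℓ → (onLine (toℕ ℓ) (toℕ (source e)) Bool.≟ true) ×-dec (onLine (toℕ ℓ) (toℕ (target e)) Bool.≟ true))
  ... | no none = contradiction (ℓ , onS , onT) none
  ... | yes (ℓ′ , onS′ , onT′) = Fin.toℕ-injective (line-injective q k t q≡ (bound ℓ′) (bound ℓ) (m%n<n _ k) (m%n<n _ k) parts≢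
          (meet (toℕ (source e)) onS′ onS) (meet (toℕ (target e)) onT′ onT))
    where
    bound : ∀ (ℓ : Fin (suc r)) → toℕ ℓ ℕ.< q ℕ.* q
    bound ℓ = ℕ.<-≤-trans (Fin.toℕ<n ℓ) r≤q²
    meet : ∀ i → onLine (toℕ ℓ′) i ≡ true → onLine (toℕ ℓ) i ≡ true → line q (toℕ ℓ′) (part i) ≡ line q (toℕ ℓ) (part i)
    meet i on′ on = trans (does-true (line q (toℕ ℓ′) (part i) ℕ.≟ point i) on′) (sym (does-true (line q (toℕ ℓ) (part i) ℕ.≟ point i) on))

-- Components of the coloured graph

∈-runFrom : ∀ {r n} (colour : Edge n → Fin r) (alg : OnlineAlg r) → (∀ hist e → alg n hist e ≡ colour e) →
  ∀ hist {es e} → e ∈ₗ es → (e , colour e) ∈ₗ runFrom alg n hist es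
∈-runFrom colour alg static hist (here refl) = here (cong (_ ,_) (sym (static hist _)))
∈-runFrom colour alg static hist (there {x = x} e∈) = there (∈-runFrom colour alg static (hist ++ List.[ x ]) e∈)

module Connectivity {r n} (G : List (Edge n × Fin r)) (col : Fin r) where

  Adj-sym : ∀ {u v} → Adj G col u v → Adj G col v u
  Adj-sym (e , e∈ , inj₁ (p , q)) = e , e∈ , inj₂ (p , q)
  Adj-sym (e , e∈ , inj₂ (p , q)) = e , e∈ , inj₁ (p , q)

  Reach-trans : ∀ {u v w} → Reach G col u v → Reach G col v w → Reach G col u w
  Reach-trans p here = p
  Reach-trans p (step q a) = step (Reach-trans p q) a

  Reach-sym : ∀ {u v} → Reach G col u v → Reach G col v u
  Reach-sym here = here
  Reach-sym (step p a) = Reach-trans (step here (Adj-sym a)) (Reach-sym p)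

  module _ (α : Fin n → Bool) (part : Fin n → ℕ) where
    open Components n α part

    Sound : Labelling → Set
    Sound lab = ∀ u v → lab u ≡ lab v → Reach G col u v

    -- After a merge every vertex carries the old label of a vertex reachable from it: of itself, or
    -- of i if it was in the component of j. Equal new labels are thus connected through two such
    -- representatives.
    next-sound : ∀ lab e → (allowed (source e) (target e) ≡ true → (e , col) ∈ₗ G) → Sound lab → Sound (next lab e)
    next-sound lab e@((i , j) , _) e∈ sound with allowed i j
    ... | false = sound
    ... | true = λ u v eq → Reach-trans (proj₁ (proj₂ (representative u))) (Reach-trans
            (sound _ _ (trans (sym (proj₂ (proj₂ (representative u)))) (trans eq (proj₂ (proj₂ (representative v))))))
            (Reach-sym (proj₁ (proj₂ (representative v)))))
      where
      representative : ∀ u → Σ (Fin n) λ w → Reach G col u w × merge lab i j u ≡ lab w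
      representative u with lab u Fin.≟ lab j
      ... | yes eq = i , step (sound u j eq) (e , e∈ refl , inj₂ (refl , refl)) , refl
      ... | no _ = u , here , refl

    steps-sound : ∀ {m} (es : Vec (Edge n) m) lab →
      (∀ e → e ∈ₗ toList es → allowed (source e) (target e) ≡ true → (e , col) ∈ₗ G) → Sound lab → Sound (steps next lab es)
    steps-sound [] lab e∈ sound = sound
    steps-sound (e ∷ es) lab e∈ sound = steps-sound es (next lab e) (λ e′ → e∈ e′ ∘ there) (next-sound lab e (e∈ e (here refl)) sound)

    component : ∀ lab → Sound lab → ∀ v {K} → K ≤ fromℕ (size lab v) → HasComponentOfOrder≥ G col K
    component lab sound v K≤ = v , Vec.tabulate member , ≤-trans K≤ (≤-reflexive (trans (cong fromℕ size≡) (fromℕ≡toℚ _))) ,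
      λ u u∈ → sound v u (sym (does-true (lab u Fin.≟ lab v) (proj₂ (∧-true {α u} (trans (sym (lookup∘tabulate member u)) ([]=⇒lookup u∈))))))
      where
      member : Fin n → Bool
      member w = α w ∧ same lab w v
      ∣tabulate∣ : ∀ {m} (f : Fin m → Bool) → count (allFin m) f ≡ ∣ Vec.tabulate f ∣
      ∣tabulate∣ {m} f = go f (λ x → x)
        where
        go : ∀ {m l} (f : Fin l → Bool) (g : Fin m → Fin l) → count (tabulate g) f ≡ ∣ Vec.tabulate (f ∘ g) ∣
        go {zero} f g = refl
        go {suc m} f g with f (g zero)
        ... | true = cong suc (go f (g ∘ suc))
        ... | false = go f (g ∘ suc)
      size≡ : size lab v ≡ ∣ Vec.tabulate member ∣
      size≡ = ∣tabulate∣ member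

-- From averages to counting sequences

fromℕ-^ : ∀ a m → fromℕ (a ℕ.^ m) ≡ pow (fromℕ a) m
fromℕ-^ a zero = fromℕ-1
fromℕ-^ a (suc m) = trans (fromℕ-* a (a ℕ.^ m)) (cong (fromℕ a *_) (fromℕ-^ a m))

length-filter : ∀ {X : Set} {P : X → Set} (P? : ∀ x → Dec (P x)) xs → fromℕ (length (filter P? xs)) ≡ ∑ xs (λ x → ⟦ does (P? x) ⟧)
length-filter P? [] = fromℕ-0
length-filter P? (x ∷ xs) with P? x
... | yes _ = trans (fromℕ-suc (length (filter P? xs))) (cong (_+_ 1ℚ) (length-filter P? xs))
... | no _ = trans (length-filter P? xs) (sym (+-identityˡ _))

length-sequences : ∀ {X : Set} (xs : List X) m → fromℕ (length (sequences xs m)) ≡ pow (fromℕ (length xs)) m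
length-sequences xs zero = fromℕ-1
length-sequences xs (suc m) = begin
  fromℕ (length (sequences xs (suc m)))
    ≡⟨ sym (trans (∑-const (sequences xs (suc m)) 1ℚ) (*-identityʳ _)) ⟩
  ∑ (sequences xs (suc m)) (λ _ → 1ℚ)
    ≡⟨ ∑-cartesianProductWith Vec._∷_ xs (sequences xs m) (λ _ → 1ℚ) ⟩
  ∑ xs (λ _ → ∑ (sequences xs m) (λ _ → 1ℚ))
    ≡⟨ trans (∑-const xs _) (cong (fromℕ (length xs) *_) (trans (∑-const (sequences xs m) 1ℚ) (*-identityʳ _))) ⟩
  fromℕ (length xs) * fromℕ (length (sequences xs m))
    ≡⟨ cong (fromℕ (length xs) *_) (length-sequences xs m) ⟩
  pow (fromℕ (length xs)) (suc m) ∎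
  where open ≡-Reasoning

sequences-unique : ∀ {X : Set} {xs : List X} m → Unique xs → Unique (sequences xs m)
sequences-unique zero u = [] ∷ []
sequences-unique (suc m) u = Unique.cartesianProductWith⁺ Vec._∷_ ∷-injective u (sequences-unique m u)

-- Union bound over the r events g col.
probAtLeast : ∀ n m r (g : Fin r → Vec (Edge n) m → Bool) (P : Vec (Edge n) m → Set) δ →
  (∀ v → (∀ col → g col v ≡ true) → P v) →
  (∀ col → ∑ (sequences (edges n) m) (λ v → ⟦ not (g col v) ⟧) ≤ pow (fromℕ (length (edges n))) m * δ) →
  ProbAtLeast n m P (1ℚ - fromℕ r * δ)
probAtLeast n m r g P δ sound few =
  filter all? vs , Unique.filter⁺ all? (sequences-unique m (edges-unique n)) , All.map (λ {v} → sound v) (All.all-filter all? vs) ,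
  subst₂ (λ a b → (1ℚ - fromℕ r * δ) * a ≤ b) total (fromℕ≡toℚ (length (filter all? vs))) enough
  where
  vs : List (Vec (Edge n) m)
  vs = sequences (edges n) m
  all? : ∀ v → Dec (∀ col → g col v ≡ true)
  all? v = Fin.all? (λ col → g col v Bool.≟ true)
  N : ℚ
  N = pow (fromℕ (length (edges n))) m
  total : N ≡ toℚ ((n C 2) ℕ.^ m)
  total = trans (cong (λ l → pow (fromℕ l) m) (length-edges n)) (trans (sym (fromℕ-^ (n C 2) m)) (fromℕ≡toℚ _))
  bad : Vec (Edge n) m → ℚ
  bad v = ∑ (allFin r) (λ col → ⟦ not (g col v) ⟧)
  pointwise : ∀ v → 1ℚ - bad v ≤ ⟦ does (all? v) ⟧
  pointwise v = by-dec (all? v)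
    where
    by-dec : ∀ (d : Dec (∀ col → g col v ≡ true)) → 1ℚ - bad v ≤ ⟦ does d ⟧
    by-dec (yes _) = ≤-cert (bad v) (∑-nonneg (allFin r) (λ col → ⟦⟧-nonneg (not (g col v)))) (eq (bad v))
      where eq : ∀ b → 1ℚ - b + b ≡ 1ℚ
            eq = solve-∀ ring
    by-dec (no ¬all) with Fin.¬∀⟶∃¬ r (λ col → g col v ≡ true) (λ col → g col v Bool.≟ true) ¬all
    ... | col , ¬g = ≤-cert (bad v - 1ℚ) (p≤q⇒0≤q-p 1≤bad) (eq (bad v))
      where
      eq : ∀ b → 1ℚ - b + (b - 1ℚ) ≡ 0ℚ
      eq = solve-∀ ring
      1≤bad : 1ℚ ≤ bad v
      1≤bad = subst₂ _≤_ fromℕ-1 (fromℕ-count (allFin r) (λ col → not (g col v)))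
        (fromℕ-mono (count-positive {P = λ col → not (g col v)} (∈-allFin col) (cong not (Bool.¬-not ¬g))))
  enough : (1ℚ - fromℕ r * δ) * N ≤ fromℕ (length (filter all? vs))
  enough = begin
    (1ℚ - fromℕ r * δ) * N ≡⟨ eq (fromℕ r) δ N ⟩
    N - fromℕ r * (N * δ) ≡⟨ cong (λ z → N - z) (sym (∑-allFin-const r (N * δ))) ⟩
    N - ∑ (allFin r) (λ _ → N * δ) ≤⟨ +-monoʳ-≤ N (neg-antimono-≤ (∑-mono (allFin r) few)) ⟩
    N - ∑ (allFin r) (λ col → ∑ vs (λ v → ⟦ not (g col v) ⟧))
      ≡⟨ cong₂ _-_ (trans (sym (length-sequences (edges n) m)) (sym (trans (∑-const vs 1ℚ) (*-identityʳ _)))) (∑-swap (allFin r) vs (λ col v → ⟦ not (g col v) ⟧)) ⟩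
    ∑ vs (λ _ → 1ℚ) - ∑ vs bad ≡⟨ sym (∑-- vs (λ _ → 1ℚ) bad) ⟩
    ∑ vs (λ v → 1ℚ - bad v) ≤⟨ ∑-mono vs pointwise ⟩
    ∑ vs (λ v → ⟦ does (all? v) ⟧) ≡⟨ sym (length-filter all? vs) ⟩
    fromℕ (length (filter all? vs)) ∎
    where
    open ≤-Reasoning
    eq : ∀ r d n → (1ℚ - r * d) * n ≡ n - r * (n * d)
    eq = solve-∀ ring

-- Rounding and asymptotics

floor-bounds : ∀ x → 0ℚ ≤ x → fromℕ ℤ.∣ floor x ∣ ≤ x × x ≤ fromℕ (suc ℤ.∣ floor x ∣)
floor-bounds x@(mkℚ (ℤ.+ a) d-1 c) 0≤x = lower , upper
  where
  d f : ℕ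
  d = suc d-1
  f = a / d
  floor≡ : ℤ.∣ floor x ∣ ≡ f
  floor≡ = cong ℤ.∣_∣ (ℤ.*-identityˡ (ℤ.+ f))
  lower : fromℕ ℤ.∣ floor x ∣ ≤ x
  lower = subst (λ m → fromℕ m ≤ x) (sym floor≡) (toℚᵘ-cancel-≤ (ℚᵘ.≤-respˡ-≃ (ℚᵘ.≃-sym (toℚᵘ-fromℕ f))
    (ℚᵘ.*≤* (subst₂ ℤ._≤_ (ℤ.pos-* f d) (sym (ℤ.*-identityʳ (ℤ.+ a))) (ℤ.+≤+ (m/n*n≤m a d))))))
  upper : x ≤ fromℕ (suc ℤ.∣ floor x ∣)
  upper = subst (λ m → x ≤ fromℕ (suc m)) (sym floor≡) (toℚᵘ-cancel-≤ (ℚᵘ.≤-respʳ-≃ (ℚᵘ.≃-sym (toℚᵘ-fromℕ (suc f)))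
    (ℚᵘ.*≤* (subst₂ ℤ._≤_ (sym (ℤ.*-identityʳ (ℤ.+ a))) (ℤ.pos-* (suc f) d) (ℤ.+≤+ a≤)))))
    where
    a≤ : a ℕ.≤ suc f ℕ.* d
    a≤ = ℕ.≤-trans (ℕ.≤-reflexive (m≡m%n+[m/n]*n a d)) (ℕ.+-monoˡ-≤ (f ℕ.* d) (ℕ.<⇒≤ (m%n<n a d)))
floor-bounds (mkℚ ℤ.-[1+ a ] d-1 c) (*≤* ())

eventually : ∀ a b → 0ℚ < b → Σ ℕ λ N → ∀ n → N ℕ.≤ n → a ≤ b * fromℕ n
eventually a b 0<b with reciprocal b 0<b
... | r , 0<r , br with archimedean (a * r)
...   | N , h = N , λ n N≤n → ≤-trans (≤-reflexive (trans (sym (*-identityʳ a)) (trans (cong (a *_) (sym br)) (eq a b r))))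
        (*-monoˡ b (<⇒≤ 0<b) (≤-trans h (fromℕ-mono N≤n)))
  where eq : ∀ a b r → a * (b * r) ≡ b * (a * r)
        eq = solve-∀ ring

-- For the modulus F = k! the inequality `growth σ ≤ r` is the hypothesis (σ F)² ≤ r of
-- `side-upper`: steps of length F are then small compared with √r.
parts modulus growth : ℕ → ℕ
parts σ = (σ ℕ.+ 5) ℕ.* (σ ℕ.+ 5)
modulus σ = parts σ !
growth σ = σ ℕ.* modulus σ ℕ.* (σ ℕ.* modulus σ)

sigma points : ℕ → ℕ
sigma r = slow growth r
points r = side (modulus (sigma r)) r

-- (q/2)(1 + 7/σ) with q = points r and σ = sigma r.
rate : ℕ → ℚ
rate r = fromℕ (points r ℕ.* (sigma r ℕ.+ 7)) * recip (2 ℕ.* sigma r)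

1≤sigma : ∀ r → 1 ℕ.≤ sigma r
1≤sigma r = ℕ.≤-trans (ℕ.s≤s ℕ.z≤n) (slow≥5 growth r)

1≤points : ∀ r → 1 ℕ.≤ points r
1≤points r with side-≡1 (modulus (sigma r)) r
... | t , eq = subst (1 ℕ.≤_) (sym eq) (ℕ.m≤n+m 1 _)

rate-nonneg : ∀ r → 0ℚ ≤ rate r
rate-nonneg r = *-nonneg (fromℕ-nonneg (points r ℕ.* (sigma r ℕ.+ 7))) (recip-nonneg (2 ℕ.* sigma r))

2σ*rate : ∀ r → fromℕ (2 ℕ.* sigma r) * rate r ≡ fromℕ (points r ℕ.* (sigma r ℕ.+ 7))
2σ*rate r = trans (eq (fromℕ (2 ℕ.* sigma r)) (fromℕ (points r ℕ.* (sigma r ℕ.+ 7))) (recip (2 ℕ.* sigma r)))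
  (trans (cong (fromℕ (points r ℕ.* (sigma r ℕ.+ 7)) *_) (*-recip (2 ℕ.* sigma r) (ℕ.*-mono-≤ {1} {2} (ℕ.s≤s ℕ.z≤n) (1≤sigma r)))) (*-identityʳ _))
  where eq : ∀ a b c → a * (b * c) ≡ b * (a * c)
        eq = solve-∀ ring

-- With w = 2 `rate r` = q (σ + 7) / σ, the lower bound is w² ≥ q² ≥ r. For the upper bound, (σ q)²
-- ≤ (σ + 1)² r gives σ⁴ w² ≤ ((σ + 1)(σ + 7))² r, and (σ + 1)(σ + 7) ≤ (1 + δ) σ² once σ is large.
rate-asymptotic : AsympSqrtHalf rate
rate-asymptotic δ 0<δ δ<1 = R , λ r R≤r → rate-nonneg r , lower r R≤r , upper r R≤r
  where
  S R₁ R : ℕ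
  S = proj₁ (eventually (fromℕ 15) δ 0<δ)
  -- The 6 excludes the first alternative of `slow-bound`, and `S` ensures 15 ≤ δ σ.
  R₁ = proj₁ (slow-unbounded growth (6 ℕ.⊔ S))
  R = 1 ℕ.⊔ R₁

  module _ (r : ℕ) (R≤r : R ℕ.≤ r) where
    σ q : ℕ
    σ = sigma r
    q = points r
    σℚ qℚ rℚ w Δ : ℚ
    σℚ = fromℕ σ
    qℚ = fromℕ q
    rℚ = fromℕ r
    w = 2ℚ * rate r
    Δ = 1ℚ + δ

    6⊔S≤σ : 6 ℕ.⊔ S ℕ.≤ σ
    6⊔S≤σ = proj₂ (slow-unbounded growth (6 ℕ.⊔ S)) r (ℕ.≤-trans (ℕ.m≤n⊔m 1 R₁) R≤r)

    growth≤r : growth σ ℕ.≤ r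
    growth≤r with slow-bound growth r
    ... | inj₂ le = le
    ... | inj₁ eq = contradiction (ℕ.≤-trans (ℕ.m≤m⊔n 6 S) (ℕ.≤-trans 6⊔S≤σ (ℕ.≤-reflexive eq))) (ℕ.<⇒≱ (ℕ.n<1+n 5))

    0<σ : 0ℚ < σℚ
    0<σ = <-≤-trans (subst (0ℚ <_) (sym fromℕ-1) 0<1) (fromℕ-mono (1≤sigma r))

    two : fromℕ 2 ≡ 2ℚ
    two = trans (fromℕ-suc 1) (cong (_+_ 1ℚ) fromℕ-1)

    σw : σℚ * w ≡ qℚ * fromℕ (σ ℕ.+ 7)
    σw = trans (eq σℚ 2ℚ (rate r)) (trans (cong (_* rate r) (trans (cong (_* σℚ) (sym two)) (sym (fromℕ-* 2 σ))))
      (trans (2σ*rate r) (fromℕ-* q (σ ℕ.+ 7))))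
      where eq : ∀ s t c → s * (t * c) ≡ t * s * c
            eq = solve-∀ ring

    w² : w * w ≡ toℚ 4 * (rate r * rate r)
    w² = trans (eq 2ℚ (rate r)) refl
      where eq : ∀ t c → t * c * (t * c) ≡ t * t * (c * c)
            eq = solve-∀ ring

    0≤w : 0ℚ ≤ w
    0≤w = *-nonneg 0≤2 (rate-nonneg r)

    q≤w : qℚ ≤ w
    q≤w = *-cancelˡ σℚ 0<σ (begin
      σℚ * qℚ ≡⟨ *-comm σℚ qℚ ⟩
      qℚ * σℚ ≤⟨ *-monoˡ qℚ (fromℕ-nonneg q) (fromℕ-mono (ℕ.m≤m+n σ 7)) ⟩
      qℚ * fromℕ (σ ℕ.+ 7) ≡⟨ sym σw ⟩
      σℚ * w ∎)
      where open ≤-Reasoning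

    lower : ((1ℚ - δ) * (1ℚ - δ)) * toℚ r ≤ toℚ 4 * (rate r * rate r)
    lower = begin
      ((1ℚ - δ) * (1ℚ - δ)) * toℚ r ≡⟨ cong (((1ℚ - δ) * (1ℚ - δ)) *_) (sym (fromℕ≡toℚ r)) ⟩
      ((1ℚ - δ) * (1ℚ - δ)) * rℚ ≤⟨ *-mono-≤ (square-nonneg (1ℚ - δ)) (fromℕ-nonneg r) (*-mono-≤ 0≤1-δ 0≤1 1-δ≤1 1-δ≤1) ≤-refl ⟩
      1ℚ * 1ℚ * rℚ ≡⟨ *-identityˡ rℚ ⟩
      rℚ ≤⟨ fromℕ-mono (side-large (modulus σ) r (ℕ.1≤n! (parts σ))) ⟩
      fromℕ (q ℕ.* q) ≡⟨ fromℕ-* q q ⟩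
      qℚ * qℚ ≤⟨ *-mono-≤ (fromℕ-nonneg q) 0≤w q≤w q≤w ⟩
      w * w ≡⟨ w² ⟩
      toℚ 4 * (rate r * rate r) ∎
      where
      open ≤-Reasoning
      0≤1-δ : 0ℚ ≤ 1ℚ - δ
      0≤1-δ = p≤q⇒0≤q-p (<⇒≤ δ<1)
      1-δ≤1 : 1ℚ - δ ≤ 1ℚ
      1-δ≤1 = ≤-cert δ (<⇒≤ 0<δ) (eq δ)
        where eq : ∀ d → 1ℚ - d + d ≡ 1ℚ
              eq = solve-∀ ring

    -- Expand, and use 8σ + 7 ≤ 15σ ≤ δσ².
    ratio : fromℕ (suc σ) * fromℕ (σ ℕ.+ 7) ≤ Δ * (σℚ * σℚ)
    ratio = begin
      fromℕ (suc σ) * fromℕ (σ ℕ.+ 7) ≡⟨ sym (fromℕ-* (suc σ) (σ ℕ.+ 7)) ⟩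
      fromℕ (suc σ ℕ.* (σ ℕ.+ 7)) ≤⟨ fromℕ-mono (ℕ.≤-trans (ℕ.≤-reflexive (expand σ)) (ℕ.+-monoʳ-≤ (σ ℕ.* σ) (ℕ.≤-trans (ℕ.+-monoʳ-≤ (8 ℕ.* σ) (ℕ.≤-trans (ℕ.≤-reflexive (sym (ℕ.*-identityʳ 7))) (ℕ.*-monoʳ-≤ 7 (1≤sigma r)))) (ℕ.≤-reflexive (collect σ))))) ⟩
      fromℕ (σ ℕ.* σ ℕ.+ 15 ℕ.* σ) ≡⟨ trans (fromℕ-+ (σ ℕ.* σ) (15 ℕ.* σ)) (cong₂ _+_ (fromℕ-* σ σ) (fromℕ-* 15 σ)) ⟩
      σℚ * σℚ + fromℕ 15 * σℚ ≤⟨ +-monoʳ-≤ (σℚ * σℚ) (*-mono-≤ (fromℕ-nonneg 15) (<⇒≤ 0<σ) (proj₂ (eventually (fromℕ 15) δ 0<δ) σ (ℕ.≤-trans (ℕ.m≤n⊔m 6 S) 6⊔S≤σ)) ≤-refl) ⟩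
      σℚ * σℚ + δ * σℚ * σℚ ≡⟨ eq σℚ δ ⟩
      Δ * (σℚ * σℚ) ∎
      where
      open ≤-Reasoning
      expand : ∀ σ → suc σ ℕ.* (σ ℕ.+ 7) ≡ σ ℕ.* σ ℕ.+ (8 ℕ.* σ ℕ.+ 7)
      expand = ℕ-Solver.solve-∀
      collect : ∀ σ → 8 ℕ.* σ ℕ.+ 7 ℕ.* σ ≡ 15 ℕ.* σ
      collect = ℕ-Solver.solve-∀
      eq : ∀ s d → s * s + d * s * s ≡ (1ℚ + d) * (s * s)
      eq = solve-∀ ring

    upper : toℚ 4 * (rate r * rate r) ≤ ((1ℚ + δ) * (1ℚ + δ)) * toℚ r
    upper = *-cancelˡ σ⁴ (*-positive (*-positive 0<σ 0<σ) (*-positive 0<σ 0<σ)) (begin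
      σ⁴ * (toℚ 4 * (rate r * rate r)) ≡⟨ cong (σ⁴ *_) (sym w²) ⟩
      σ⁴ * (w * w) ≡⟨ eq₁ σℚ w ⟩
      σℚ * σℚ * (σℚ * w * (σℚ * w)) ≡⟨ cong (λ z → σℚ * σℚ * (z * z)) σw ⟩
      σℚ * σℚ * (qℚ * t * (qℚ * t)) ≡⟨ trans (eq₂ σℚ qℚ t) (cong (_* (t * t)) (sym (trans (fromℕ-* (σ ℕ.* q) (σ ℕ.* q)) (cong (λ z → z * z) (fromℕ-* σ q))))) ⟩
      fromℕ (σ ℕ.* q ℕ.* (σ ℕ.* q)) * (t * t) ≤⟨ *-mono-≤ (fromℕ-nonneg _) (square-nonneg t) (fromℕ-mono (side-upper (modulus σ) r σ (ℕ.≤-trans (ℕ.m≤m⊔n 1 R₁) R≤r) growth≤r)) ≤-refl ⟩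
      fromℕ (suc σ ℕ.* suc σ ℕ.* r) * (t * t) ≡⟨ trans (cong (_* (t * t)) (trans (fromℕ-* (suc σ ℕ.* suc σ) r) (cong (_* rℚ) (fromℕ-* (suc σ) (suc σ))))) (eq₃ (fromℕ (suc σ)) rℚ t) ⟩
      fromℕ (suc σ) * t * (fromℕ (suc σ) * t) * rℚ ≤⟨ *-mono-≤ (*-nonneg 0≤st 0≤st) (fromℕ-nonneg r) (*-mono-≤ 0≤st (≤-trans 0≤st ratio) ratio ratio) ≤-refl ⟩
      Δ * (σℚ * σℚ) * (Δ * (σℚ * σℚ)) * rℚ ≡⟨ eq₄ Δ σℚ rℚ ⟩
      σ⁴ * (Δ * Δ * rℚ) ≡⟨ cong (λ z → σ⁴ * (Δ * Δ * z)) (fromℕ≡toℚ r) ⟩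
      σ⁴ * (Δ * Δ * toℚ r) ∎)
      where
      open ≤-Reasoning
      σ⁴ t : ℚ
      σ⁴ = σℚ * σℚ * (σℚ * σℚ)
      t = fromℕ (σ ℕ.+ 7)
      0≤st : 0ℚ ≤ fromℕ (suc σ) * t
      0≤st = *-nonneg (fromℕ-nonneg (suc σ)) (fromℕ-nonneg (σ ℕ.+ 7))
      eq₁ : ∀ s w → s * s * (s * s) * (w * w) ≡ s * s * (s * w * (s * w))
      eq₁ = solve-∀ ring
      eq₂ : ∀ s q t → s * s * (q * t * (q * t)) ≡ s * q * (s * q) * (t * t)
      eq₂ = solve-∀ ring
      eq₃ : ∀ s r t → s * s * r * (t * t) ≡ s * t * (s * t) * r
      eq₃ = solve-∀ ring
      eq₄ : ∀ d s r → d * (s * s) * (d * (s * s)) * r ≡ s * s * (s * s) * (d * d * r)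
      eq₄ = solve-∀ ring

-- The online algorithm

module Construction (r-1 σ q t : ℕ) (5≤σ : 5 ℕ.≤ σ) (1≤q : 1 ℕ.≤ q) (q≡ : q ≡ parts σ ! ℕ.* t ℕ.+ 1) (r≤q² : suc r-1 ℕ.≤ q ℕ.* q)
  (c : ℚ) (0≤c : 0ℚ ≤ c) (2σc : fromℕ (2 ℕ.* σ) * c ≡ fromℕ (q ℕ.* (σ ℕ.+ 7))) where

  r : ℕ
  r = suc r-1

  open Constants σ q 5≤σ 1≤q

  private instance
    q-nonZero : ℕ.NonZero q
    q-nonZero = ℕ.>-nonZero 1≤q
    k-nonZero : ℕ.NonZero k
    k-nonZero = ℕ.>-nonZero 1≤k
    Q-nonZero : ℕ.NonZero Q
    Q-nonZero = ℕ.>-nonZero 1≤Q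
    σ-nonZero : ℕ.NonZero σ
    σ-nonZero = ℕ.>-nonZero 1≤σ

  open Design q k

  algorithm : OnlineAlg r
  algorithm n hist e = colour r-1 e

  module _ (ε : ℚ) (0<ε : 0ℚ < ε) (δ : ℚ) (0<δ : 0ℚ < δ) where

    C₁ δ′ : ℚ
    C₁ = c + ε + 1ℚ
    δ′ = δ * recip r

    0≤c+ε : 0ℚ ≤ c + ε
    0≤c+ε = +-nonneg (0≤c) (<⇒≤ 0<ε)

    0<δ′ : 0ℚ < δ′
    0<δ′ = *-positive 0<δ (recip-positive r (ℕ.s≤s ℕ.z≤n))

    0<½δ′ : 0ℚ < δ′ * ½
    0<½δ′ = *-positive 0<δ′ (positive⁻¹ ½)

    rδ′ : fromℕ r * δ′ ≡ δ
    rδ′ = trans (eq (fromℕ r) δ (recip r)) (trans (cong (δ *_) (*-recip r (ℕ.s≤s ℕ.z≤n))) (*-identityʳ δ))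
      where eq : ∀ r d i → r * (d * i) ≡ d * (r * i)
            eq = solve-∀ ring

    eventually₀ = eventually 1ℚ ε 0<ε
    eventually₁ = eventually (sℚ + 1ℚ + 2ℚ * M) l 0<l
    eventually₂ = eventually (C₁ * (2ℚ * M * (2ℚ * M))) (l * l * (δ′ * ½)) (*-positive (*-positive 0<l 0<l) 0<½δ′)
    eventually₃ = eventually (C₁ * (2ℚ * 2ℚ)) (1/K * 1/K * (δ′ * ½)) (*-positive (*-positive 0<1/K 0<1/K) 0<½δ′)

    e₀ e₁ e₂ e₃ N₀ : ℕ
    e₀ = proj₁ eventually₀
    e₁ = proj₁ eventually₁
    e₂ = proj₁ eventually₂
    e₃ = proj₁ eventually₃
    N₀ = 2 ℕ.⊔ (σ ℕ.⊔ (e₀ ℕ.⊔ (e₁ ℕ.⊔ (e₂ ℕ.⊔ e₃))))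

    module _ (n : ℕ) (N₀≤n : N₀ ℕ.≤ n) where

      m T₁ T₂ H : ℕ
      m = roundsFor (c + ε) n
      T₂ = n / σ
      T₁ = m ℕ.∸ T₂
      H = n / Q

      2≤n : 2 ℕ.≤ n
      2≤n = ℕ.m⊔n≤o⇒m≤o 2 (σ ℕ.⊔ (e₀ ℕ.⊔ (e₁ ℕ.⊔ (e₂ ℕ.⊔ e₃)))) N₀≤n
      rest₁ : σ ℕ.⊔ (e₀ ℕ.⊔ (e₁ ℕ.⊔ (e₂ ℕ.⊔ e₃))) ℕ.≤ n
      rest₁ = ℕ.m⊔n≤o⇒n≤o 2 (σ ℕ.⊔ (e₀ ℕ.⊔ (e₁ ℕ.⊔ (e₂ ℕ.⊔ e₃)))) N₀≤n
      σ≤n : σ ℕ.≤ n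
      σ≤n = ℕ.m⊔n≤o⇒m≤o σ (e₀ ℕ.⊔ (e₁ ℕ.⊔ (e₂ ℕ.⊔ e₃))) rest₁
      rest₂ : e₀ ℕ.⊔ (e₁ ℕ.⊔ (e₂ ℕ.⊔ e₃)) ℕ.≤ n
      rest₂ = ℕ.m⊔n≤o⇒n≤o σ (e₀ ℕ.⊔ (e₁ ℕ.⊔ (e₂ ℕ.⊔ e₃))) rest₁
      1≤εn : 1ℚ ≤ ε * fromℕ n
      1≤εn = proj₂ eventually₀ n (ℕ.m⊔n≤o⇒m≤o e₀ (e₁ ℕ.⊔ (e₂ ℕ.⊔ e₃)) rest₂)
      rest₃ : e₁ ℕ.⊔ (e₂ ℕ.⊔ e₃) ℕ.≤ n
      rest₃ = ℕ.m⊔n≤o⇒n≤o e₀ (e₁ ℕ.⊔ (e₂ ℕ.⊔ e₃)) rest₂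
      n-large₁ : sℚ + 1ℚ + 2ℚ * M ≤ l * fromℕ n
      n-large₁ = proj₂ eventually₁ n (ℕ.m⊔n≤o⇒m≤o e₁ (e₂ ℕ.⊔ e₃) rest₃)
      rest₄ : e₂ ℕ.⊔ e₃ ℕ.≤ n
      rest₄ = ℕ.m⊔n≤o⇒n≤o e₁ (e₂ ℕ.⊔ e₃) rest₃
      n-large₂ : C₁ * (2ℚ * M * (2ℚ * M)) ≤ l * l * (δ′ * ½) * fromℕ n
      n-large₂ = proj₂ eventually₂ n (ℕ.m⊔n≤o⇒m≤o e₂ e₃ rest₄)
      n-large₃ : C₁ * (2ℚ * 2ℚ) ≤ 1/K * 1/K * (δ′ * ½) * fromℕ n
      n-large₃ = proj₂ eventually₃ n (ℕ.m⊔n≤o⇒n≤o e₂ e₃ rest₄)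

      1≤n : 1 ℕ.≤ n
      1≤n = ℕ.≤-trans (ℕ.s≤s ℕ.z≤n) 2≤n

      0<n : 0ℚ < fromℕ n
      0<n = <-≤-trans 0<1 (1≤fromℕ 1≤n)

      1≤|edges| : 1 ℕ.≤ length (edges n)
      1≤|edges| = nonempty n 2≤n
        where nonempty : ∀ n → 2 ℕ.≤ n → 1 ℕ.≤ length (edges n)
              nonempty (suc (suc n)) _ = ℕ.s≤s ℕ.z≤n
              nonempty (suc zero) (ℕ.s≤s ())

      m≤ : fromℕ m ≤ (c + ε) * fromℕ n
      m≤ = subst (λ z → fromℕ m ≤ (c + ε) * z) (sym (fromℕ≡toℚ n))
        (proj₁ (floor-bounds ((c + ε) * toℚ n) (*-nonneg 0≤c+ε (subst (0ℚ ≤_) (fromℕ≡toℚ n) (fromℕ-nonneg n)))))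

      -- Rounding down costs at most one round, for which ε n ≥ 1 pays.
      ≤m : c * fromℕ n ≤ fromℕ m
      ≤m = ≤-cert ((1ℚ + fromℕ m - (c + ε) * fromℕ n) + (ε * fromℕ n - 1ℚ))
        (+-nonneg (p≤q⇒0≤q-p ≤1+m) (p≤q⇒0≤q-p 1≤εn)) (eq c ε (fromℕ n) (fromℕ m))
        where
        ≤1+m : (c + ε) * fromℕ n ≤ 1ℚ + fromℕ m
        ≤1+m = subst₂ (λ z y → (c + ε) * z ≤ y) (sym (fromℕ≡toℚ n)) (fromℕ-suc m)
          (proj₂ (floor-bounds ((c + ε) * toℚ n) (*-nonneg 0≤c+ε (subst (0ℚ ≤_) (fromℕ≡toℚ n) (fromℕ-nonneg n)))))
        eq : ∀ c e n m → c * n + ((1ℚ + m - (c + e) * n) + (e * n - 1ℚ)) ≡ m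
        eq = solve-∀ ring

      nq[σ+7]≤2σm : q ℕ.* (σ ℕ.+ 7) ℕ.* n ℕ.≤ 2 ℕ.* σ ℕ.* m
      nq[σ+7]≤2σm = fromℕ-cancel-≤ (begin
        fromℕ (q ℕ.* (σ ℕ.+ 7) ℕ.* n) ≡⟨ trans (fromℕ-* (q ℕ.* (σ ℕ.+ 7)) n) (cong (_* fromℕ n) (sym 2σc)) ⟩
        fromℕ (2 ℕ.* σ) * c * fromℕ n ≡⟨ *-assoc (fromℕ (2 ℕ.* σ)) (c) (fromℕ n) ⟩
        fromℕ (2 ℕ.* σ) * (c * fromℕ n) ≤⟨ *-monoˡ (fromℕ (2 ℕ.* σ)) (fromℕ-nonneg (2 ℕ.* σ)) ≤m ⟩
        fromℕ (2 ℕ.* σ) * fromℕ m ≡⟨ sym (fromℕ-* (2 ℕ.* σ) m) ⟩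
        fromℕ (2 ℕ.* σ ℕ.* m) ∎)
        where open ≤-Reasoning

      σT₂≤n : σ ℕ.* T₂ ℕ.≤ n
      σT₂≤n = ℕ.≤-trans (ℕ.≤-reflexive (ℕ.*-comm σ T₂)) (m/n*n≤m n σ)

      -- The origin of the 7 in `rate`: σ + 7 = s + 2, and since T₂ ≤ n / σ ≤ 2 n q / (2σ), the
      -- extra 2 pays for the second phase.
      nqs+2σT₂≤2σm : n ℕ.* q ℕ.* s ℕ.+ 2 ℕ.* σ ℕ.* T₂ ℕ.≤ 2 ℕ.* σ ℕ.* m
      nqs+2σT₂≤2σm = begin
        n ℕ.* q ℕ.* s ℕ.+ 2 ℕ.* σ ℕ.* T₂ ≡⟨ cong (n ℕ.* q ℕ.* s ℕ.+_) (ℕ.*-assoc 2 σ T₂) ⟩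
        n ℕ.* q ℕ.* s ℕ.+ 2 ℕ.* (σ ℕ.* T₂) ≤⟨ ℕ.+-monoʳ-≤ (n ℕ.* q ℕ.* s) (ℕ.*-monoʳ-≤ 2 (ℕ.≤-trans σT₂≤n (ℕ.≤-trans (ℕ.≤-reflexive (sym (ℕ.*-identityʳ n))) (ℕ.*-monoʳ-≤ n 1≤q)))) ⟩
        n ℕ.* q ℕ.* s ℕ.+ 2 ℕ.* (n ℕ.* q) ≡⟨ collect n q σ ⟩
        q ℕ.* (σ ℕ.+ 7) ℕ.* n ≤⟨ nq[σ+7]≤2σm ⟩
        2 ℕ.* σ ℕ.* m ∎
        where
        open ℕ.≤-Reasoning
        collect : ∀ n q σ → n ℕ.* q ℕ.* (σ ℕ.+ 5) ℕ.+ 2 ℕ.* (n ℕ.* q) ≡ q ℕ.* (σ ℕ.+ 7) ℕ.* n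
        collect = ℕ-Solver.solve-∀

      T₂≤m : T₂ ℕ.≤ m
      T₂≤m = ℕ.*-cancelˡ-≤ (2 ℕ.* σ) {{ℕ.m*n≢0 2 σ}} (ℕ.≤-trans (ℕ.m≤n+m (2 ℕ.* σ ℕ.* T₂) (n ℕ.* q ℕ.* s)) nqs+2σT₂≤2σm)

      T₁+T₂ : T₁ ℕ.+ T₂ ≡ m
      T₁+T₂ = ℕ.m∸n+n≡m T₂≤m

      T₁-long : n ℕ.* q ℕ.* s ℕ.≤ 2 ℕ.* T₁ ℕ.* σ
      T₁-long = ℕ.+-cancelʳ-≤ (2 ℕ.* σ ℕ.* T₂) _ _ (ℕ.≤-trans nqs+2σT₂≤2σm (ℕ.≤-reflexive
        (trans (cong (2 ℕ.* σ ℕ.*_) (sym T₁+T₂)) (expand σ T₁ T₂))))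
        where expand : ∀ σ a b → 2 ℕ.* σ ℕ.* (a ℕ.+ b) ≡ 2 ℕ.* a ℕ.* σ ℕ.+ 2 ℕ.* σ ℕ.* b
              expand = ℕ-Solver.solve-∀

      1≤T₁ : 1 ℕ.≤ T₁
      1≤T₁ = nonzero T₁ T₁-long
        where
        nonzero : ∀ T → n ℕ.* q ℕ.* s ℕ.≤ 2 ℕ.* T ℕ.* σ → 1 ℕ.≤ T
        nonzero zero long = contradiction (ℕ.≤-trans (ℕ.*-mono-≤ (ℕ.*-mono-≤ 1≤n 1≤q) 1≤s) long) λ ()
        nonzero (suc T) _ = ℕ.s≤s ℕ.z≤n

      T₂-long : n ℕ.≤ 2 ℕ.* σ ℕ.* T₂
      T₂-long = begin
        n ≡⟨ m≡m%n+[m/n]*n n σ ⟩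
        n % σ ℕ.+ T₂ ℕ.* σ ≤⟨ ℕ.+-monoˡ-≤ (T₂ ℕ.* σ) (ℕ.<⇒≤ (m%n<n n σ)) ⟩
        σ ℕ.+ T₂ ℕ.* σ ≤⟨ ℕ.+-monoˡ-≤ (T₂ ℕ.* σ) (ℕ.≤-trans (ℕ.≤-reflexive (sym (ℕ.*-identityˡ σ))) (ℕ.*-monoˡ-≤ σ (m≥n⇒m/n>0 σ≤n))) ⟩
        T₂ ℕ.* σ ℕ.+ T₂ ℕ.* σ ≡⟨ collect T₂ σ ⟩
        2 ℕ.* σ ℕ.* T₂ ∎
        where
        open ℕ.≤-Reasoning
        collect : ∀ t σ → t ℕ.* σ ℕ.+ t ℕ.* σ ≡ 2 ℕ.* σ ℕ.* t
        collect = ℕ-Solver.solve-∀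

      m≤Cn : fromℕ m ≤ C₁ * fromℕ n
      m≤Cn = ≤-trans m≤ (*-mono-≤ 0≤c+ε (fromℕ-nonneg n) (≤-cert 1ℚ 0≤1 refl) ≤-refl)

      QH≤n : Q ℕ.* H ℕ.≤ n
      QH≤n = ℕ.≤-trans (ℕ.≤-reflexive (ℕ.*-comm Q H)) (m/n*n≤m n Q)

      n≤QH : n ℕ.≤ Q ℕ.* suc H
      n≤QH = ℕ.≤-trans (ℕ.≤-reflexive (m≡m%n+[m/n]*n n Q)) (ℕ.≤-trans (ℕ.+-monoˡ-≤ (H ℕ.* Q) (ℕ.<⇒≤ (m%n<n n Q))) (ℕ.≤-reflexive (ℕ.*-comm (suc H) Q)))

      α : Fin r → Fin n → Bool
      α col v = onLine (toℕ col) (toℕ v)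

      partOf : Fin n → ℕ
      partOf v = part (toℕ v)

      module Colour (col : Fin r) = Whp C₁ δ′ (<⇒≤ 0<δ′) n (α col) partOf H T₁ T₂
        (recip (length (edges n))) (recip-nonneg (length (edges n))) (*-recip (length (edges n)) 1≤|edges|)
        (line-large (toℕ col) n H QH≤n) (line-small-in-parts (toℕ col) n (suc H) n≤QH)
        QH≤n n≤QH 1≤T₁ T₁-long T₂-long
        (≤-trans (fromℕ-mono (ℕ.m∸n≤m m T₂)) m≤Cn) (≤-trans (fromℕ-mono T₂≤m) m≤Cn) n-large₁ n-large₂ n-large₃ 0<n

      final : Fin r → Vec (Edge n) m → Fin n → Fin n
      final col es = steps (Components.next n (α col) partOf) id es

      g : Fin r → Vec (Edge n) m → Bool
      g col es = Colour.good col (final col es)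

      few : ∀ col → ∑ (sequences (edges n) m) (λ es → ⟦ not (g col es) ⟧) ≤ pow (fromℕ (length (edges n))) m * δ′
      few col = ≤-trans (≤-reflexive (Colour.sequences-Exp col m (λ lab → ⟦ not (Colour.good col lab) ⟧) id))
        (*-monoˡ _ (pow-nonneg m (fromℕ-nonneg (length (edges n))))
          (subst (λ m → Colour.Exp col m (λ lab → ⟦ not (Colour.good col lab) ⟧) id ≤ δ′) T₁+T₂ (Colour.failure col)))

      sound : ∀ es → (∀ col → g col es ≡ true) → ∀ col → HasComponentOfOrder≥ (run algorithm n (toList es)) col (l * toℚ n)
      sound es good col = subst (λ z → HasComponentOfOrder≥ G col (l * z)) (fromℕ≡toℚ n)
        (component (α col) partOf (final col es) (steps-sound (α col) partOf es id own-colour (λ { u .u refl → here }))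
          (proj₁ large) (proj₂ (proj₂ large)))
        where
        G : List (Edge n × Fin r)
        G = run algorithm n (toList es)
        open Connectivity G col
        large : ∃ λ v → α col v ≡ true × l * fromℕ n ≤ fromℕ (Components.size n (α col) partOf (final col es) v)
        large = does-true (Colour.large? col (final col es)) (good col)
        own-colour : ∀ e → e ∈ₗ toList es → Components.allowed n (α col) partOf (source e) (target e) ≡ true → (e , col) ∈ₗ G
        own-colour e e∈ ok = subst (λ c → (e , c) ∈ₗ G)
          (colour-line t q≡ r-1 r≤q² e col on-source (proj₁ ok′)
            (does-false (part (toℕ (source e)) ℕ.≟ part (toℕ (target e))) (Bool.not-injective (proj₂ ok′))))
          (∈-runFrom (colour r-1) algorithm (λ _ _ → refl) [] e∈)
          where
          on-source : α col (source e) ≡ true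
          on-source = proj₁ (∧-true {α col (source e)} ok)
          ok′ : α col (target e) ≡ true × not (does (part (toℕ (source e)) ℕ.≟ part (toℕ (target e)))) ≡ true
          ok′ = ∧-true {α col (target e)} (proj₂ (∧-true {α col (source e)} ok))

      whp : ProbAtLeast n m (λ es → ∀ col → HasComponentOfOrder≥ (run algorithm n (toList es)) col (l * toℚ n)) (1ℚ - δ)
      whp = subst (λ d → ProbAtLeast n m (λ es → ∀ col → HasComponentOfOrder≥ (run algorithm n (toList es)) col (l * toℚ n)) (1ℚ - d)) rδ′
        (probAtLeast n m r g _ δ′ sound few)

online : ∀ r-1 → let r = suc r-1 in Σ (OnlineAlg r) λ alg → ∀ ε → 0ℚ < ε → Σ ℚ λ cε → 0ℚ < cε ×
  WHP (roundsFor (rate r + ε)) (λ n es → ∀ (col : Fin r) → HasComponentOfOrder≥ (run alg n (toList es)) col (cε * toℚ n))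
-- The proportion `l` = 1 / (q k) depends on r alone; ε influences only the number of rounds and the
-- threshold `N₀`.
online r-1 = algorithm , λ ε 0<ε → l , 0<l , λ δ 0<δ → N₀ ε 0<ε δ 0<δ , whp ε 0<ε δ 0<δ
  where
  r : ℕ
  r = suc r-1
  open Constants (sigma r) (points r) (slow≥5 growth r) (1≤points r) using (l; 0<l)
  open Construction r-1 (sigma r) (points r) (proj₁ (side-≡1 (modulus (sigma r)) r)) (slow≥5 growth r) (1≤points r)
    (proj₂ (side-≡1 (modulus (sigma r)) r)) (side-large (modulus (sigma r)) r (ℕ.1≤n! (parts (sigma r))))
    (rate r) (rate-nonneg r) (2σ*rate r) using (algorithm; N₀; whp)

theorem1p5 : Σ (ℕ → ℚ) λ c → AsympSqrtHalf c ×
    (∀ (r : ℕ) → 2 ℕ.≤ r → Σ (OnlineAlg r) λ alg →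
    ∀ (ε : ℚ) → 0ℚ ℚ.< ε → Σ ℚ λ cε → 0ℚ ℚ.< cε ×
    WHP (roundsFor (c r ℚ.+ ε))
    (λ n es → ∀ (col : Fin r) → HasComponentOfOrder≥ (run alg n (toList es)) col (cε ℚ.* toℚ n)))
theorem1p5 = rate , rate-asymptotic , λ where
  zero ()
  (suc r-1) _ → online r-1
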